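{- Let $\lambda/\mu$ be a skew partition with $\mathrm{rank}(\lambda/\mu)=r$, and let $\mathcal{I}_0=\{(w_1,y_1),\ldots,(w_r,y_r)\}$ be its noncrossing interval set. Then \[ y(\lambda/\mu)=(-1)^{z(\lambda/\mu)}\det(d_{ij})_{i,j=1}^r,\qquad d_{ij}=\begin{cases}\dfrac{1}{y_j-w_i}, & y_j>w_i,\\[4pt] 0, & y_j<w_i.\end{cases} \]
   Context: A partition $\lambda$ has Young diagram $\{(i,j):1\le i\le\ell(\lambda),1\le j\le\lambda_i\}$; for $\mu\subseteq\lambda$ the skew partition $\lambda/\mu$ has diagram the diagram of $\lambda$ minus that of $\mu$. A border strip is a connected skew shape with no $2\times2$ square; its height is one less than its number of rows. A border strip $B\subseteq\lambda/\mu$ is a border strip of $\lambda/\mu$ if $\lambda/\mu-B$ is a skew partition $\nu/\mu$; it is maximal if it is not properly contained in another border strip of $\lambda/\mu$. $\mathrm{rank}(\lambda/\mu)$ is the minimal number of border strips into which the diagram of $\lambda/\mu$ can be partitioned. A greedy border strip decomposition of $\lambda/\mu$ is obtained by successively removing a maximal border strip from the current skew shape; it consists of $r$ border strips, and $z(\lambda/\mu)$ denotes the sum of the heights of its strips (this sum is determined by the shape $\lambda/\mu$). $s_{\lambda/\mu}(1^t)$ is the skew Schur function evaluated at $x_1=\cdots=x_t=1$, $x_i=0$ for $i>t$, a polynomial in $t$ divisible by $t^r$; $y(\lambda/\mu)=(t^{ -r}s_{\lambda/\mu}(1^t))_{t=0}$. Snakes and interval sets: let $e_1,\ldots,e_k$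 be the edges of the bottom-right boundary lattice path of the diagram of $\lambda/\mu$ (unit steps up or right) from its bottom-leftmost to its top-rightmost point. For an edge $e$, if no square has $e$ as an edge, $S_e=\emptyset$; otherwise with $(i,j)$ the unique square having $e$ as an edge, $S_e=\lambda/\mu\cap\{(i,j),(i-1,j),(i-1,j-1),(i-2,j-1),\ldots\}$ if $e$ is horizontal, $S_e=\lambda/\mu\cap\{(i,j),(i,j-1),(i-1,j-1),(i-1,j-2),\ldots\}$ if $e$ is vertical. The length of a snake is its number of squares minus one; a right (left) snake is one of even length from a horizontal (vertical) edge. The snake sequence $q_1\cdots q_k$ records $L_m$ for a left snake of length $2m$, $R_m$ for a right snake of length $2m$, $O$ for odd length; it has exactly $r$ $L$'s and $r$ $R$'s. An interval set is a set of $r$ pairs $(u_i,v_i)$ with distinct $u_i$, distinct $v_i$, $1\le u_i<v_i\le k$, $u_i\ne v_j$ for all $i,j$, $q_{u_i}$ an $L$ and $q_{v_i}$ an $R$. The noncrossing interval set $\mathcal{I}_0$ is the unique interval set having no pairs $(i,j)$ with $u_i<u_j<v_i<v_j$. (Note $y_j\ne w_i$ for all $i,j$.)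
   Formalization: "Horizontal" and "vertical" are exchanged in the definition of snakes: bottom edges carry (i,j),(i,j-1),... and give L; right edges carry (i,j),(i-1,j),... and give R. As written, the formula would give y = -1 instead of -1/3 for the shape (2,1). -}

module Defs where

open import Data.Nat using (ℕ; zero; suc; _+_; _∸_; _≤_; _<_; _<ᵇ_; _≡ᵇ_; _≤ᵇ_)
open import Data.Bool using (Bool; true; false; if_then_else_; _∧_; T)
open import Data.List using (List; []; _∷_; map; concatMap; upTo; length; filter; foldr; reverse; zip)
open import Data.Nat.ListAction using (sum)
open import Data.List.Relation.Unary.Linked using (Linked)
open import Data.List.Relation.Unary.All using (All)
open import Data.List.Relation.Unary.Unique.Propositional using (Unique)
open import Data.List.Membership.Propositional using (_∈_)
open import Data.Vec using (Vec; toList; lookup)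
open import Data.Fin using (Fin; punchIn; toℕ) renaming (zero to fz; suc to fs)
open import Data.Product using (Σ; _×_; _,_; proj₁; proj₂; ∃)
open import Data.Maybe using (Maybe; just; nothing)
open import Relation.Binary.PropositionalEquality using (_≡_; _≢_)
open import Relation.Nullary using (¬_)
open import Data.Integer using (+_)
open import Data.Rational using (ℚ; 0ℚ; 1ℚ) renaming (_+_ to _+ℚ_; _*_ to _*ℚ_; -_ to -ℚ_; _/_ to _/ℚ_)

-- Partitions and skew shapes
-- A partition is a weakly decreasing list of naturals (trailing zeros
-- allowed; they contribute no cells).  Rows/columns are 1-based,
-- English convention (row 1 on top), as in the paper.

IsPartition : List ℕ → Set
IsPartition = Linked (λ a b → b ≤ a)

row : List ℕ → ℕ → ℕ
row xs zero = 0
row [] (suc i) = 0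
row (x ∷ xs) (suc zero) = x
row (x ∷ xs) (suc (suc i)) = row xs (suc i)

_⊆ₚ_ : List ℕ → List ℕ → Set
μ ⊆ₚ λ' = ∀ i → row μ i ≤ row λ' i

Cell : Set
Cell = ℕ × ℕ

-- (i , j) lies in the diagram of α/β  (row 0 is never a row)
_∈S_ : Cell → List ℕ × List ℕ → Set
(i , j) ∈S (α , β) = (row β i < j) × (j ≤ row α i)

memb : List ℕ × List ℕ → Cell → Bool
memb (α , β) (i , j) = (row β i <ᵇ j) ∧ (j ≤ᵇ row α i)

between : ℕ → ℕ → List ℕ
between a b = map (λ k → a + suc k) (upTo (b ∸ a))

cells : List ℕ × List ℕ → List Cell
cells (α , β) = concatMap (λ i → map (λ j → (i , j)) (between (row β i) (row α i))) (between 0 (length α))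

Adjacent : Cell → Cell → Set
Adjacent (i , j) (i' , j') =
  ((i ≡ i') × ((suc j ≡ j') ⊎' (j ≡ suc j'))) ⊎' ((j ≡ j') × ((suc i ≡ i') ⊎' (i ≡ suc i')))
  where
    open import Data.Sum using () renaming (_⊎_ to _⊎'_)

data Reach (S : List ℕ × List ℕ) : Cell → Cell → Set where
  here : ∀ {c} → Reach S c c
  step : ∀ {c c' d} → Adjacent c c' → c' ∈S S → Reach S c' d → Reach S c d

Connected : List ℕ × List ℕ → Set
Connected S = ∀ c d → c ∈S S → d ∈S S → Reach S c d

NonEmpty : List ℕ × List ℕ → Set
NonEmpty S = ∃ λ c → c ∈S S

No2x2 : List ℕ × List ℕ → Set
No2x2 S = ¬ (∃ λ i → ∃ λ j → ((i , j) ∈S S) × ((i , suc j) ∈S S) × ((suc i , j) ∈S S) × ((suc i , suc j) ∈S S))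

IsBorderStrip : List ℕ × List ℕ → Set
IsBorderStrip S = NonEmpty S × Connected S × No2x2 S

SkewBorderStrip : List ℕ × List ℕ → Set
SkewBorderStrip (α , β) = IsPartition α × IsPartition β × (β ⊆ₚ α) × IsBorderStrip (α , β)

multiplicity : Cell → List (List ℕ × List ℕ) → ℕ
multiplicity c D = length (filter (λ S → T? (memb S c)) D)
  where
    open import Relation.Nullary.Decidable using () renaming (T? to T?)

indicator : Bool → ℕ
indicator true = 1
indicator false = 0

IsBSDecomposition : List ℕ → List ℕ → List (List ℕ × List ℕ) → Set
IsBSDecomposition lam mu D =
  All SkewBorderStrip D × (∀ c → multiplicity c D ≡ indicator (memb (lam , mu) c))

IsRank : List ℕ → List ℕ → ℕ → Set
IsRank lam mu r =
  (∃ λ D → (length D ≡ r) × IsBSDecomposition lam mu D)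
  × (∀ D → IsBSDecomposition lam mu D → r ≤ length D)

-- Greedy border strip decompositions
-- A border strip of cur/mu is cur/ν with ν a partition, mu ⊆ ν ⊆ cur
-- (so that cur/mu − B = ν/mu).

IsBSOf : List ℕ → List ℕ → List ℕ → Set
IsBSOf cur mu ν = IsPartition ν × (mu ⊆ₚ ν) × (ν ⊆ₚ cur) × IsBorderStrip (cur , ν)

IsMaximalBSOf : List ℕ → List ℕ → List ℕ → Set
IsMaximalBSOf cur mu ν =
  IsBSOf cur mu ν ×
  (∀ ν' → IsBSOf cur mu ν' → (∀ c → c ∈S (cur , ν) → c ∈S (cur , ν')) →
          (∀ c → c ∈S (cur , ν') → c ∈S (cur , ν)))

data GreedyDec (mu : List ℕ) : List ℕ → List (List ℕ × List ℕ) → Set where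
  done : ∀ {cur} → (∀ i → row cur i ≡ row mu i) → GreedyDec mu cur []
  step : ∀ {cur ν G} → IsMaximalBSOf cur mu ν → GreedyDec mu ν G →
         GreedyDec mu cur ((cur , ν) ∷ G)

height : List ℕ × List ℕ → ℕ
height (α , β) = length (filter (λ i → T? (row β i <ᵇ row α i)) (between 0 (length α))) ∸ 1
  where
    open import Relation.Nullary.Decidable using () renaming (T? to T?)

zOf : List (List ℕ × List ℕ) → ℕ
zOf G = sum (map height G)

fillings : ℕ → ℕ → List (List ℕ)
fillings t zero = [] ∷ []
fillings t (suc n) = concatMap (λ v → map (v ∷_) (fillings t n)) (between 0 t)

okPair : Cell × ℕ → Cell × ℕ → Bool
okPair ((i , j) , a) ((i' , j') , b) =
  (if (i ≡ᵇ i') ∧ (j <ᵇ j') then a ≤ᵇ b else true) ∧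
  (if (j ≡ᵇ j') ∧ (i <ᵇ i') then a <ᵇ b else true)

isSSYT : List Cell → List ℕ → Bool
isSSYT cs vs = allB (λ x → allB (λ y → okPair x y) zs) zs
  where
    zs = zip cs vs
    allB : (Cell × ℕ → Bool) → List (Cell × ℕ) → Bool
    allB f xs = foldr (λ x b → f x ∧ b) true xs

-- number of SSYT of shape lam/mu with entries ≤ t, i.e. s_{lam/mu}(1^t)
ssytCount : List ℕ → List ℕ → ℕ → ℕ
ssytCount lam mu t =
  length (filter (λ f → T? (isSSYT (cells (lam , mu)) f)) (fillings t (length (cells (lam , mu)))))
  where
    open import Relation.Nullary.Decidable using () renaming (T? to T?)

ℕtoℚ : ℕ → ℚ
ℕtoℚ n = (+ n) /ℚ 1

evalP : List ℚ → ℚ → ℚ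
evalP [] x = 0ℚ
evalP (a ∷ p) x = a +ℚ (x *ℚ evalP p x)

coeff : List ℚ → ℕ → ℚ
coeff [] i = 0ℚ
coeff (a ∷ p) zero = a
coeff (a ∷ p) (suc i) = coeff p i

-- Bot i j : the bottom edge of cell (i,j) (a unit step right);
-- Rgt i j : the right edge of cell (i,j) (a unit step up).
-- READING: the edge the paper calls "horizontal" (snake
-- (i,j),(i-1,j),(i-1,j-1),...) is Rgt, the one it calls "vertical"
-- (snake (i,j),(i,j-1),(i-1,j-1),...) is Bot, i.e. an edge is named by
-- the direction in which it separates two squares.
data Edge : Set where
  Bot : ℕ → ℕ → Edge
  Rgt : ℕ → ℕ → Edge

lastOr : ℕ → List ℕ → ℕ
lastOr d [] = d
lastOr d (x ∷ xs) = lastOr x xs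

headOr : ℕ → List ℕ → ℕ
headOr d [] = d
headOr d (x ∷ _) = x

nonemptyRows : List ℕ → List ℕ → List ℕ
nonemptyRows lam mu = filter (λ i → T? (row mu i <ᵇ row lam i)) (between 0 (length lam))
  where
    open import Relation.Nullary.Decidable using () renaming (T? to T?)

-- bottom-right boundary path of lam/mu from its bottom-leftmost point to
-- its top-rightmost point (unit steps right / up): for each row i from
-- the lowest nonempty row imax up to the highest imin, the bottom
-- boundary edges of row i followed by the right edge of (i,lam_i)
boundaryPath : List ℕ → List ℕ → List Edge
boundaryPath lam mu with nonemptyRows lam mu
... | [] = []
... | rs@(_ ∷ _) =
  concatMap rowEdges (reverse (between (imin ∸ 1) imax))
  where
    imin = headOr 0 rs
    imax = lastOr 0 rs
    lo : ℕ → ℕ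
    lo i = if i ≡ᵇ imax then row mu imax else row lam (suc i)
    rowEdges : ℕ → List Edge
    rowEdges i = foldr _∷_ (Rgt i (row lam i) ∷ []) (map (Bot i) (between (lo i) (row lam i)))

-- |S_e|: number of squares of the snake starting at edge e
-- (the square (i,j) is the unique square of lam/mu having e as an edge,
-- if it lies in lam/mu; otherwise S_e is empty)
snakeSize : List ℕ → List ℕ → Edge → ℕ
snakeSize lam mu (Rgt i j) =
  if memb (lam , mu) (i , j)
  then length (filter (λ c → T? (memb (lam , mu) c)) (map hc (upTo (suc (i + j))))) else 0
  where
    open import Relation.Nullary.Decidable using () renaming (T? to T?)
    open import Data.Nat using (_/_; _%_)
    hc : ℕ → Cell
    hc n = if n % 2 ≡ᵇ 0 then (i ∸ (n / 2) , j ∸ (n / 2)) else (i ∸ suc (n / 2) , j ∸ (n / 2))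
snakeSize lam mu (Bot i j) =
  if memb (lam , mu) (i , j)
  then length (filter (λ c → T? (memb (lam , mu) c)) (map vc (upTo (suc (i + j))))) else 0
  where
    open import Relation.Nullary.Decidable using () renaming (T? to T?)
    open import Data.Nat using (_/_; _%_)
    vc : ℕ → Cell
    vc n = if n % 2 ≡ᵇ 0 then (i ∸ (n / 2) , j ∸ (n / 2)) else (i ∸ (n / 2) , j ∸ suc (n / 2))

data Letter : Set where
  L : ℕ → Letter
  R : ℕ → Letter
  O : Letter

-- a snake of s squares has length s − 1 (the empty snake has length −1,
-- which is odd); even length 2m gives R_m ("horizontal" edge) or
-- L_m ("vertical" edge)
letterOf : Edge → ℕ → Letter
letterOf e zero = O
letterOf e (suc s) with s Data.Nat.% 2
  where open import Data.Nat
... | zero = lr e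
  where
    open import Data.Nat using (_/_)
    lr : Edge → Letter
    lr (Rgt _ _) = R (s / 2)
    lr (Bot _ _) = L (s / 2)
... | suc _ = O

snakeSeq : List ℕ → List ℕ → List Letter
snakeSeq lam mu = map (λ e → letterOf e (snakeSize lam mu e)) (boundaryPath lam mu)

letterAt : List Letter → ℕ → Letter
letterAt q zero = O
letterAt [] (suc u) = O
letterAt (x ∷ q) (suc zero) = x
letterAt (x ∷ q) (suc (suc u)) = letterAt q (suc u)

IsL : Letter → Set
IsL l = ∃ λ m → l ≡ L m

IsR : Letter → Set
IsR l = ∃ λ m → l ≡ R m

IsIntervalSet : List ℕ → List ℕ → (r : ℕ) → Vec (ℕ × ℕ) r → Set
IsIntervalSet lam mu r I =
  All (λ p → (1 ≤ proj₁ p) × (proj₁ p < proj₂ p) × (proj₂ p ≤ length q)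
             × IsL (letterAt q (proj₁ p)) × IsR (letterAt q (proj₂ p))) (toList I)
  × Unique (map proj₁ (toList I)) × Unique (map proj₂ (toList I))
  × (∀ p p' → p ∈ toList I → p' ∈ toList I → proj₁ p ≢ proj₂ p')
  where q = snakeSeq lam mu

NonCrossing : {r : ℕ} → Vec (ℕ × ℕ) r → Set
NonCrossing I = ∀ p p' → p ∈ toList I → p' ∈ toList I →
  ¬ ((proj₁ p < proj₁ p') × (proj₁ p' < proj₂ p) × (proj₂ p < proj₂ p'))

IsNoncrossingIntervalSet : List ℕ → List ℕ → (r : ℕ) → Vec (ℕ × ℕ) r → Set
IsNoncrossingIntervalSet lam mu r I = IsIntervalSet lam mu r I × NonCrossing I

sgn : ℕ → ℚ
sgn zero = 1ℚ
sgn (suc n) = -ℚ (sgn n)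

det : (n : ℕ) → (Fin n → Fin n → ℚ) → ℚ
det zero M = 1ℚ
det (suc n) M = foldr _+ℚ_ 0ℚ (map term (Data.List.allFin (suc n)))
  where
    term : Fin (suc n) → ℚ
    term j = sgn (toℕ j) *ℚ (M fz j *ℚ det n (λ a b → M (fs a) (punchIn j b)))

recipℕ : ℕ → ℚ
recipℕ zero = 0ℚ
recipℕ (suc n) = (+ 1) /ℚ (suc n)

dMatrix : {r : ℕ} → Vec (ℕ × ℕ) r → Fin r → Fin r → ℚ
dMatrix I i j =
  if proj₁ (lookup I i) <ᵇ proj₂ (lookup I j)
  then recipℕ (proj₂ (lookup I j) ∸ proj₁ (lookup I i)) else 0ℚ

{-# OPTIONS --safe #-}
module Submission where

-- Write N = ℓ(λ), A = {λᵢ + N - i} and B = {μᵢ + N - i} (the beads of λ and μ).  By Jacobi-Trudi,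
-- s_{λ/μ}(1^t) is the determinant of the matrix h_{a-b}(1^t) with b ∈ B and a ∈ A, where h_n(1^t) is 1
-- for n = 0 and t/n + O(t²) for n > 0.  The rows b ∈ B \ A are therefore divisible by t, the other rows
-- are unit vectors at t = 0, and what is left of the quotient at t = 0 is ± the determinant of 1/(a-b)
-- with b ∈ B \ A and a ∈ A \ B.
--
-- Jacobi-Trudi at 1^t follows by induction on t: subtracting consecutive rows turns the determinant for
-- t + 1 into the sum of the determinants for t over all ν such that ν/μ is a horizontal strip, the strip
-- of the entries 1 of a tableau.
--
-- The snakes mark the elements of B \ A by L and those of A \ B by R.  Removing a border strip moves one
-- bead from a to b < a and jumps over as many beads as its height, so a greedy decomposition yields a
-- matching of sign (-1)^z.  A maximal strip is the rim of a connected component: (b, a] is a maximal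
-- interval of positions x such that A has more elements ≥ x than B, and a noncrossing matching pairs the
-- ends of such an interval.  Finally, counting cells on diagonals shows that every decomposition
-- into border strips has a strip starting at each L, so the r pairs of the matching exhaust all L and R.

open import Defs
open import Data.Bool using (Bool; true; false; if_then_else_; _∧_; not; T)
open import Data.Bool.Properties using (T-∧; T-≡; not-involutive)
open import Data.Empty using (⊥; ⊥-elim)
open import Data.Fin using (Fin; punchIn; toℕ) renaming (zero to fzero; suc to fsuc)
open import Data.List
  using (List; []; _∷_; _++_; map; length; concat; concatMap; foldr; tabulate; filter; zip; upTo; reverse;
    applyUpTo)
open import Data.List.Membership.Propositional using (_∈_; _∉_; find; lose)
open import Data.List.Membership.Propositional.Properties
  using (∈-map⁺; ∈-map⁻; ∈-concatMap⁺; ∈-concatMap⁻; ∈-++⁻; ∈-++⁺ˡ; ∈-++⁺ʳ; ∈-filter⁺; ∈-filter⁻; ∈-upTo⁺;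
    ∈-upTo⁻; ∈-∃++)
open import Data.List.Properties
  using (++-assoc; ++-identityʳ; length-++; length-map; map-++; map-id; map-cong; map-∘; map-tabulate;
    tabulate-cong; map-upTo; upTo-∷ʳ; reverse-++; ∷-injectiveˡ;
    ∷-injectiveʳ) renaming (≡-dec to ≡-decList)
open import Data.List.Relation.Binary.Permutation.Propositional as Perm
  using (_↭_; ↭-refl; ↭-trans; ↭-sym; ↭-prep; ↭⇒↭ₛ)
open import Data.List.Relation.Binary.Permutation.Propositional.Properties
  using (shift; ↭-length; ∈-resp-↭; ++-comm) renaming (map⁺ to ↭-map⁺)
open import Data.List.Relation.Binary.Pointwise as Pw using (Pointwise; []; _∷_)
open import Data.List.Relation.Unary.All as All using (All; []; _∷_)
open import Data.List.Relation.Unary.All.Properties using (All¬⇒¬Any)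
open import Data.List.Relation.Unary.AllPairs using (AllPairs; []; _∷_)
open import Data.List.Relation.Unary.AllPairs.Properties using () renaming (filter⁺ to pairs-filter⁺)
open import Data.List.Relation.Unary.Any using (Any) renaming (here to aHere; there to aThere)
open import Data.List.Relation.Unary.Linked as Linked using (Linked; []; [-]; _∷_)
open import Data.List.Relation.Unary.Unique.Propositional using (Unique)
open import Data.Nat
  using (ℕ; zero; suc; pred; _+_; _∸_; _/_; _%_; _≤_; _<_; _≥_; z≤n; s≤s; _≤?_; _<?_; _≟_; _≡ᵇ_; _<ᵇ_;
    _≤ᵇ_) renaming (_*_ to _*ℕ_)
open import Data.Nat.DivMod using (m≡m%n+[m/n]*n; m*n%n≡0; m*n/n≡m; m/n≡1+[m∸n]/n)
open import Data.Nat.ListAction using (sum)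
open import Data.Nat.Properties
  using (+-suc; +-comm; +-assoc; +-identityʳ; *-comm; *-zeroʳ; suc-injective; m+[n∸m]≡n; m+n∸m≡n;
    +-∸-assoc; [m+n]∸[m+o]≡n∸o; m≤n⇒m∸n≡0; m∸n≤m; m≤n+m∸n; m∸n≢0⇒n<m; m<n⇒0<n∸m; m+n≤o⇒m≤o∸n; m≤o∸n⇒m+n≤o;
    m≤n+o⇒m∸n≤o; ∸-monoˡ-<; ∸-monoˡ-≤; ∸-monoʳ-≤; ∸-monoʳ-<; +-cancelʳ-≡; +-cancelˡ-≡; +-cancelʳ-≤;
    +-cancelˡ-<; ≤-refl; ≤-reflexive; ≤-trans; ≤-antisym; ≤-pred; <⇒≤; <⇒≢; <-cmp; <-irrefl; <-trans;
    <-asym; ≤-<-trans; ≤∧≢⇒<; ≰⇒>; ≮⇒≥; n<1+n; n≤1+n; n≤0⇒n≡0; m≤m+n; m≤n+m; m≤n⇒m≤1+n; m<n⇒n≢0; +-mono-≤;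
    +-mono-≤-<; +-mono-<-≤; +-monoˡ-<; +-monoˡ-≤; +-monoʳ-≤; +-monoʳ-<; ≡ᵇ⇒≡; ≡⇒≡ᵇ; <ᵇ⇒<; <⇒<ᵇ; ≤ᵇ⇒≤; ≤⇒≤ᵇ;
    pred-cancel-<)
open import Data.Product using (Σ; ∃; ∃₂; _×_; _,_; proj₁; proj₂)
open import Data.Product.Properties using (≡-dec; ,-injectiveˡ; ,-injectiveʳ)
open import Data.Rational using (ℚ; 0ℚ; 1ℚ; _*_; _-_) renaming (_+_ to _+ℚ_; -_ to -ℚ_)
open import Data.Sum using (_⊎_; inj₁; inj₂)
open import Data.Unit using (⊤; tt)
open import Data.Vec using (Vec; []; _∷_; toList; lookup)
open import Data.Vec.Properties using (length-toList)
open import Function using (_∘_; case_of_)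
open import Relation.Binary.Definitions using (tri<; tri≈; tri>)
open import Relation.Binary.PropositionalEquality
  using (_≡_; _≢_; refl; sym; trans; cong; cong₂; subst; subst₂; setoid; module ≡-Reasoning)
open import Relation.Nullary using (¬_; Dec; yes; no)
open import Relation.Nullary.Decidable using (T?)
import Data.Integer as ℤ
import Data.Integer.Properties as ℤ
import Data.List.Relation.Binary.Permutation.Setoid.Properties as Permₛ
import Data.List.Relation.Unary.Unique.Propositional.Properties as Unique
import Data.Nat.Solver
import Data.Rational as ℚ
import Data.Rational.Properties as ℚ
import Data.Rational.Solver
import Data.Rational.Unnormalised as ℚᵘ
import Data.Rational.Unnormalised.Properties as ℚᵘ
import Function
open Function.Equivalence using (to; from)
open Data.Rational.Solver.+-*-Solver using (solve; _:=_; _:+_; _:*_; :-_; _:-_; con)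
module ℕS = Data.Nat.Solver.+-*-Solver
open ≡-Reasoning

-- The sign is the obstacle. The determinant has to be read with rows and columns in matched order,
-- and the permutation doing this is defined by the pairs, while z is defined by the intermediate
-- shapes of a greedy removal. The two meet by relabelling: `φ` replaces each bead a that ends a
-- pair by its start b and fixes the others, and an alternating function of the relabelled beads is
-- followed along the removal. As `φ` gives a and b the same label, one removal only carries this
-- label past the beads jumped over. For this, (b, a) must be one of the pairs still present, and
-- the rest must again be noncrossing with the right cover. Shapes and matchings communicate only
-- through tail counts, the number of beads that are at least x: these see how often x is covered,
-- but not how starts and ends are paired. So a decomposition whose strips come in no particular
-- order still identifies the cover of the given pairs. The entries 1/(a-b) come from h_n(1^t) =
-- t(t+1)...(t+n-1)/n!, whose linear coefficient is (n-1)!/n!.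

variable
  X Y : Set

-- Finite sums, and determinants as iterated contractions

ΣL : (X → ℚ) → List X → ℚ
ΣL f []       = 0ℚ
ΣL f (x ∷ xs) = f x +ℚ ΣL f xs

ΣL-cong : {f g : X → ℚ} → (∀ x → f x ≡ g x) → ∀ xs → ΣL f xs ≡ ΣL g xs
ΣL-cong e []       = refl
ΣL-cong e (x ∷ xs) = cong₂ _+ℚ_ (e x) (ΣL-cong e xs)

ΣL-++ : (f : X → ℚ) → ∀ xs ys → ΣL f (xs ++ ys) ≡ ΣL f xs +ℚ ΣL f ys
ΣL-++ f []       ys = sym (ℚ.+-identityˡ _)
ΣL-++ f (x ∷ xs) ys = trans (cong (f x +ℚ_) (ΣL-++ f xs ys))
  (solve 3 (λ a b c → a :+ (b :+ c) := (a :+ b) :+ c) refl (f x) (ΣL f xs) (ΣL f ys))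

ΣL-map : (f : Y → ℚ) (g : X → Y) → ∀ xs → ΣL f (map g xs) ≡ ΣL (f ∘ g) xs
ΣL-map f g []       = refl
ΣL-map f g (x ∷ xs) = cong (f (g x) +ℚ_) (ΣL-map f g xs)

ΣL-concatMap : (f : Y → ℚ) (g : X → List Y) → ∀ xs → ΣL f (concatMap g xs) ≡ ΣL (λ x → ΣL f (g x)) xs
ΣL-concatMap f g []       = refl
ΣL-concatMap f g (x ∷ xs) = trans (ΣL-++ f (g x) (concatMap g xs)) (cong (ΣL f (g x) +ℚ_) (ΣL-concatMap f g xs))

-- ι f is the contraction with the covector f; iterated contraction expands the determinant of the
-- matrix (f x) with rows f and columns x along its first row.

ι : (X → ℚ) → (List X → ℚ) → List X → ℚ
ι f Φ []       = 0ℚ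
ι f Φ (x ∷ xs) = f x * Φ xs - ι f (Φ ∘ (x ∷_)) xs

-- A matrix that is not square gets the value 0 from this recursion.
detL : List (X → ℚ) → List X → ℚ
detL []       []      = 1ℚ
detL []       (_ ∷ _) = 0ℚ
detL (f ∷ fs) xs      = ι f (detL fs) xs

-- A contraction evaluates its covector only at the listed columns and `Φ` only at sublists, so a
-- property of the columns passes to every minor. This allows identities that hold only on the
-- columns present.
ι-cong-on : (P : X → Set) {f g : X → ℚ} {Φ Ψ : List X → ℚ} →
  (∀ {x} → P x → f x ≡ g x) → (∀ {ys} → All P ys → Φ ys ≡ Ψ ys) →
  ∀ {xs} → All P xs → ι f Φ xs ≡ ι g Ψ xs
ι-cong-on P e E []       = refl
ι-cong-on P e E (p ∷ ps) = cong₂ _-_ (cong₂ _*_ (e p) (E ps)) (ι-cong-on P e (λ qs → E (p ∷ qs)) ps)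

ι-congʳ : (f : X → ℚ) {Φ Ψ : List X → ℚ} → (∀ ys → Φ ys ≡ Ψ ys) → ∀ xs → ι f Φ xs ≡ ι f Ψ xs
ι-congʳ f E xs = ι-cong-on (λ _ → ⊤) (λ _ → refl) (λ {ys} _ → E ys) (All.universal (λ _ → tt) xs)

ι-congˡ : {f g : X → ℚ} (Φ : List X → ℚ) → (∀ x → f x ≡ g x) → ∀ xs → ι f Φ xs ≡ ι g Φ xs
ι-congˡ Φ e xs = ι-cong-on (λ _ → ⊤) (λ {x} _ → e x) (λ _ → refl) (All.universal (λ _ → tt) xs)

ι-+ˡ : (f g : X → ℚ) (Φ : List X → ℚ) → ∀ xs → ι (λ x → f x +ℚ g x) Φ xs ≡ ι f Φ xs +ℚ ι g Φ xs
ι-+ˡ f g Φ []       = refl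
ι-+ˡ f g Φ (x ∷ xs) = trans (cong ((f x +ℚ g x) * Φ xs -_) (ι-+ˡ f g (Φ ∘ (x ∷_)) xs))
  (solve 5 (λ a b p u v → (a :+ b) :* p :- (u :+ v) := (a :* p :- u) :+ (b :* p :- v)) refl
    (f x) (g x) (Φ xs) (ι f (Φ ∘ (x ∷_)) xs) (ι g (Φ ∘ (x ∷_)) xs))

ι-*ˡ : (c : ℚ) (f : X → ℚ) (Φ : List X → ℚ) → ∀ xs → ι (λ x → c * f x) Φ xs ≡ c * ι f Φ xs
ι-*ˡ c f Φ []       = sym (ℚ.*-zeroʳ c)
ι-*ˡ c f Φ (x ∷ xs) = trans (cong ((c * f x) * Φ xs -_) (ι-*ˡ c f (Φ ∘ (x ∷_)) xs))
  (solve 4 (λ c a p u → (c :* a) :* p :- c :* u := c :* (a :* p :- u)) refl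
    c (f x) (Φ xs) (ι f (Φ ∘ (x ∷_)) xs))

ι-+ʳ : (f : X → ℚ) (Φ Ψ : List X → ℚ) → ∀ xs → ι f (λ ys → Φ ys +ℚ Ψ ys) xs ≡ ι f Φ xs +ℚ ι f Ψ xs
ι-+ʳ f Φ Ψ []       = refl
ι-+ʳ f Φ Ψ (x ∷ xs) = trans (cong (f x * (Φ xs +ℚ Ψ xs) -_) (ι-+ʳ f (Φ ∘ (x ∷_)) (Ψ ∘ (x ∷_)) xs))
  (solve 5 (λ a p q u v → a :* (p :+ q) :- (u :+ v) := (a :* p :- u) :+ (a :* q :- v)) refl
    (f x) (Φ xs) (Ψ xs) (ι f (Φ ∘ (x ∷_)) xs) (ι f (Ψ ∘ (x ∷_)) xs))

ι-*ʳ : (c : ℚ) (f : X → ℚ) (Φ : List X → ℚ) → ∀ xs → ι f (λ ys → c * Φ ys) xs ≡ c * ι f Φ xs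
ι-*ʳ c f Φ []       = sym (ℚ.*-zeroʳ c)
ι-*ʳ c f Φ (x ∷ xs) = trans (cong (f x * (c * Φ xs) -_) (ι-*ʳ c f (Φ ∘ (x ∷_)) xs))
  (solve 4 (λ c a p u → a :* (c :* p) :- c :* u := c :* (a :* p :- u)) refl
    c (f x) (Φ xs) (ι f (Φ ∘ (x ∷_)) xs))

ι-negʳ : (f : X → ℚ) (Φ : List X → ℚ) → ∀ xs → ι f (λ ys → -ℚ Φ ys) xs ≡ -ℚ ι f Φ xs
ι-negʳ f Φ []       = refl
ι-negʳ f Φ (x ∷ xs) = trans (cong (f x * (-ℚ Φ xs) -_) (ι-negʳ f (Φ ∘ (x ∷_)) xs))
  (solve 3 (λ a p u → a :* (:- p) :- (:- u) := :- (a :* p :- u)) refl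
    (f x) (Φ xs) (ι f (Φ ∘ (x ∷_)) xs))

ι-zeroˡ : (f : X → ℚ) (Φ : List X → ℚ) → ∀ {xs} → All (λ x → f x ≡ 0ℚ) xs → ι f Φ xs ≡ 0ℚ
ι-zeroˡ f Φ []       = refl
ι-zeroˡ f Φ {x ∷ xs} (p ∷ ps) rewrite p | ι-zeroˡ f (Φ ∘ (x ∷_)) ps | ℚ.*-zeroˡ (Φ xs) = refl

ι-zeroʳ : (f : X → ℚ) {Φ : List X → ℚ} → (∀ ys → Φ ys ≡ 0ℚ) → ∀ xs → ι f Φ xs ≡ 0ℚ
ι-zeroʳ f E []       = refl
ι-zeroʳ f E (x ∷ xs) rewrite E xs | ι-zeroʳ f (λ ys → E (x ∷ ys)) xs | ℚ.*-zeroʳ (f x) = refl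

ι-Σˡ : (F : Y → X → ℚ) (Φ : List X → ℚ) → ∀ cs xs → ι (λ x → ΣL (λ c → F c x) cs) Φ xs ≡ ΣL (λ c → ι (F c) Φ xs) cs
ι-Σˡ F Φ []       xs = ι-zeroˡ _ Φ (All.universal (λ _ → refl) xs)
ι-Σˡ F Φ (c ∷ cs) xs = trans (ι-+ˡ (F c) _ Φ xs) (cong (ι (F c) Φ xs +ℚ_) (ι-Σˡ F Φ cs xs))

ι-Σʳ : (f : X → ℚ) (Φ : Y → List X → ℚ) → ∀ cs xs → ι f (λ ys → ΣL (λ c → Φ c ys) cs) xs ≡ ΣL (λ c → ι f (Φ c) xs) cs
ι-Σʳ f Φ []       xs = ι-zeroʳ f (λ _ → refl) xs
ι-Σʳ f Φ (c ∷ cs) xs = trans (ι-+ʳ f (Φ c) _ xs) (cong (ι f (Φ c) xs +ℚ_) (ι-Σʳ f Φ cs xs))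

ι-−ʳ : (f : X → ℚ) (c : ℚ) (Φ Ψ : List X → ℚ) → ∀ xs → ι f (λ ys → c * Φ ys - Ψ ys) xs ≡ c * ι f Φ xs - ι f Ψ xs
ι-−ʳ f c Φ Ψ xs = trans (ι-+ʳ f (λ ys → c * Φ ys) (λ ys → -ℚ Ψ ys) xs) (cong₂ _+ℚ_ (ι-*ʳ c f Φ xs) (ι-negʳ f Ψ xs))

-- Expanding twice along the first column, the two terms that use this column are exchanged between
-- the sides, and the remaining one is the same identity for `Φ ∘ (x ∷_)`.
ι-anticomm : (f g : X → ℚ) (Φ : List X → ℚ) → ∀ xs → ι f (ι g Φ) xs ≡ -ℚ ι g (ι f Φ) xs
ι-anticomm f g Φ []       = refl
ι-anticomm f g Φ (x ∷ xs)
  rewrite ι-−ʳ f (g x) Φ (ι g (Φ ∘ (x ∷_))) xs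
        | ι-−ʳ g (f x) Φ (ι f (Φ ∘ (x ∷_))) xs
        | ι-anticomm f g (Φ ∘ (x ∷_)) xs =
  solve 5 (λ a b u v w → a :* u :- (b :* v :- (:- w)) := :- (b :* v :- (a :* u :- w))) refl
    (f x) (g x) (ι g Φ xs) (ι f Φ xs) (ι g (ι f (Φ ∘ (x ∷_))) xs)

-- The two terms using the first column cancel. The direct induction avoids the division by 2 that a
-- deduction from anticommutativity would require.
ι-square : (f : X → ℚ) (Φ : List X → ℚ) → ∀ xs → ι f (ι f Φ) xs ≡ 0ℚ
ι-square f Φ []       = refl
ι-square f Φ (x ∷ xs)
  rewrite ι-−ʳ f (f x) Φ (ι f (Φ ∘ (x ∷_))) xs | ι-square f (Φ ∘ (x ∷_)) xs =
  solve 1 (λ u → u :- (u :- con 0ℚ) := con 0ℚ) refl (f x * ι f Φ xs)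

-- Adjacent swaps generate all rearrangements. Vanishing on a repeated row is supplied by `ι-square`
-- where it is used.
Alternating : (List Y → ℚ) → Set
Alternating Φ = ∀ us x y vs → Φ (us ++ x ∷ y ∷ vs) ≡ -ℚ Φ (us ++ y ∷ x ∷ vs)

detL-alternating-rows : (xs : List X) → Alternating (λ fs → detL fs xs)
detL-alternating-rows xs us f g vs = go us xs
  where
  go : ∀ us xs → detL (us ++ f ∷ g ∷ vs) xs ≡ -ℚ detL (us ++ g ∷ f ∷ vs) xs
  go []       xs = ι-anticomm f g (detL vs) xs
  go (u ∷ us) xs = trans (ι-congʳ u (go us) xs) (ι-negʳ u _ xs)

ι-alternating : (f : X → ℚ) {Φ : List X → ℚ} → Alternating Φ → Alternating (ι f Φ)
ι-alternating f {Φ} alt [] x y vs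
  rewrite trans (ι-congʳ f (alt [] x y) vs) (ι-negʳ f (λ ys → Φ (y ∷ x ∷ ys)) vs) =
  solve 3 (λ a b c → a :- (b :- (:- c)) := :- (b :- (a :- c))) refl
    (f x * Φ (y ∷ vs)) (f y * Φ (x ∷ vs)) (ι f (λ ys → Φ (y ∷ x ∷ ys)) vs)
ι-alternating f {Φ} alt (u ∷ us) x y vs
  rewrite alt us x y vs | ι-alternating f {λ ys → Φ (u ∷ ys)} (λ us′ → alt (u ∷ us′)) us x y vs =
  solve 3 (λ a b c → a :* (:- b) :- (:- c) := :- (a :* b :- c)) refl
    (f u) (Φ (us ++ y ∷ x ∷ vs)) (ι f (Φ ∘ (u ∷_)) (us ++ y ∷ x ∷ vs))

detL-alternating-columns : (fs : List (X → ℚ)) → Alternating (detL fs)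
detL-alternating-columns []       []       x y vs = refl
detL-alternating-columns []       (u ∷ us) x y vs = refl
detL-alternating-columns (f ∷ fs) = ι-alternating f (detL-alternating-columns fs)

sgn*sgn : ∀ n → sgn n * sgn n ≡ 1ℚ
sgn*sgn zero    = refl
sgn*sgn (suc n) = trans (solve 1 (λ s → (:- s) :* (:- s) := s :* s) refl (sgn n)) (sgn*sgn n)

sgn-+ : ∀ m n → sgn (m + n) ≡ sgn m * sgn n
sgn-+ zero    n = sym (ℚ.*-identityˡ _)
sgn-+ (suc m) n rewrite sgn-+ m n = solve 2 (λ a b → :- (a :* b) := (:- a) :* b) refl (sgn m) (sgn n)

-- One adjacent swap for each entry of `ms`. When `ms` are the beads that a strip jumps over, the
-- exponent is the height of the strip.
alternating-move : {Φ : List Y → ℚ} → Alternating Φ → ∀ us y ms vs →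
  Φ (us ++ y ∷ ms ++ vs) ≡ sgn (length ms) * Φ (us ++ ms ++ y ∷ vs)
alternating-move alt us y []       vs = sym (ℚ.*-identityˡ _)
alternating-move {Φ = Φ} alt us y (m ∷ ms) vs = begin
  Φ (us ++ y ∷ m ∷ ms ++ vs)                           ≡⟨ alt us y m (ms ++ vs) ⟩
  -ℚ Φ (us ++ m ∷ y ∷ ms ++ vs)                        ≡⟨ cong -ℚ_ (cong Φ (++-assoc us (m ∷ []) _)) ⟨
  -ℚ Φ ((us ++ m ∷ []) ++ y ∷ ms ++ vs)                ≡⟨ cong -ℚ_
      (alternating-move {Φ = Φ} alt (us ++ m ∷ []) y ms vs) ⟩
  -ℚ (sgn (length ms) * Φ ((us ++ m ∷ []) ++ ms ++ y ∷ vs))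
    ≡⟨ cong (λ l → -ℚ (sgn (length ms) * Φ l)) (++-assoc us (m ∷ []) _) ⟩
  -ℚ (sgn (length ms) * Φ (us ++ m ∷ ms ++ y ∷ vs))
    ≡⟨ solve 2 (λ a b → :- (a :* b) := (:- a) :* b) refl (sgn (length ms)) _ ⟩
  (-ℚ sgn (length ms)) * Φ (us ++ m ∷ ms ++ y ∷ vs)   ∎

-- The signs of a permutation of the rows and of the same permutation of the columns cancel.
detL-↭ : (k : Y → X → ℚ) {ps qs : List (Y × X)} → ps ↭ qs →
  detL (map (k ∘ proj₁) ps) (map proj₂ ps) ≡ detL (map (k ∘ proj₁) qs) (map proj₂ qs)
detL-↭ {Y} {X} k = go []
  where
  Δ : List (Y × X) → ℚ
  Δ ps = detL (map (k ∘ proj₁) ps) (map proj₂ ps)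

  swap : ∀ us p q vs → Δ (us ++ p ∷ q ∷ vs) ≡ Δ (us ++ q ∷ p ∷ vs)
  swap us p q vs
    rewrite map-++ (k ∘ proj₁) us (p ∷ q ∷ vs) | map-++ proj₂ us (p ∷ q ∷ vs)
          | map-++ (k ∘ proj₁) us (q ∷ p ∷ vs) | map-++ proj₂ us (q ∷ p ∷ vs) = begin
    detL (fs₁ ++ kp ∷ kq ∷ fs₂) (ys ++ x ∷ y ∷ zs)        ≡⟨ detL-alternating-rows (ys ++ x ∷ y ∷ zs) fs₁ kp kq fs₂ ⟩
    -ℚ detL (fs₁ ++ kq ∷ kp ∷ fs₂) (ys ++ x ∷ y ∷ zs)
      ≡⟨ cong -ℚ_ (detL-alternating-columns (fs₁ ++ kq ∷ kp ∷ fs₂) ys x y zs) ⟩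
    -ℚ (-ℚ detL (fs₁ ++ kq ∷ kp ∷ fs₂) (ys ++ y ∷ x ∷ zs)) ≡⟨ solve 1 (λ a → :- (:- a) := a) refl _ ⟩
    detL (fs₁ ++ kq ∷ kp ∷ fs₂) (ys ++ y ∷ x ∷ zs)         ∎
    where
    fs₁ = map (k ∘ proj₁) us
    fs₂ = map (k ∘ proj₁) vs
    ys = map proj₂ us
    zs = map proj₂ vs
    kp = k (proj₁ p)
    kq = k (proj₁ q)
    x = proj₂ p
    y = proj₂ q

  -- The induction on the permutation runs behind a fixed prefix `us`, because both constructors
  -- that descend do so behind entries already passed; here such an entry joins the prefix.
  snoc : ∀ us p vs ws → Δ ((us ++ p ∷ []) ++ vs) ≡ Δ ((us ++ p ∷ []) ++ ws) → Δ (us ++ p ∷ vs) ≡ Δ (us ++ p ∷ ws)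
  snoc us p vs ws e rewrite ++-assoc us (p ∷ []) vs | ++-assoc us (p ∷ []) ws = e

  go : ∀ us {ps qs} → ps ↭ qs → Δ (us ++ ps) ≡ Δ (us ++ qs)
  go us Perm.refl = refl
  go us (Perm.prep p e) = snoc us p _ _ (go (us ++ p ∷ []) e)
  go us (Perm.swap p q e) = trans (swap us p q _)
    (snoc us q _ _ (snoc (us ++ q ∷ []) p _ _ (go ((us ++ q ∷ []) ++ p ∷ []) e)))
  go us (Perm.trans e e′) = trans (go us e) (go us e′)

detL-zero-column : ∀ {fs : List (X → ℚ)} {a} → All (λ f → f a ≡ 0ℚ) fs → ∀ xs → detL fs (a ∷ xs) ≡ 0ℚ
detL-zero-column []       xs = refl
detL-zero-column {fs = f ∷ fs} {a} (p ∷ ps) xs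
  rewrite p | ι-zeroʳ f (detL-zero-column ps) xs | ℚ.*-zeroˡ (detL fs xs) = refl

detL-unit-row : (f : X → ℚ) (fs : List (X → ℚ)) {c : X} {xs : List X} → f c ≡ 1ℚ → All (λ x → f x ≡ 0ℚ) xs →
  detL (f ∷ fs) (c ∷ xs) ≡ detL fs xs
detL-unit-row f fs {c} {xs} p ps rewrite p | ι-zeroˡ f (detL fs ∘ (c ∷_)) ps =
  solve 1 (λ a → con 1ℚ :* a :- con 0ℚ := a) refl (detL fs xs)

-- Links the sign of `ι`, which flips at each column passed over, with the explicit `sgn (toℕ j)`
-- and `punchIn` in the definition of `det`.
ι-tabulate : (g : X → ℚ) (Φ : List X → ℚ) → ∀ n (c : Fin (suc n) → X) →
  ι g Φ (tabulate c) ≡ foldr _+ℚ_ 0ℚ (tabulate (λ j → sgn (toℕ j) * (g (c j) * Φ (tabulate (c ∘ punchIn j)))))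
ι-tabulate g Φ zero c = solve 1 (λ a → a :- con 0ℚ := con 1ℚ :* a :+ con 0ℚ) refl (g (c fzero) * Φ [])
ι-tabulate {X} g Φ (suc n) c = trans
  (cong (λ e → g (c fzero) * Φ (tabulate (c ∘ fsuc)) - e) (ι-tabulate g (Φ ∘ (c fzero ∷_)) n (c ∘ fsuc)))
  (trans (cong₂ _+ℚ_ (sym (ℚ.*-identityˡ (g (c fzero) * Φ (tabulate (c ∘ fsuc)))))
      (neg-sum (suc n) (sgn ∘ toℕ) (λ j → g (c (fsuc j)) * Φ (tabulate (c ∘ punchIn (fsuc j))))))
         refl)
  where
  neg-sum : ∀ m (s u : Fin m → ℚ) →
    -ℚ foldr _+ℚ_ 0ℚ (tabulate (λ j → s j * u j)) ≡ foldr _+ℚ_ 0ℚ (tabulate (λ j → (-ℚ s j) * u j))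
  neg-sum zero    s u = refl
  neg-sum (suc m) s u = trans
    (solve 3 (λ a b r → :- (a :* b :+ r) := (:- a) :* b :+ (:- r)) refl (s fzero) (u fzero)
      (foldr _+ℚ_ 0ℚ (tabulate (λ j → s (fsuc j) * u (fsuc j)))))
    (cong ((-ℚ s fzero) * u fzero +ℚ_) (neg-sum m (s ∘ fsuc) (u ∘ fsuc)))

det≡detL : ∀ n (f : Fin n → X → ℚ) (c : Fin n → X) → det n (λ i j → f i (c j)) ≡ detL (tabulate f) (tabulate c)
det≡detL zero    f c = refl
det≡detL (suc n) f c = trans
  (cong (foldr _+ℚ_ 0ℚ) (trans (map-tabulate {n = suc n} (λ j → j)
      (λ j → sgn (toℕ j) * (f fzero (c j) * det n (λ a b → f (fsuc a) (c (punchIn j b))))))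
    (tabulate-cong (λ j → cong (λ e → sgn (toℕ j) * (f fzero (c j) * e)) (det≡detL n (f ∘ fsuc) (c ∘ punchIn j))))))
  (sym (ι-tabulate (f fzero) (detL (tabulate (f ∘ fsuc))) n c))

-- Horizontal strips and subtraction of consecutive rows

range : ℕ → ℕ → List ℕ
range i zero    = []
range i (suc n) = i ∷ range (suc i) n

beads : List ℕ → List ℕ
beads []       = []
beads (m ∷ ms) = m + length ms ∷ beads ms

-- All ν with as many rows as ms such that ν/ms is a horizontal strip and ν₁ ≤ B.
hstrips : ℕ → List ℕ → List (List ℕ)
hstrips B []       = [] ∷ []
hstrips B (m ∷ ms) = concatMap (λ ns → map (_∷ ns) (range m (suc B ∸ m))) (hstrips m ms)

data HStrip : ℕ → List ℕ → List ℕ → Set where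
  hnil  : ∀ {B} → HStrip B [] []
  hcons : ∀ {B m v ms ns} → m ≤ v → v ≤ B → HStrip m ms ns → HStrip B (m ∷ ms) (v ∷ ns)

∈-range⁻ : ∀ i n {v} → v ∈ range i n → i ≤ v × v < i + n
∈-range⁻ i (suc n) (aHere refl) = ≤-refl , subst (i <_) (sym (+-suc i n)) (s≤s (m≤m+n i n))
∈-range⁻ i (suc n) {v} (aThere p) with a , b ← ∈-range⁻ (suc i) n p = <⇒≤ a , subst (v <_) (sym (+-suc i n)) b

∈-range⁺ : ∀ i n {v} → i ≤ v → v < i + n → v ∈ range i n
∈-range⁺ i zero    {v} p q = ⊥-elim (<-irrefl refl (≤-trans (subst (v <_) (+-comm i 0) q) p))
∈-range⁺ i (suc n) {v} p q with <-cmp i v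
... | tri≈ _ refl _ = aHere refl
... | tri< i<v _ _  = aThere (∈-range⁺ (suc i) n i<v (subst (v <_) (+-suc i n) q))
... | tri> _ _ v<i  = ⊥-elim (<-irrefl refl (≤-trans v<i p))

∈-hstrips⁻ : ∀ B ms {ns} → Linked _≥_ (B ∷ ms) → ns ∈ hstrips B ms → HStrip B ms ns
∈-hstrips⁻ B []       _ (aHere refl) = hnil
∈-hstrips⁻ B (m ∷ ms) (m≤B ∷ l) p
  with qs ← ∈-concatMap⁻ (λ ns → map (_∷ ns) (range m (suc B ∸ m))) {xs = hstrips m ms} p
  = go (hstrips m ms) (λ q → ∈-hstrips⁻ m ms l q) qs
  where
  go : ∀ hs {ns} → (∀ {ks} → ks ∈ hs → HStrip m ms ks) →
       Any (λ ks → ns ∈ map (_∷ ks) (range m (suc B ∸ m))) hs → HStrip B (m ∷ ms) ns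
  go (ks ∷ hs) H (aHere q) with v , v∈ , refl ← ∈-map⁻ (_∷ ks) q with a , b ← ∈-range⁻ m _ v∈ =
    hcons a (≤-pred (subst (v <_) (m+[n∸m]≡n (m≤n⇒m≤1+n m≤B)) b)) (H (aHere refl))
  go (ks ∷ hs) H (aThere q) = go hs (H ∘ aThere) q

∈-hstrips⁺ : ∀ {B ms ns} → HStrip B ms ns → ns ∈ hstrips B ms
∈-hstrips⁺ hnil = aHere refl
∈-hstrips⁺ {B} {m ∷ ms} (hcons {v = v} {ns = ks} m≤v v≤B h) =
  ∈-concatMap⁺ (λ ns → map (_∷ ns) (range m (suc B ∸ m))) (put (∈-hstrips⁺ h))
  where
  v∈ = ∈-range⁺ m (suc B ∸ m) m≤v (subst (v <_) (sym (m+[n∸m]≡n (m≤n⇒m≤1+n (≤-trans m≤v v≤B)))) (s≤s v≤B))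
  put : ∀ {hs} → ks ∈ hs → Any (λ ns → _ ∈ map (_∷ ns) (range m (suc B ∸ m))) hs
  put (aHere refl) = aHere (∈-map⁺ (_∷ ks) v∈)
  put (aThere p)   = aThere (put p)

hstrip-length : ∀ {B ms ns} → HStrip B ms ns → length ns ≡ length ms
hstrip-length hnil          = refl
hstrip-length (hcons _ _ h) = cong suc (hstrip-length h)

hstrip-linked : ∀ {B ms ns} → HStrip B ms ns → Linked _≥_ (B ∷ ns)
hstrip-linked hnil = [-]
hstrip-linked (hcons m≤v v≤B h) = v≤B ∷ weaken m≤v (hstrip-linked h)
  where
  weaken : ∀ {a b xs} → a ≤ b → Linked _≥_ (a ∷ xs) → Linked _≥_ (b ∷ xs)
  weaken p [-]     = [-]
  weaken p (q ∷ l) = ≤-trans q p ∷ l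

hstrip-⊇ : ∀ {B ms ns} → HStrip B ms ns → Pointwise _≤_ ms ns
hstrip-⊇ hnil            = []
hstrip-⊇ (hcons m≤v _ h) = m≤v ∷ hstrip-⊇ h

ΣL-cong-∈ : {f g : X → ℚ} → ∀ xs → (∀ {x} → x ∈ xs → f x ≡ g x) → ΣL f xs ≡ ΣL g xs
ΣL-cong-∈ []       e = refl
ΣL-cong-∈ (x ∷ xs) e = cong₂ _+ℚ_ (e (aHere refl)) (ΣL-cong-∈ xs (e ∘ aThere))

-- Subtracting consecutive rows of the matrix with rows K′ b leaves sums of the rows K c.
module _ (K K′ : ℕ → X → ℚ) (diff : ∀ b x → K′ b x ≡ K b x +ℚ K′ (suc b) x) where

  telescope : ∀ b n x → K′ b x ≡ ΣL (λ c → K c x) (range b n) +ℚ K′ (b + n) x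
  telescope b zero    x rewrite +-comm b 0 = sym (ℚ.+-identityˡ _)
  telescope b (suc n) x rewrite +-suc b n = trans (diff b x)
    (trans (cong (K b x +ℚ_) (telescope (suc b) n x))
      (solve 3 (λ a c d → a :+ (c :+ d) := (a :+ c) :+ d) refl (K b x) (ΣL (λ c → K c x) (range (suc b) n)) _))

  shift-range : ∀ m k n → map (_+ n) (range m k) ≡ range (m + n) k
  shift-range m zero    n = refl
  shift-range m (suc k) n = cong (m + n ∷_) (shift-range (suc m) k n)

  -- If B is the part preceding m, then B + suc n is its bead, so the remainder of the telescoping
  -- is exactly the unreduced row above.
  telescope-row : ∀ m B n (Φ : List X → ℚ) xs → m ≤ B → ι (K′ (m + n)) Φ xs ≡
    ΣL (λ v → ι (K (v + n)) Φ xs) (range m (suc B ∸ m)) +ℚ ι (K′ (B + suc n)) Φ xs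
  telescope-row m B n Φ xs m≤B = begin
    ι (K′ (m + n)) Φ xs
      ≡⟨ ι-congˡ Φ (telescope (m + n) (suc B ∸ m)) xs ⟩
    ι (λ x → ΣL (λ c → K c x) (range (m + n) (suc B ∸ m)) +ℚ K′ (m + n + (suc B ∸ m)) x) Φ xs
      ≡⟨ ι-+ˡ _ _ Φ xs ⟩
    ι (λ x → ΣL (λ c → K c x) (range (m + n) (suc B ∸ m))) Φ xs +ℚ ι (K′ (m + n + (suc B ∸ m))) Φ xs
      ≡⟨ cong₂ _+ℚ_ (ι-Σˡ K Φ (range (m + n) (suc B ∸ m)) xs) (cong (λ e → ι (K′ e) Φ xs) end) ⟩
    ΣL (λ c → ι (K c) Φ xs) (range (m + n) (suc B ∸ m)) +ℚ ι (K′ (B + suc n)) Φ xs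
      ≡⟨ cong (_+ℚ ι (K′ (B + suc n)) Φ xs) (trans (cong (ΣL _) (sym (shift-range m (suc B ∸ m) n)))
           (ΣL-map _ (_+ n) (range m (suc B ∸ m)))) ⟩
    ΣL (λ v → ι (K (v + n)) Φ xs) (range m (suc B ∸ m)) +ℚ ι (K′ (B + suc n)) Φ xs ∎
    where
    end : m + n + (suc B ∸ m) ≡ B + suc n
    end = trans (+-assoc m n _) (trans (cong (m +_) (+-comm n _)) (trans (sym (+-assoc m _ n))
      (trans (cong (_+ n) (m+[n∸m]≡n (m≤n⇒m≤1+n m≤B))) (sym (+-suc B n)))))

  ΣL-hstrips : ∀ m ms B (Ψ : List (X → ℚ) → ℚ) → Linked _≥_ (m ∷ ms) →
    ΣL (λ ns → ΣL (λ v → Ψ (K (v + length ms) ∷ map K (beads ns))) (range m (suc B ∸ m))) (hstrips m ms) ≡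
    ΣL (λ ns → Ψ (map K (beads ns))) (hstrips B (m ∷ ms))
  ΣL-hstrips m ms B Ψ l = sym (trans (ΣL-concatMap _ (λ ns → map (_∷ ns) (range m (suc B ∸ m))) (hstrips m ms))
    (ΣL-cong-∈ (hstrips m ms) λ {ns} p → trans (ΣL-map _ (_∷ ns) (range m (suc B ∸ m)))
      (cong (λ n → ΣL (λ v → Ψ (K (v + n) ∷ map K (beads ns))) (range m (suc B ∸ m)))
            (hstrip-length (∈-hstrips⁻ m ms l p)))))

  -- Rows are reduced from the bottom up, so that the remainder of each is the still unreduced row
  -- above it and drops out as a repeated row. The statement carries this upper row along for the
  -- induction.
  interlace : ∀ B ms → Linked _≥_ (B ∷ ms) → ∀ xs →
    detL (K′ (B + length ms) ∷ map K′ (beads ms)) xs ≡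
    ΣL (λ ns → detL (K′ (B + length ms) ∷ map K (beads ns)) xs) (hstrips B ms)
  interlace B []       l xs = sym (ℚ.+-identityʳ _)
  interlace B (m ∷ ms) (m≤B ∷ l) xs = begin
    ι f (detL (f₂ ∷ map K′ (beads ms))) xs
      ≡⟨ ι-congʳ f (interlace m ms l) xs ⟩
    ι f (λ ys → ΣL (λ ns → detL (f₂ ∷ map K (beads ns)) ys) (hstrips m ms)) xs
      ≡⟨ ι-Σʳ f (λ ns → detL (f₂ ∷ map K (beads ns))) (hstrips m ms) xs ⟩
    ΣL (λ ns → ι f (ι f₂ (detL (map K (beads ns)))) xs) (hstrips m ms)
      ≡⟨ ΣL-cong (λ ns → square-free (detL (map K (beads ns)))) (hstrips m ms) ⟩
    ΣL (λ ns → ΣL (λ v → ι f (ι (K (v + length ms)) (detL (map K (beads ns)))) xs) vs) (hstrips m ms)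
      ≡⟨ ΣL-hstrips m ms B (λ fs → detL (f ∷ fs) xs) l ⟩
    ΣL (λ ns → detL (f ∷ map K (beads ns)) xs) (hstrips B (m ∷ ms)) ∎
    where
    f  = K′ (B + suc (length ms))
    f₂ = K′ (m + length ms)
    vs = range m (suc B ∸ m)
    square-free : ∀ Φ → ι f (ι f₂ Φ) xs ≡ ΣL (λ v → ι f (ι (K (v + length ms)) Φ) xs) vs
    square-free Φ = begin
      ι f (ι f₂ Φ) xs
        ≡⟨ ι-congʳ f (λ ys → telescope-row m B (length ms) Φ ys m≤B) xs ⟩
      ι f (λ ys → ΣL (λ v → ι (K (v + length ms)) Φ ys) vs +ℚ ι f Φ ys) xs
        ≡⟨ ι-+ʳ f _ (ι f Φ) xs ⟩
      ι f (λ ys → ΣL (λ v → ι (K (v + length ms)) Φ ys) vs) xs +ℚ ι f (ι f Φ) xs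
        ≡⟨ cong₂ _+ℚ_ (ι-Σʳ f (λ v → ι (K (v + length ms)) Φ) vs xs) (ι-square f Φ xs) ⟩
      ΣL (λ v → ι f (ι (K (v + length ms)) Φ) xs) vs +ℚ 0ℚ
        ≡⟨ ℚ.+-identityʳ _ ⟩
      ΣL (λ v → ι f (ι (K (v + length ms)) Φ) xs) vs ∎

  -- The first row has no row above it to absorb its remainder; instead the remainder is assumed to
  -- vanish on the columns.
  interlace-top : ∀ B ms → Linked _≥_ (B ∷ ms) → ∀ xs → All (λ x → K′ (B + length ms) x ≡ 0ℚ) xs →
    detL (map K′ (beads ms)) xs ≡ ΣL (λ ns → detL (map K (beads ns)) xs) (hstrips B ms)
  interlace-top B []       l xs z = sym (ℚ.+-identityʳ _)
  interlace-top B (m ∷ ms) (m≤B ∷ l) xs z = begin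
    detL (K′ (m + length ms) ∷ map K′ (beads ms)) xs
      ≡⟨ interlace m ms l xs ⟩
    ΣL (λ ns → detL (K′ (m + length ms) ∷ map K (beads ns)) xs) (hstrips m ms)
      ≡⟨ ΣL-cong (λ ns → trans (telescope-row m B (length ms) (detL (map K (beads ns))) xs m≤B)
           (trans (cong (ΣL _ vs +ℚ_) (ι-zeroˡ _ (detL (map K (beads ns))) z)) (ℚ.+-identityʳ _))) (hstrips m ms) ⟩
    ΣL (λ ns → ΣL (λ v → detL (K (v + length ms) ∷ map K (beads ns)) xs) vs) (hstrips m ms)
      ≡⟨ ΣL-hstrips m ms B (λ fs → detL fs xs) l ⟩
    ΣL (λ ns → detL (map K (beads ns)) xs) (hstrips B (m ∷ ms)) ∎
    where
    vs = range m (suc B ∸ m)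

-- The kernel h_{a-b}(1^t) and its determinants

-- h t n = h_n(1^t), by Pascal's rule.
h : ℕ → ℕ → ℕ
h zero    zero    = 1
h zero    (suc n) = 0
h (suc t) zero    = 1
h (suc t) (suc n) = h t (suc n) + h (suc t) n

-- kern t b a = h_{a-b}(1^t), hence 0 for a < b.
kern : ℕ → ℕ → ℕ → ℕ
kern t zero    a       = h t a
kern t (suc b) zero    = 0
kern t (suc b) (suc a) = kern t b a

h-0 : ∀ t → h t 0 ≡ 1
h-0 zero    = refl
h-0 (suc t) = refl

-- Pascal's rule above the diagonal; on the diagonal the last term is 0 and the value 1 does not
-- depend on t. This is the hypothesis `diff` of the telescoping.
kern-diff : ∀ t b a → kern (suc t) b a ≡ kern t b a + kern (suc t) (suc b) a
kern-diff t zero    zero    rewrite h-0 t = refl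
kern-diff t zero    (suc a) = refl
kern-diff t (suc b) zero    = refl
kern-diff t (suc b) (suc a) = kern-diff t b a

kern-diag : ∀ t b → kern t b b ≡ 1
kern-diag t zero    = h-0 t
kern-diag t (suc b) = kern-diag t b

kern-< : ∀ t {b a} → a < b → kern t b a ≡ 0
kern-< t {suc b} {zero}  p       = refl
kern-< t {suc b} {suc a} (s≤s p) = kern-< t p

kern-0 : ∀ {b a} → a ≢ b → kern 0 b a ≡ 0
kern-0 {zero}  {zero}  p = ⊥-elim (p refl)
kern-0 {zero}  {suc a} p = refl
kern-0 {suc b} {zero}  p = refl
kern-0 {suc b} {suc a} p = kern-0 (p ∘ cong suc)

fromℚᵘ-+ : ∀ p q → ℚ.fromℚᵘ (p ℚᵘ.+ q) ≡ ℚ.fromℚᵘ p +ℚ ℚ.fromℚᵘ q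
fromℚᵘ-+ p q = ℚ.toℚᵘ-injective (ℚᵘ.≃-trans (ℚ.toℚᵘ-fromℚᵘ (p ℚᵘ.+ q))
  (ℚᵘ.≃-sym (ℚᵘ.≃-trans (ℚ.toℚᵘ-homo-+ (ℚ.fromℚᵘ p) (ℚ.fromℚᵘ q))
    (ℚᵘ.+-cong (ℚ.toℚᵘ-fromℚᵘ p) (ℚ.toℚᵘ-fromℚᵘ q)))))

fromℚᵘ-* : ∀ p q → ℚ.fromℚᵘ (p ℚᵘ.* q) ≡ ℚ.fromℚᵘ p * ℚ.fromℚᵘ q
fromℚᵘ-* p q = ℚ.toℚᵘ-injective (ℚᵘ.≃-trans (ℚ.toℚᵘ-fromℚᵘ (p ℚᵘ.* q))
  (ℚᵘ.≃-sym (ℚᵘ.≃-trans (ℚ.toℚᵘ-homo-* (ℚ.fromℚᵘ p) (ℚ.fromℚᵘ q))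
    (ℚᵘ.*-cong (ℚ.toℚᵘ-fromℚᵘ p) (ℚ.toℚᵘ-fromℚᵘ q)))))

ℕtoℚ-+ : ∀ m n → ℕtoℚ (m + n) ≡ ℕtoℚ m +ℚ ℕtoℚ n
ℕtoℚ-+ m n = trans (ℚ.fromℚᵘ-cong {p} {ℚᵘ.mkℚᵘ (ℤ.+ m) 0 ℚᵘ.+ ℚᵘ.mkℚᵘ (ℤ.+ n) 0}
    (ℚᵘ.*≡* (cong (λ z → z ℤ.* ℤ.+ 1) e))) (fromℚᵘ-+ (ℚᵘ.mkℚᵘ (ℤ.+ m) 0) (ℚᵘ.mkℚᵘ (ℤ.+ n) 0))
  where
  p = ℚᵘ.mkℚᵘ (ℤ.+ (m + n)) 0
  e : ℤ.+ (m + n) ≡ ((ℤ.+ m) ℤ.* (ℤ.+ 1)) ℤ.+ ((ℤ.+ n) ℤ.* (ℤ.+ 1))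
  e = trans (ℤ.pos-+ m n) (sym (cong₂ ℤ._+_ (ℤ.*-identityʳ (ℤ.+ m)) (ℤ.*-identityʳ (ℤ.+ n))))

ℕtoℚ-* : ∀ m n → ℕtoℚ (m *ℕ n) ≡ ℕtoℚ m * ℕtoℚ n
ℕtoℚ-* m n = trans (ℚ.fromℚᵘ-cong {ℚᵘ.mkℚᵘ (ℤ.+ (m *ℕ n)) 0} {ℚᵘ.mkℚᵘ (ℤ.+ m) 0 ℚᵘ.* ℚᵘ.mkℚᵘ (ℤ.+ n) 0}
    (ℚᵘ.*≡* (cong (λ z → z ℤ.* ℤ.+ 1) (ℤ.pos-* m n))))
  (fromℚᵘ-* (ℚᵘ.mkℚᵘ (ℤ.+ m) 0) (ℚᵘ.mkℚᵘ (ℤ.+ n) 0))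

ℕtoℚ-suc-recip : ∀ n → ℕtoℚ (suc n) * recipℕ (suc n) ≡ 1ℚ
ℕtoℚ-suc-recip n = trans (sym (fromℚᵘ-* (ℚᵘ.mkℚᵘ (ℤ.+ suc n) 0) (ℚᵘ.mkℚᵘ (ℤ.+ 1) n)))
  (ℚ.fromℚᵘ-cong {ℚᵘ.mkℚᵘ (ℤ.+ suc n) 0 ℚᵘ.* ℚᵘ.mkℚᵘ (ℤ.+ 1) n} {ℚᵘ.mkℚᵘ (ℤ.+ 1) 0} (ℚᵘ.*≡* e))
  where
  e : (ℤ.+ suc n ℤ.* ℤ.+ 1) ℤ.* ℤ.+ 1 ≡ ℤ.+ 1 ℤ.* (ℤ.+ 1 ℤ.* ℤ.+ suc n)
  e = trans (ℤ.*-identityʳ _) (trans (ℤ.*-identityʳ (ℤ.+ suc n))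
      (sym (trans (ℤ.*-identityˡ _) (ℤ.*-identityˡ (ℤ.+ suc n)))))

kernℚ : ℕ → ℕ → ℕ → ℚ
kernℚ t b a = ℕtoℚ (kern t b a)

detBeads : ℕ → List ℕ → List ℕ → ℚ
detBeads t ls ms = detL (map (kernℚ t) (beads ms)) (beads ls)

beads-< : ∀ {B ls} → Linked _≥_ (B ∷ ls) → All (_< B + length ls) (beads ls)
beads-< {B} {[]}     _         = []
beads-< {B} {l ∷ ls} (l≤B ∷ k) = subst (l + length ls <_) (sym (+-suc B _)) (s≤s (+-monoˡ-≤ (length ls) l≤B)) ∷
  All.map (λ p → ≤-trans p (≤-trans (+-monoˡ-≤ (length ls) l≤B) (+-monoʳ-≤ B (n≤1+n _)))) (beads-< k)

-- The branching rule on the side of determinants. As B bounds the parts of `ls`, the position B +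
-- length ls exceeds all its beads, which makes the remainder of the first row vanish.
detBeads-suc : ∀ t B ls ms → Linked _≥_ (B ∷ ls) → Linked _≥_ (B ∷ ms) → length ms ≡ length ls →
  detBeads (suc t) ls ms ≡ ΣL (detBeads t ls) (hstrips B ms)
detBeads-suc t B ls ms lk mk e = interlace-top (kernℚ t) (kernℚ (suc t))
  (λ b x → trans (cong ℕtoℚ (kern-diff t b x)) (ℕtoℚ-+ (kern t b x) (kern (suc t) (suc b) x)))
  B ms mk (beads ls) (All.map (λ p → cong ℕtoℚ (kern-< (suc t) (subst (λ n → _ < B + n) (sym e) p))) (beads-< lk))

detBeads-0-≡ : ∀ ls → Linked _≥_ ls → detBeads 0 ls ls ≡ 1ℚ
detBeads-0-≡ []       k = refl
detBeads-0-≡ (l ∷ ls) k = trans (detL-unit-row (kernℚ 0 (l + length ls)) (map (kernℚ 0) (beads ls))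
  (cong ℕtoℚ (kern-diag 0 (l + length ls)))
  (All.map (λ p → cong ℕtoℚ (kern-0 (<⇒≢ p))) (beads-< k)))
  (detBeads-0-≡ ls (Linked.tail k))

-- At t = 0 the kernel is the identity matrix. Equal first parts are split off as unit rows; at the
-- first difference the larger of the two beads occurs on one side only, giving a zero row or a zero
-- column.
detBeads-0-≢ : ∀ ls ms → Linked _≥_ ls → Linked _≥_ ms → length ms ≡ length ls → ms ≢ ls → detBeads 0 ls ms ≡ 0ℚ
detBeads-0-≢ []       []       _ _ _ p = ⊥-elim (p refl)
detBeads-0-≢ (l ∷ ls) (m ∷ ms) k j e p with <-cmp m l
... | tri≈ _ refl _ = trans (cong (λ n → detL (kernℚ 0 (m + n) ∷ map (kernℚ 0) (beads ms))
    (m + length ls ∷ beads ls)) (suc-injective e))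
  (trans (detL-unit-row (kernℚ 0 (l + length ls)) (map (kernℚ 0) (beads ms))
    (cong ℕtoℚ (kern-diag 0 (l + length ls)))
    (All.map (λ q → cong ℕtoℚ (kern-0 (<⇒≢ q))) (beads-< k)))
    (detBeads-0-≢ ls ms (Linked.tail k) (Linked.tail j) (suc-injective e) (λ { refl → p refl })))
... | tri> _ _ l<m  = ι-zeroˡ (kernℚ 0 (m + length ms)) (detL (map (kernℚ 0) (beads ms)))
  (zero-at l<m ∷ All.map (λ q → cong ℕtoℚ (kern-0 (<⇒≢ (≤-trans q (≤-trans (<⇒≤ (big l<m)) ≤-refl))))) (beads-< k))
  where
  big : l < m → l + length ls < m + length ms
  big q = subst (λ n → l + length ls < m + n) (sym (suc-injective e)) (+-monoˡ-< (length ls) q)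
  zero-at : l < m → kernℚ 0 (m + length ms) (l + length ls) ≡ 0ℚ
  zero-at q = cong ℕtoℚ (kern-0 (<⇒≢ (big q)))
... | tri< m<l _ _  = detL-zero-column {fs = map (kernℚ 0) (beads (m ∷ ms))} (vanish m<l ∷ others (beads-< j))
    (beads ls)
  where
  big : m < l → m + length ms < l + length ls
  big q = subst (λ n → m + length ms < l + n) (suc-injective e) (+-monoˡ-< (length ms) q)
  vanish : m < l → kernℚ 0 (m + length ms) (l + length ls) ≡ 0ℚ
  vanish q = cong ℕtoℚ (kern-0 (λ r → <⇒≢ (big q) (sym r)))
  others : ∀ {bs} → All (_< m + length ms) bs → All (λ f → f (l + length ls) ≡ 0ℚ) (map (kernℚ 0) bs)
  others []       = []
  others (q ∷ qs) = cong ℕtoℚ (kern-0 (λ r → <⇒≢ (≤-trans q (<⇒≤ (big m<l))) (sym r))) ∷ others qs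

-- The branching rule for determinants also sums over strips that leave λ, which no tableau sees.
-- Adding cells to a shape not contained in λ never brings it inside, so these terms descend to t =
-- 0 and vanish there.
detBeads-⊈ : ∀ t B ls ms → Linked _≥_ (B ∷ ls) → Linked _≥_ (B ∷ ms) → length ms ≡ length ls →
  ¬ Pointwise _≤_ ms ls → detBeads t ls ms ≡ 0ℚ
detBeads-⊈ zero    B ls ms lk mk e p = detBeads-0-≢ ls ms (Linked.tail lk) (Linked.tail mk) e
    (λ { refl → p (Pw.refl ≤-refl) })
detBeads-⊈ (suc t) B ls ms lk mk e p = trans (detBeads-suc t B ls ms lk mk e)
  (trans (ΣL-cong-∈ (hstrips B ms) λ {ns} q → let hs = ∈-hstrips⁻ B ms mk q in
    detBeads-⊈ t B ls ns lk (hstrip-linked hs) (trans (hstrip-length hs) e)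
      (λ r → p (Pw.transitive ≤-trans (hstrip-⊇ hs) r)))
    (ΣL-0 (hstrips B ms)))
  where
  ΣL-0 : ∀ {Z : Set} (xs : List Z) → ΣL (λ _ → 0ℚ) xs ≡ 0ℚ
  ΣL-0 []       = refl
  ΣL-0 (x ∷ xs) = trans (ℚ.+-identityˡ _) (ΣL-0 xs)

-- Lists

unique-⊆-↭ : {xs zs : List X} → Unique xs → (∀ {x} → x ∈ xs → x ∈ zs) → ∃ λ ws → zs ↭ xs ++ ws
unique-⊆-↭ {zs = zs} [] s = zs , ↭-refl
unique-⊆-↭ {X} {xs = x ∷ xs} (x∉ ∷ u) s with us , vs , refl ← ∈-∃++ (s (aHere refl)) = proj₁ rest , ↭-trans
    (shift x us vs) (↭-prep x (proj₂ rest))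
  where
  sub : ∀ {y} → y ∈ xs → y ∈ us ++ vs
  sub {y} y∈ with ∈-resp-↭ (shift x us vs) (s (aThere y∈))
  ... | aHere refl = ⊥-elim (All¬⇒¬Any x∉ y∈)
  ... | aThere q   = q
  rest : ∃ λ ws → us ++ vs ↭ xs ++ ws
  rest = unique-⊆-↭ u sub

unique-⊆-length : {xs zs : List X} → Unique xs → (∀ {x} → x ∈ xs → x ∈ zs) → length xs ≤ length zs
unique-⊆-length {xs = xs} u s with ws , p ← unique-⊆-↭ u s = subst (length xs ≤_) (sym (↭-length p))
  (subst (length xs ≤_) (sym (length-++ xs)) (m≤m+n _ _))

unique-same-length : {xs zs : List X} → Unique xs → Unique zs →
  (∀ {x} → x ∈ xs → x ∈ zs) → (∀ {x} → x ∈ zs → x ∈ xs) → length xs ≡ length zs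
unique-same-length u v s t = ≤-antisym (unique-⊆-length u s) (unique-⊆-length v t)

∈-concatMap⁻′ : (f : X → List Y) → ∀ {y} xs → y ∈ concatMap f xs → ∃ λ x → x ∈ xs × y ∈ f x
∈-concatMap⁻′ f xs p = find (∈-concatMap⁻ f {xs = xs} p)

∈-concatMap⁺′ : (f : X → List Y) → ∀ {x y xs} → x ∈ xs → y ∈ f x → y ∈ concatMap f xs
∈-concatMap⁺′ f {xs = xs} p q = ∈-concatMap⁺ f {xs = xs} (lose p q)

unique-concatMap : (f : X → List Y) → ∀ {xs} → Unique xs → (∀ {x} → x ∈ xs → Unique (f x)) →
  (∀ {x x′ y} → x ∈ xs → x′ ∈ xs → y ∈ f x → y ∈ f x′ → x ≡ x′) → Unique (concatMap f xs)
unique-concatMap f []       v k = []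
unique-concatMap f {x ∷ xs} (x∉ ∷ u) v k = Unique.++⁺ (v (aHere refl))
  (unique-concatMap f u (v ∘ aThere) (λ p q → k (aThere p) (aThere q)))
  λ { (p , q) → let x′ , x′∈ , r = ∈-concatMap⁻′ f xs q in
      All¬⇒¬Any x∉ (subst (_∈ xs) (sym (k (aHere refl) (aThere x′∈) p r)) x′∈) }

unique-map-on : (f : X → Y) → ∀ {xs} → Unique xs → (∀ {x x′} → x ∈ xs → x′ ∈ xs → f x ≡ f x′ → x ≡ x′) → Unique
    (map f xs)
unique-map-on f []       k = []
unique-map-on f {x ∷ xs} (x∉ ∷ u) k = All.tabulate (λ {y} p e → let z , z∈ , e′ = ∈-map⁻ f p in
    All¬⇒¬Any x∉ (subst (_∈ xs) (sym (k (aHere refl) (aThere z∈) (trans e e′))) z∈))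
  ∷ unique-map-on f u (λ p q → k (aThere p) (aThere q))

unique-range : ∀ i n → Unique (range i n)
unique-range i zero    = []
unique-range i (suc n) = All.tabulate (λ p → <⇒≢ (proj₁ (∈-range⁻ (suc i) n p))) ∷ unique-range (suc i) n

map-cong-∈ : {f g : X → Y} → ∀ xs → (∀ {x} → x ∈ xs → f x ≡ g x) → map f xs ≡ map g xs
map-cong-∈ []       e = refl
map-cong-∈ (x ∷ xs) e = cong₂ _∷_ (e (aHere refl)) (map-cong-∈ xs (e ∘ aThere))

map-≡⁻ : {f g : X → Y} → ∀ xs → map f xs ≡ map g xs → ∀ {x} → x ∈ xs → f x ≡ g x
map-≡⁻ (x ∷ xs) e (aHere refl) = ∷-injectiveˡ e
map-≡⁻ (x ∷ xs) e (aThere p)   = map-≡⁻ xs (∷-injectiveʳ e) p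

-- Tableaux

row-antitone : ∀ {ls} → Linked _≥_ ls → ∀ {i i′} → 1 ≤ i → i ≤ i′ → row ls i′ ≤ row ls i
row-antitone []  {suc i} {suc i′} _ _ = z≤n
row-antitone [-] {suc zero} {suc zero} _ _ = ≤-refl
row-antitone [-] {suc i} {suc (suc i′)} _ _ = z≤n
row-antitone [-] {suc (suc i)} {suc zero} _ (s≤s ())
row-antitone (p ∷ l) {suc zero} {suc zero} _ _ = ≤-refl
row-antitone (p ∷ l) {suc zero} {suc (suc i′)} _ _ = ≤-trans (row-antitone l {1} {suc i′} (s≤s z≤n) (s≤s z≤n)) p
row-antitone (p ∷ l) {suc (suc i)} {suc (suc i′)} _ (s≤s q) = row-antitone l (s≤s z≤n) q

row-beyond : ∀ ls i → length ls < i → row ls i ≡ 0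
row-beyond []       (suc i)       p       = refl
row-beyond (l ∷ ls) (suc (suc i)) (s≤s p) = row-beyond ls (suc i) p
row-beyond (l ∷ ls) (suc zero)    (s≤s ())

row-≤ : ∀ {ms ls} → Pointwise _≤_ ms ls → ∀ i → row ms i ≤ row ls i
row-≤ p       zero          = z≤n
row-≤ []      (suc i)       = z≤n
row-≤ (q ∷ p) (suc zero)    = q
row-≤ (q ∷ p) (suc (suc i)) = row-≤ p (suc i)

pointwise-row : ∀ {ms ls} → length ms ≡ length ls → (∀ i → row ms i ≤ row ls i) → Pointwise _≤_ ms ls
pointwise-row {[]}     {[]}     e r = []
pointwise-row {m ∷ ms} {l ∷ ls} e r = r 1 ∷ pointwise-row (suc-injective e) (tl r)
  where
  tl : (∀ i → row (m ∷ ms) i ≤ row (l ∷ ls) i) → ∀ i → row ms i ≤ row ls i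
  tl r zero    = z≤n
  tl r (suc i) = r (suc (suc i))

row-ext : ∀ {ms ls} → length ms ≡ length ls → (∀ i → row ms i ≡ row ls i) → ms ≡ ls
row-ext {[]}     {[]}     e r = refl
row-ext {m ∷ ms} {l ∷ ls} e r = cong₂ _∷_ (r 1) (row-ext (suc-injective e) (tl r))
  where
  tl : (∀ i → row (m ∷ ms) i ≡ row (l ∷ ls) i) → ∀ i → row ms i ≡ row ls i
  tl r zero    = refl
  tl r (suc i) = r (suc (suc i))

hstrip-row-≥ : ∀ {B ms ns} → HStrip B ms ns → ∀ i → row ns (suc (suc i)) ≤ row ms (suc i)
hstrip-row-≥ hnil i = z≤n
hstrip-row-≥ (hcons _ _ hnil) zero = z≤n
hstrip-row-≥ (hcons _ _ (hcons _ q _)) zero = q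
hstrip-row-≥ (hcons _ _ h) (suc i) = hstrip-row-≥ h i

hstrip-from-rows : ∀ B ms ns → length ms ≡ length ns → row ns 1 ≤ B → (∀ i → row ms i ≤ row ns i) →
  (∀ i → row ns (suc (suc i)) ≤ row ms (suc i)) → HStrip B ms ns
hstrip-from-rows B []       []       e b p q = hnil
hstrip-from-rows B (m ∷ ms) (n ∷ ns) e b p q = hcons (p 1) b
    (hstrip-from-rows m ms ns (suc-injective e) (q 0) p′ (q ∘ suc))
  where
  p′ : ∀ i → row ms i ≤ row ns i
  p′ zero    = z≤n
  p′ (suc i) = p (suc (suc i))

row-map-range : ∀ (g : ℕ → ℕ) i n k → k < n → row (map g (range i n)) (suc k) ≡ g (i + k)
row-map-range g i (suc n) zero    p       = cong g (sym (+-comm i 0))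
row-map-range g i (suc n) (suc k) (s≤s p) = trans (row-map-range g (suc i) n k p) (cong g (sym (+-suc i k)))

length-range : ∀ i n → length (range i n) ≡ n
length-range i zero    = refl
length-range i (suc n) = cong suc (length-range (suc i) n)

∈-between⁻ : ∀ a b {k} → k ∈ between a b → a < k × k ≤ b
∈-between⁻ a b p with k , k∈ , refl ← ∈-map⁻ (λ k → a + suc k) p =
  subst (a <_) (sym (+-suc a k)) (s≤s (m≤m+n a k)) ,
  subst (_≤ b) (sym (+-suc a k)) (bound a b (∈-upTo⁻ k∈))
  where
  bound : ∀ a b {k} → k < b ∸ a → a + k < b
  bound zero    b       q = q
  bound (suc a) (suc b) q = s≤s (bound a b q)

∈-between⁺ : ∀ a b {k} → a < k → k ≤ b → k ∈ between a b
∈-between⁺ a b {k} p q = subst (_∈ between a b) e (∈-map⁺ (λ k → a + suc k) (∈-upTo⁺ bound))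
  where
  e : a + suc (k ∸ suc a) ≡ k
  e = trans (+-suc a _) (m+[n∸m]≡n p)
  bound : k ∸ suc a < b ∸ a
  bound = go a b k p q
    where
    go : ∀ a b k → a < k → k ≤ b → k ∸ suc a < b ∸ a
    go zero    (suc b) (suc k) _       (s≤s q) = s≤s q
    go (suc a) (suc b) (suc k) (s≤s p) (s≤s q) = go a b k p q

unique-between : ∀ a b → Unique (between a b)
unique-between a b = Unique.map⁺ (λ e → suc-injective (+-cancelˡ-≡ a _ _ e)) (Unique.upTo⁺ (b ∸ a))

∈-cells⁻ : ∀ α β {c} → c ∈ cells (α , β) → c ∈S (α , β)
∈-cells⁻ α β p with i , i∈ , q ← ∈-concatMap⁻′ _ (between 0 (length α)) p
  with j , j∈ , refl ← ∈-map⁻ (i ,_) q = ∈-between⁻ (row β i) (row α i) j∈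

∈S-row : ∀ {α β i j} → (i , j) ∈S (α , β) → 1 ≤ i × i ≤ length α
∈S-row {α} {β} {zero}  {suc j} (p , ())
∈S-row {α} {β} {suc i} {j} (p , q) with suc i ≤? length α
... | yes r = s≤s z≤n , r
... | no  r = ⊥-elim (<-irrefl refl (≤-trans (≤-trans (s≤s z≤n) p) (subst (j ≤_) (row-beyond α (suc i) (≰⇒> r)) q)))

∈-cells⁺ : ∀ α β {c} → c ∈S (α , β) → c ∈ cells (α , β)
∈-cells⁺ α β {i , j} p = ∈-concatMap⁺′ _ (∈-between⁺ 0 (length α) (proj₁ (∈S-row {α} {β} p))
    (proj₂ (∈S-row {α} {β} p)))
  (∈-map⁺ (i ,_) (∈-between⁺ (row β i) (row α i) (proj₁ p) (proj₂ p)))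

unique-cells : ∀ α β → Unique (cells (α , β))
unique-cells α β = unique-concatMap _ (unique-between 0 (length α))
  (λ {i} _ → Unique.map⁺ ,-injectiveʳ (unique-between (row β i) (row α i)))
  λ { {i} {i′} _ _ p q → same p q }
  where
  same : ∀ {i i′ y} {js js′ : List ℕ} → y ∈ map (i ,_) js → y ∈ map (i′ ,_) js′ → i ≡ i′
  same p q with _ , _ , refl ← ∈-map⁻ (_ ,_) p | _ , _ , e ← ∈-map⁻ (_ ,_) q = ,-injectiveˡ e

∈-fillings⁻ : ∀ t n {f} → f ∈ fillings t n → length f ≡ n × All (λ v → 1 ≤ v × v ≤ t) f
∈-fillings⁻ t zero    (aHere refl) = refl , []
∈-fillings⁻ t (suc n) p with v , v∈ , q ← ∈-concatMap⁻′ _ (between 0 t) p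
  with f , f∈ , refl ← ∈-map⁻ (v ∷_) q with a , b ← ∈-fillings⁻ t n f∈ = cong suc a , ∈-between⁻ 0 t v∈ ∷ b

∈-fillings⁺ : ∀ t f → All (λ v → 1 ≤ v × v ≤ t) f → f ∈ fillings t (length f)
∈-fillings⁺ t []      _ = aHere refl
∈-fillings⁺ t (v ∷ f) ((p , q) ∷ ps) = ∈-concatMap⁺′ _ (∈-between⁺ 0 t p q) (∈-map⁺ (v ∷_) (∈-fillings⁺ t f ps))

unique-fillings : ∀ t n → Unique (fillings t n)
unique-fillings t zero    = [] ∷ []
unique-fillings t (suc n) = unique-concatMap _ (unique-between 0 t)
  (λ {v} _ → Unique.map⁺ ∷-injectiveʳ (unique-fillings t n))
  λ { p _ q r → same q r }
  where
  same : ∀ {i i′ y} {js js′ : List (List ℕ)} → y ∈ map (i ∷_) js → y ∈ map (i′ ∷_) js′ → i ≡ i′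
  same p q with _ , _ , refl ← ∈-map⁻ (_ ∷_) p | _ , _ , e ← ∈-map⁻ (_ ∷_) q = ∷-injectiveˡ e

-- A filling is a function on all cells, and only its values on the shape matter. The same function
-- can then be read on another shape without reindexing a list.
record IsSSYT (α β : List ℕ) (t : ℕ) (F : Cell → ℕ) : Set where
  field
    entries : ∀ {c} → c ∈S (α , β) → 1 ≤ F c × F c ≤ t
    rows    : ∀ {i j j′} → (i , j) ∈S (α , β) → (i , j′) ∈S (α , β) → j < j′ → F (i , j) ≤ F (i , j′)
    columns : ∀ {i i′ j} → (i , j) ∈S (α , β) → (i′ , j) ∈S (α , β) → i < i′ → F (i , j) < F (i′ , j)
open IsSSYT

T-if⁻ : ∀ a b {c} → T (if a ∧ b then c else true) → T a → T b → T c
T-if⁻ true true p _ _ = p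

T-if⁺ : ∀ a b {c} → (T a → T b → T c) → T (if a ∧ b then c else true)
T-if⁺ true  true  p = p tt tt
T-if⁺ true  false p = tt
T-if⁺ false b     p = tt

T-foldr⁻ : (f : X → Bool) → ∀ {xs} → T (foldr (λ x b → f x ∧ b) true xs) → ∀ {x} → x ∈ xs → T (f x)
T-foldr⁻ f p (aHere refl) = proj₁ (to T-∧ p)
T-foldr⁻ f {y ∷ _} p (aThere q) = T-foldr⁻ f (proj₂ (to (T-∧ {f y}) p)) q

T-foldr⁺ : (f : X → Bool) → ∀ xs → (∀ {x} → x ∈ xs → T (f x)) → T (foldr (λ x b → f x ∧ b) true xs)
T-foldr⁺ f []       p = tt
T-foldr⁺ f (x ∷ xs) p = from T-∧ (p (aHere refl) , T-foldr⁺ f xs (p ∘ aThere))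

zip-map : (F : X → Y) → ∀ cs → zip cs (map F cs) ≡ map (λ c → c , F c) cs
zip-map F []       = refl
zip-map F (c ∷ cs) = cong ((c , F c) ∷_) (zip-map F cs)

isSSYT⁻ : (F : Cell → ℕ) → ∀ cs → T (isSSYT cs (map F cs)) → ∀ {c d} → c ∈ cs → d ∈ cs → T
    (okPair (c , F c) (d , F d))
isSSYT⁻ F cs p {c} {d} c∈ d∈ rewrite zip-map F cs =
  T-foldr⁻ (okPair (c , F c)) (T-foldr⁻ _ p (∈-map⁺ (λ c → c , F c) c∈)) (∈-map⁺ (λ c → c , F c) d∈)

isSSYT⁺ : (F : Cell → ℕ) → ∀ cs → (∀ {c d} → c ∈ cs → d ∈ cs → T (okPair (c , F c) (d , F d))) → T
    (isSSYT cs (map F cs))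
isSSYT⁺ F cs p rewrite zip-map F cs = T-foldr⁺ _ (map (λ c → c , F c) cs) λ x∈ → T-foldr⁺ _
    (map (λ c → c , F c) cs) λ y∈ → ok x∈ y∈
  where
  ok : ∀ {x y} → x ∈ map (λ c → c , F c) cs → y ∈ map (λ c → c , F c) cs → T (okPair x y)
  ok x∈ y∈ with c , c∈ , refl ← ∈-map⁻ (λ c → c , F c) x∈ | d , d∈ , refl ← ∈-map⁻ (λ c → c , F c) y∈ = p c∈ d∈

ssyts : List ℕ → List ℕ → ℕ → List (List ℕ)
ssyts α β t = filter (λ f → T? (isSSYT (cells (α , β)) f)) (fillings t (length (cells (α , β))))

_≟c_ : (c d : Cell) → Dec (c ≡ d)
_≟c_ = ≡-dec _≟_ _≟_

assign : List Cell → List ℕ → Cell → ℕ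
assign (c ∷ cs) (v ∷ vs) d with c ≟c d
... | yes _ = v
... | no  _ = assign cs vs d
assign _ _ d = 0

map-assign : ∀ {cs} vs → Unique cs → length vs ≡ length cs → map (assign cs vs) cs ≡ vs
map-assign {[]}     []       u e = refl
map-assign {c ∷ cs} (v ∷ vs) (c∉ ∷ u) e = cong₂ _∷_ first
  (trans (map-cong-∈ cs others) (map-assign vs u (suc-injective e)))
  where
  first : assign (c ∷ cs) (v ∷ vs) c ≡ v
  first with c ≟c c
  ... | yes _ = refl
  ... | no  p = ⊥-elim (p refl)
  others : ∀ {d} → d ∈ cs → assign (c ∷ cs) (v ∷ vs) d ≡ assign cs vs d
  others {d} d∈ with c ≟c d
  ... | yes refl = ⊥-elim (All¬⇒¬Any c∉ d∈)
  ... | no  _    = refl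

∈-ssyts⁺ : ∀ {α β t F} → IsSSYT α β t F → map F (cells (α , β)) ∈ ssyts α β t
∈-ssyts⁺ {α} {β} {t} {F} s = ∈-filter⁺ (λ f → T? (isSSYT (cells (α , β)) f))
  (subst (λ n → map F (cells (α , β)) ∈ fillings t n) (length-map F (cells (α , β)))
    (∈-fillings⁺ t _ (All.tabulate λ p → let c , c∈ , e = ∈-map⁻ F p in
      subst (λ v → 1 ≤ v × v ≤ t) (sym e) (entries s (∈-cells⁻ α β c∈)))))
  (isSSYT⁺ F (cells (α , β)) λ {c} {d} p q → ok c d (∈-cells⁻ α β p) (∈-cells⁻ α β q))
  where
  ok : ∀ c d → c ∈S (α , β) → d ∈S (α , β) → T (okPair (c , F c) (d , F d))
  ok (i , j) (i′ , j′) p q = from (T-∧ {if (i ≡ᵇ i′) ∧ (j <ᵇ j′) then F (i , j) ≤ᵇ F (i′ , j′) else true})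
    ( T-if⁺ (i ≡ᵇ i′) (j <ᵇ j′) (λ a b → inRow (≡ᵇ⇒≡ i i′ a) (<ᵇ⇒< j j′ b))
    , T-if⁺ (j ≡ᵇ j′) (i <ᵇ i′) (λ a b → inColumn (≡ᵇ⇒≡ j j′ a) (<ᵇ⇒< i i′ b)))
    where
    inRow : i ≡ i′ → j < j′ → T (F (i , j) ≤ᵇ F (i′ , j′))
    inRow refl l = ≤⇒≤ᵇ (rows s p q l)
    inColumn : j ≡ j′ → i < i′ → T (F (i , j) <ᵇ F (i′ , j′))
    inColumn refl l = <⇒<ᵇ (columns s p q l)

∈-ssyts⁻ : ∀ α β t {f} → f ∈ ssyts α β t →
  map (assign (cells (α , β)) f) (cells (α , β)) ≡ f × IsSSYT α β t (assign (cells (α , β)) f)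
∈-ssyts⁻ α β t {f} f∈ with f∈′ , ok ← ∈-filter⁻ (λ f → T? (isSSYT (cells (α , β)) f)) {xs = fillings t
    (length (cells (α , β)))} f∈
  with e , bounds ← ∈-fillings⁻ t (length (cells (α , β))) f∈′ = eq , record
    { entries = λ p → All.lookup bounds (subst (F _ ∈_) eq (∈-map⁺ F (∈-cells⁺ α β p)))
    ; rows = λ {i} {j} {j′} p q l → ≤ᵇ⇒≤ _ _ (T-if⁻ (i ≡ᵇ i) (j <ᵇ j′) (proj₁ (to T-∧ (pair p q))) (≡⇒≡ᵇ i i refl)
        (<⇒<ᵇ l))
    ; columns = λ {i} {i′} {j} p q l → <ᵇ⇒< _ _ (T-if⁻ (j ≡ᵇ j) (i <ᵇ i′)
        (proj₂ (to (T-∧ {if (i ≡ᵇ i′) ∧ (j <ᵇ j) then F (i , j) ≤ᵇ F (i′ , j) else true}) (pair p q)))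
            (≡⇒≡ᵇ j j refl) (<⇒<ᵇ l))
    }
  where
  F = assign (cells (α , β)) f
  eq = map-assign f (unique-cells α β) (proj₁ (∈-fillings⁻ t (length (cells (α , β)))
      (proj₁ (∈-filter⁻ (λ f → T? (isSSYT (cells (α , β)) f)) {xs = fillings t (length (cells (α , β)))} f∈))))
  pair : ∀ {c d} → c ∈S (α , β) → d ∈S (α , β) → T (okPair (c , F c) (d , F d))
  pair p q = isSSYT⁻ F (cells (α , β)) (subst (λ g → T (isSSYT (cells (α , β)) g)) (sym eq)
    (proj₂ (∈-filter⁻ (λ f → T? (isSSYT (cells (α , β)) f)) {xs = fillings t (length (cells (α , β)))} f∈)))
    (∈-cells⁺ α β p) (∈-cells⁺ α β q)

unique-ssyts : ∀ α β t → Unique (ssyts α β t)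
unique-ssyts α β t = Unique.filter⁺ (λ f → T? (isSSYT (cells (α , β)) f)) (unique-fillings t (length (cells (α , β))))

open IsSSYT

∈S-between : ∀ {α β γ} → (∀ i → row γ i ≤ row β i) → ∀ c → c ∈S (α , β) → c ∈S (α , γ)
∈S-between le (i , j) (p , q) = ≤-trans (s≤s (le i)) p , q

-- A tableau of shape λ/μ is a horizontal strip ν/μ of entries 1 and a raised tableau of shape λ/ν.
raise : List ℕ → (Cell → ℕ) → Cell → ℕ
raise ns F (i , j) with j ≤? row ns i
... | yes _ = 1
... | no  _ = suc (F (i , j))

raise-∈ : ∀ ns F i j → j ≤ row ns i → raise ns F (i , j) ≡ 1
raise-∈ ns F i j p with j ≤? row ns i
... | yes _ = refl
... | no  q = ⊥-elim (q p)

raise-∉ : ∀ ns F i j → row ns i < j → raise ns F (i , j) ≡ suc (F (i , j))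
raise-∉ ns F i j p with j ≤? row ns i
... | yes q = ⊥-elim (<-irrefl refl (≤-trans p q))
... | no  _ = refl

raise-SSYT : ∀ {B ls ms ns t F} → Linked _≥_ ms → HStrip B ms ns → IsSSYT ls ns t F → IsSSYT ls ms (suc t)
    (raise ns F)
raise-SSYT {B} {ls} {ms} {ns} {t} {F} lk h s = record { entries = λ {c} → ent c ; rows = rw ; columns = cl }
  where
  ent : ∀ c → c ∈S (ls , ms) → 1 ≤ raise ns F c × raise ns F c ≤ suc t
  ent (i , j) (p , q) with j ≤? row ns i
  ... | yes _ = ≤-refl , s≤s z≤n
  ... | no  r = s≤s z≤n , s≤s (proj₂ (entries s {i , j} (≰⇒> r , q)))
  rw : ∀ {i j j′} → (i , j) ∈S (ls , ms) → (i , j′) ∈S (ls , ms) → j < j′ → raise ns F (i , j) ≤ raise ns F (i , j′)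
  rw {i} {j} {j′} p q l with j ≤? row ns i | j′ ≤? row ns i
  ... | yes _ | yes _ = ≤-refl
  ... | yes _ | no  _ = s≤s z≤n
  ... | no  r | yes r′ = ⊥-elim (r (≤-trans (<⇒≤ l) r′))
  ... | no  r | no  r′ = s≤s (rows s (≰⇒> r , proj₂ p) (≰⇒> r′ , proj₂ q) l)
  cl : ∀ {i i′ j} → (i , j) ∈S (ls , ms) → (i′ , j) ∈S (ls , ms) → i < i′ → raise ns F (i , j) < raise ns F (i′ , j)
  cl {i} {i′} {j} p q l with j ≤? row ns i | j ≤? row ns i′
  -- Below a cell of λ/μ its column has no cell of ν, since ν/μ is a horizontal strip: row i′ of ν
  -- is no longer than row i of μ.
  ... | _     | yes r′ = ⊥-elim (<-irrefl refl (≤-trans (proj₁ p)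
      (≤-trans r′ (strip i i′ (proj₁ (∈S-row {ls} {ms} p)) l))))
    where
    strip : ∀ i i′ → 1 ≤ i → i < i′ → row ns i′ ≤ row ms i
    strip (suc i) (suc (suc i′)) _ (s≤s l) = ≤-trans (hstrip-row-≥ h i′) (row-antitone lk (s≤s z≤n) l)
    strip (suc i) (suc zero) _ (s≤s ())
  ... | yes r | no  r′ = s≤s (proj₁ (entries s {i′ , j} (≰⇒> r′ , proj₂ q)))
  ... | no  r | no  r′ = s≤s (columns s (≰⇒> r , proj₂ p) (≰⇒> r′ , proj₂ q) l)

-- Applied to a row of a tableau, k is the last column with entry 1. The scan starts at the right
-- end, where one value at most 1 settles all columns before it.
cut : (f : ℕ → ℕ) → ∀ a d → (∀ {j j′} → a < j → j < j′ → j′ ≤ a + d → f j ≤ f j′) →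
  ∃ λ k → a ≤ k × k ≤ a + d × (∀ {j} → a < j → j ≤ k → f j ≤ 1) × (∀ {j} → k < j → j ≤ a + d → 1 < f j)
cut f a zero    mono rewrite +-comm a 0 = a , ≤-refl , ≤-refl ,
    (λ p q → ⊥-elim (<-irrefl refl (≤-trans p q))) , λ p q → ⊥-elim (<-irrefl refl (≤-trans p q))
cut f a (suc d) mono rewrite +-suc a d with f (suc (a + d)) ≤? 1
... | yes p = suc (a + d) , m≤n⇒m≤1+n (m≤m+n a d) , ≤-refl , (λ {j} q r → below j q r) , λ q r → ⊥-elim
    (<-irrefl refl (≤-trans q r))
  where
  below : ∀ j → a < j → j ≤ suc (a + d) → f j ≤ 1
  below j q r with <-cmp j (suc (a + d))
  ... | tri< l _ _    = ≤-trans (mono q l ≤-refl) p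
  ... | tri≈ _ refl _ = p
  ... | tri> _ _ g    = ⊥-elim (<-irrefl refl (≤-trans g r))
... | no  p with k , a≤k , k≤ , lo , hi ← cut f a d (λ q l r → mono q l (m≤n⇒m≤1+n r)) =
  k , a≤k , m≤n⇒m≤1+n k≤ , lo , λ {j} q r → above j q r
  where
  above : ∀ j → k < j → j ≤ suc (a + d) → 1 < f j
  above j q r with <-cmp j (suc (a + d))
  ... | tri< l _ _    = hi q (≤-pred l)
  ... | tri≈ _ refl _ = ≰⇒> p
  ... | tri> _ _ g    = ⊥-elim (<-irrefl refl (≤-trans g r))

module OnesShape {B t} {ls ms : List ℕ} {F : Cell → ℕ} (lk : Linked _≥_ (B ∷ ls)) (mk : Linked _≥_ ms)
  (len : length ms ≡ length ls) (ms≤ls : ∀ i → row ms i ≤ row ls i) (s : IsSSYT ls ms t F) where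

  rowCut : ∀ i → ∃ λ k → row ms i ≤ k × k ≤ row ls i ×
    (∀ {j} → row ms i < j → j ≤ k → F (i , j) ≤ 1) × (∀ {j} → k < j → j ≤ row ls i → 1 < F (i , j))
  rowCut i = subst (λ b → ∃ λ k → row ms i ≤ k × k ≤ b ×
      (∀ {j} → row ms i < j → j ≤ k → F (i , j) ≤ 1) × (∀ {j} → k < j → j ≤ b → 1 < F (i , j)))
    e (cut (λ j → F (i , j)) (row ms i) (row ls i ∸ row ms i)
      (λ {j} {j′} p l q → rows s (p , ≤-trans (<⇒≤ l) (subst (j′ ≤_) e q)) (≤-trans p (<⇒≤ l) , subst (j′ ≤_) e q) l))
    where
    e = m+[n∸m]≡n (ms≤ls i)

  g : ℕ → ℕ
  g i = proj₁ (rowCut i)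

  ones : List ℕ
  ones = map g (range 1 (length ls))

  length-ones : length ones ≡ length ls
  length-ones = trans (length-map g (range 1 (length ls))) (length-range 1 (length ls))

  row-ones : ∀ i → row ones (suc i) ≡ g (suc i)
  row-ones i with suc i ≤? length ls
  ... | yes p = row-map-range g 1 (length ls) i p
  ... | no  p = trans (row-beyond ones (suc i) (subst (_< suc i) (sym length-ones) (≰⇒> p)))
    (sym (≤0 (subst (g (suc i) ≤_) (row-beyond ls (suc i) (≰⇒> p)) (proj₁ (proj₂ (proj₂ (rowCut (suc i))))))))
    where
    ≤0 : ∀ {n} → n ≤ 0 → n ≡ 0
    ≤0 z≤n = refl

  ones-≤ : ∀ i → row ones i ≤ row ls i
  ones-≤ zero    = z≤n
  ones-≤ (suc i) rewrite row-ones i = proj₁ (proj₂ (proj₂ (rowCut (suc i))))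

  ones-≥ : ∀ i → row ms i ≤ row ones i
  ones-≥ zero    = z≤n
  ones-≥ (suc i) rewrite row-ones i = proj₁ (proj₂ (rowCut (suc i)))

  ones-on : ∀ i {j} → row ms i < j → j ≤ row ones i → F (i , j) ≤ 1
  ones-on zero    p z≤n = ⊥-elim (m<n⇒n≢0 p refl)
  ones-on (suc i) p q = proj₁ (proj₂ (proj₂ (proj₂ (rowCut (suc i))))) p (subst (_ ≤_) (row-ones i) q)

  ones-off : ∀ i {j} → row ones i < j → j ≤ row ls i → 1 < F (i , j)
  ones-off zero    p z≤n = ⊥-elim (m<n⇒n≢0 p refl)
  ones-off (suc i) p q = proj₂ (proj₂ (proj₂ (proj₂ (rowCut (suc i))))) (subst (_< _) (row-ones i) p) q

  ones-strip : HStrip B ms ones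
  ones-strip = hstrip-from-rows B ms ones (trans len (sym length-ones))
    (≤-trans (ones-≤ 1) (head≤ lk)) ones-≥ horizontal
    where
    head≤ : ∀ {ls} → Linked _≥_ (B ∷ ls) → row ls 1 ≤ B
    head≤ [-]     = z≤n
    head≤ (p ∷ _) = p
    -- Otherwise a column would have an entry at most 1 directly below a positive entry.
    horizontal : ∀ i → row ones (suc (suc i)) ≤ row ms (suc i)
    horizontal i with row ones (suc (suc i)) ≤? row ms (suc i)
    ... | yes p = p
    ... | no  p = ⊥-elim (<-irrefl refl (≤-trans (columns s cell cell′ (n<1+n _)) (≤-trans
        (ones-on (suc (suc i)) (proj₁ cell′) ≤-refl) (proj₁ (entries s {suc i , j} cell)))))
      where
      j = row ones (suc (suc i))
      cell : (suc i , j) ∈S (ls , ms)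
      cell = ≰⇒> p , ≤-trans (ones-≤ (suc (suc i))) (row-antitone (Linked.tail lk) (s≤s z≤n) (n≤1+n _))
      cell′ : (suc (suc i) , j) ∈S (ls , ms)
      cell′ = ≤-trans (s≤s (row-antitone mk (s≤s z≤n) (n≤1+n _))) (≰⇒> p) , ones-≤ (suc (suc i))

  lowered : Cell → ℕ
  lowered c = F c ∸ 1

  lowered-SSYT : ∀ {t′} → t ≡ suc t′ → IsSSYT ls ones t′ lowered
  lowered-SSYT refl = record
    { entries = λ {c} p → ≤-pred (subst (2 ≤_) (sym (pos c p)) (big c p)) , ≤-pred
        (subst (_≤ t) (sym (pos c p)) (proj₂ (entries s {c} (up c p))))
    ; rows    = λ {i} {j} {j′} p q l → ∸-monoˡ-≤ 1 (rows s (up (i , j) p) (up (i , j′) q) l)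
    ; columns = λ {i} {i′} {j} p q l → ∸-monoˡ-< (columns s (up (i , j) p) (up (i′ , j) q) l)
        (proj₁ (entries s {i , j} (up (i , j) p)))
    }
    where
    up : ∀ c → c ∈S (ls , ones) → c ∈S (ls , ms)
    up = ∈S-between {ls} {ones} {ms} ones-≥
    big : ∀ c → c ∈S (ls , ones) → 2 ≤ F c
    big (i , j) (p , q) = ones-off i p q
    pos : ∀ c → c ∈S (ls , ones) → suc (F c ∸ 1) ≡ F c
    pos c p = m+[n∸m]≡n (<⇒≤ (big c p))

  -- `G` is arbitrary off the smaller shape, because a function recovered from its list of values by
  -- `assign` agrees with the original only on the listed cells.
  raise-lowered : ∀ c → c ∈S (ls , ms) → (G : Cell → ℕ) → (∀ d → d ∈S (ls , ones) → G d ≡ lowered d)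
      → raise ones G c ≡ F c
  raise-lowered (i , j) (p , q) G e with j ≤? row ones i
  ... | yes r = ≤-antisym (proj₁ (entries s {i , j} (p , q))) (ones-on i p r)
  ... | no  r = trans (cong suc (e (i , j) (≰⇒> r , q))) (m+[n∸m]≡n (<⇒≤ (ones-off i (≰⇒> r) q)))

unique-hstrips : ∀ B ms → Linked _≥_ (B ∷ ms) → Unique (hstrips B ms)
unique-hstrips B []       l       = [] ∷ []
unique-hstrips B (m ∷ ms) (_ ∷ l) = unique-concatMap _ (unique-hstrips m ms l)
  (λ _ → Unique.map⁺ ∷-injectiveˡ (unique-range m (suc B ∸ m)))
  λ { _ _ q r → same q r }
  where
  same : ∀ {i i′ y} {js js′ : List ℕ} → y ∈ map (_∷ i) js → y ∈ map (_∷ i′) js′ → i ≡ i′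
  same p q with _ , _ , refl ← ∈-map⁻ (_∷ _) p | _ , _ , e ← ∈-map⁻ (_∷ _) q = ∷-injectiveʳ e

_⊆?_ : ∀ ms ls → Dec (Pointwise _≤_ ms ls)
_⊆?_ = Pw.decidable _≤?_

module Step (B t : ℕ) (ls ms : List ℕ) (lk : Linked _≥_ (B ∷ ls)) (mk : Linked _≥_ (B ∷ ms))
  (len : length ms ≡ length ls) (ms≤ls : Pointwise _≤_ ms ls) where

  shapes : List (List ℕ)
  shapes = filter (_⊆? ls) (hstrips B ms)

  build : List ℕ → List ℕ → List ℕ
  build ns f = map (raise ns (assign (cells (ls , ns)) f)) (cells (ls , ms))

  built : List (List ℕ)
  built = concatMap (λ ns → map (build ns) (ssyts ls ns t)) shapes

  shape : ∀ {ns} → ns ∈ shapes → HStrip B ms ns × Pointwise _≤_ ns ls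
  shape p with q , r ← ∈-filter⁻ (_⊆? ls) {xs = hstrips B ms} p = ∈-hstrips⁻ B ms mk q , r

  length-shape : ∀ {ns} → ns ∈ shapes → length ns ≡ length ls
  length-shape p = trans (hstrip-length (proj₁ (shape p))) len

  build-agree : ∀ ns ns′ f f′ → build ns f ≡ build ns′ f′ → ∀ c → c ∈S (ls , ms) →
    raise ns (assign (cells (ls , ns)) f) c ≡ raise ns′ (assign (cells (ls , ns′)) f′) c
  build-agree ns ns′ f f′ e c c∈ = map-≡⁻ (cells (ls , ms)) e (∈-cells⁺ ls ms c∈)

  -- The strip can be recovered from the built filling as the place of its 1s: in a cell of ns′
  -- outside ns the first filling is at least 2, the second is 1.
  smaller : ∀ {ns ns′ f f′} → ns ∈ shapes → ns′ ∈ shapes → f ∈ ssyts ls ns t →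
    build ns f ≡ build ns′ f′ → ∀ i → row ns′ i ≤ row ns i
  smaller {ns} {ns′} {f} {f′} p p′ q e i with row ns′ i ≤? row ns i
  ... | yes r = r
  ... | no  r = ⊥-elim (<-irrefl refl (subst (1 <_) contra
      (s≤s (proj₁ (entries (proj₂ (∈-ssyts⁻ ls ns t q)) {i , row ns′ i} (≰⇒> r , inside))))))
    where
    inside : row ns′ i ≤ row ls i
    inside = row-≤ (proj₂ (shape p′)) i
    contra : suc (assign (cells (ls , ns)) f (i , row ns′ i)) ≡ 1
    contra = trans (sym (raise-∉ ns _ i (row ns′ i) (≰⇒> r)))
      (trans (build-agree ns ns′ f f′ e (i , row ns′ i)
          (≤-trans (s≤s (row-≤ (hstrip-⊇ (proj₁ (shape p))) i)) (≰⇒> r) , inside))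
        (raise-∈ ns′ _ i (row ns′ i) ≤-refl))

  same-shape : ∀ {ns ns′ f f′} → ns ∈ shapes → ns′ ∈ shapes → f ∈ ssyts ls ns t → f′ ∈ ssyts ls ns′ t →
    build ns f ≡ build ns′ f′ → ns ≡ ns′
  same-shape p p′ q q′ e = row-ext (trans (length-shape p) (sym (length-shape p′)))
    (λ i → ≤-antisym (smaller p′ p q′ (sym e) i) (smaller p p′ q e i))

  build-injective : ∀ {ns f f′} → ns ∈ shapes → f ∈ ssyts ls ns t → f′ ∈ ssyts ls ns t → build ns f ≡ build ns f′
      → f ≡ f′
  build-injective {ns} {f} {f′} p q q′ e = trans (sym (proj₁ (∈-ssyts⁻ ls ns t q)))
    (trans (map-cong-∈ (cells (ls , ns)) (λ {c} c∈ → agree c (∈-cells⁻ ls ns c∈))) (proj₁ (∈-ssyts⁻ ls ns t q′)))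
    where
    agree : ∀ c → c ∈S (ls , ns) → assign (cells (ls , ns)) f c ≡ assign (cells (ls , ns)) f′ c
    agree (i , j) c∈ = suc-injective (trans (sym (raise-∉ ns _ i j (proj₁ c∈)))
      (trans (build-agree ns ns f f′ e (i , j) (∈S-between {ls} {ns} {ms} (row-≤ (hstrip-⊇ (proj₁ (shape p))))
          (i , j) c∈)) (raise-∉ ns _ i j (proj₁ c∈))))

  unique-filtered : Unique shapes
  unique-filtered = Unique.filter⁺ (_⊆? ls) (unique-hstrips B ms mk)

  unique-built : Unique built
  unique-built = unique-concatMap _ unique-filtered
    (λ {ns} p → unique-map-on (build ns) (unique-ssyts ls ns t) (build-injective p))
    λ {ns} {ns′} p p′ q q′ → same p p′ q q′
    where
    same : ∀ {ns ns′ y} → ns ∈ shapes → ns′ ∈ shapes → y ∈ map (build ns) (ssyts ls ns t) → y ∈ map (build ns′)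
        (ssyts ls ns′ t) → ns ≡ ns′
    same {ns} {ns′} p p′ q q′ with _ , r , refl ← ∈-map⁻ (build ns) q | _ , r′ , e ← ∈-map⁻
        (build ns′) q′ = same-shape p p′ r r′ e

  built-⊆ : ∀ {f} → f ∈ built → f ∈ ssyts ls ms (suc t)
  built-⊆ f∈ with ns , p , q ← ∈-concatMap⁻′ _ shapes f∈ with f′ , r , refl ← ∈-map⁻ (build ns) q =
    ∈-ssyts⁺ (raise-SSYT (Linked.tail mk) (proj₁ (shape p)) (proj₂ (∈-ssyts⁻ ls ns t r)))

  built-⊇ : ∀ {f} → f ∈ ssyts ls ms (suc t) → f ∈ built
  built-⊇ {f} f∈ = ∈-concatMap⁺′ _ (∈-filter⁺ (_⊆? ls) (∈-hstrips⁺ ones-strip) (pointwise-row length-ones ones-≤))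
    (subst (_∈ map (build ones) (ssyts ls ones t)) back (∈-map⁺ (build ones) low∈))
    where
    F = assign (cells (ls , ms)) f
    open OnesShape lk (Linked.tail mk) len (row-≤ ms≤ls) (proj₂ (∈-ssyts⁻ ls ms (suc t) f∈))
    low∈ : map lowered (cells (ls , ones)) ∈ ssyts ls ones t
    low∈ = ∈-ssyts⁺ (lowered-SSYT refl)
    back : build ones (map lowered (cells (ls , ones))) ≡ f
    back = trans (map-cong-∈ (cells (ls , ms)) λ {c} c∈ → raise-lowered c (∈-cells⁻ ls ms c∈) _
        λ d d∈ → map-≡⁻ (cells (ls , ones)) (map-assign (map lowered (cells (ls , ones))) (unique-cells ls ones)
            (length-map lowered (cells (ls , ones)))) (∈-cells⁺ ls ones d∈))
      (proj₁ (∈-ssyts⁻ ls ms (suc t) f∈))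

  length-concatMap : (f : X → List Y) → ∀ xs → ℕtoℚ (length (concatMap f xs)) ≡ ΣL (λ x → ℕtoℚ (length (f x))) xs
  length-concatMap f []       = refl
  length-concatMap f (x ∷ xs) = trans (cong ℕtoℚ (length-++ (f x)))
      (trans (ℕtoℚ-+ (length (f x)) (length (concatMap f xs)))
    (cong (ℕtoℚ (length (f x)) +ℚ_) (length-concatMap f xs)))

  count-suc : ℕtoℚ (ssytCount ls ms (suc t)) ≡ ΣL (λ ns → ℕtoℚ (ssytCount ls ns t)) shapes
  count-suc = trans (cong ℕtoℚ (unique-same-length (unique-ssyts ls ms (suc t)) unique-built built-⊇ built-⊆))
    (trans (length-concatMap _ shapes)
      (ΣL-cong (λ ns → cong ℕtoℚ (length-map (build ns) (ssyts ls ns t))) shapes))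

-- Jacobi-Trudi by induction on the number of variables

ΣL-filter : {P : X → Set} (P? : ∀ x → Dec (P x)) (f : X → ℚ) → ∀ xs → (∀ {x} → x ∈ xs → ¬ P x → f x ≡ 0ℚ) →
  ΣL f (filter P? xs) ≡ ΣL f xs
ΣL-filter P? f []       z = refl
ΣL-filter P? f (x ∷ xs) z with P? x
... | yes p = cong (f x +ℚ_) (ΣL-filter P? f xs (z ∘ aThere))
... | no  p = trans (ΣL-filter P? f xs (z ∘ aThere)) (sym
    (trans (cong (_+ℚ ΣL f xs) (z (aHere refl) p)) (ℚ.+-identityˡ _)))

ssytCount-0-≡ : ∀ ls → ssytCount ls ls 0 ≡ 1
ssytCount-0-≡ ls with cells (ls , ls) in eq
... | []    = refl
... | c ∷ _ = ⊥-elim (absurd c (∈-cells⁻ ls ls (subst (c ∈_) (sym eq) (aHere refl))))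
  where
  absurd : ∀ c → ¬ (c ∈S (ls , ls))
  absurd (i , j) (p , q) = <-irrefl refl (≤-trans p q)

ssytCount-0-≢ : ∀ ls ms → length ms ≡ length ls → (∀ i → row ms i ≤ row ls i) → ms ≢ ls → ssytCount ls ms 0 ≡ 0
ssytCount-0-≢ ls ms len le p with cells (ls , ms) in eq
... | _ ∷ _ = refl
... | []    = ⊥-elim (p (row-ext len λ i → ≤-antisym (le i) (full i)))
  where
  none : ∀ {c} → ¬ (c ∈ [])
  none ()
  full : ∀ i → row ls i ≤ row ms i
  full i with row ls i ≤? row ms i
  ... | yes q = q
  ... | no  q = ⊥-elim (none (subst ((i , row ls i) ∈_) eq (∈-cells⁺ ls ms (≰⇒> q , ≤-refl))))

jacobi-trudi-0 : ∀ ls ms → Linked _≥_ ls → Linked _≥_ ms → length ms ≡ length ls → (∀ i → row ms i ≤ row ls i) →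
  Dec (ms ≡ ls) → ℕtoℚ (ssytCount ls ms 0) ≡ detBeads 0 ls ms
jacobi-trudi-0 ls ms lk mk len le (yes refl) = trans (cong ℕtoℚ (ssytCount-0-≡ ls)) (sym (detBeads-0-≡ ls lk))
jacobi-trudi-0 ls ms lk mk len le (no p) =
  trans (cong ℕtoℚ (ssytCount-0-≢ ls ms len le p)) (sym (detBeads-0-≢ ls ms lk mk len p))

-- The inner shape varies in the induction, since the step passes to the shapes λ/ν. Tableaux give a
-- sum over the ν inside λ; `ΣL-filter` adds the other ν, whose determinants are 0.
jacobi-trudi : ∀ t B ls ms → Linked _≥_ (B ∷ ls) → Linked _≥_ (B ∷ ms) → length ms ≡ length ls → Pointwise _≤_ ms ls →
  ℕtoℚ (ssytCount ls ms t) ≡ detBeads t ls ms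
jacobi-trudi zero B ls ms lk mk len le =
  jacobi-trudi-0 ls ms (Linked.tail lk) (Linked.tail mk) len (row-≤ le) (≡-decList _≟_ ms ls)
jacobi-trudi (suc t) B ls ms lk mk len le = begin
  ℕtoℚ (ssytCount ls ms (suc t))                   ≡⟨ count-suc ⟩
  ΣL (λ ns → ℕtoℚ (ssytCount ls ns t)) shapes
    ≡⟨ ΣL-cong-∈ shapes (λ {ns} p →
         jacobi-trudi t B ls ns lk (hstrip-linked (proj₁ (shape p))) (length-shape p) (proj₂ (shape p))) ⟩
  ΣL (detBeads t ls) shapes
    ≡⟨ ΣL-filter (_⊆? ls) (detBeads t ls) (hstrips B ms) (λ {ns} p → let hs = ∈-hstrips⁻ B ms mk p in
         detBeads-⊈ t B ls ns lk (hstrip-linked hs) (trans (hstrip-length hs) len)) ⟩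
  ΣL (detBeads t ls) (hstrips B ms)                ≡⟨ detBeads-suc t B ls ms lk mk len ⟨
  detBeads (suc t) ls ms                           ∎
  where
  open Step B t ls ms lk mk len le

-- Border strips and beads

-- α/β is the part of the rim of α in the rows p, …, q, cut off at column β_q in row q.
record Strip (α β : List ℕ) (p q : ℕ) : Set where
  field
    1≤p    : 1 ≤ p
    p≤q    : p ≤ q
    above  : ∀ i → i < p → row β i ≡ row α i
    inside : ∀ i → p ≤ i → i < q → suc (row β i) ≡ row α (suc i)
    last   : row β q < row α q
    below  : ∀ i → q < i → row β i ≡ row α i

least : {P : ℕ → Set} → (∀ i → Dec (P i)) → ∀ n → P n → ∃ λ p → p ≤ n × P p × (∀ i → i < p → ¬ P i)
least P? zero    Pn = zero , z≤n , Pn , λ _ ()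
least {P} P? (suc n) Pn with P? 0
... | yes P0 = zero , z≤n , P0 , λ _ ()
... | no ¬P0 with p , p≤n , Pp , m ← least {λ i → P (suc i)} (λ i → P? (suc i)) n Pn =
  suc p , s≤s p≤n , Pp , λ { zero _ → ¬P0 ; (suc i) (s≤s l) → m i l }

greatest : {P : ℕ → Set} → (∀ i → Dec (P i)) → ∀ N → (∀ i → N < i → ¬ P i) → ∀ n → P n →
  ∃ λ q → n ≤ q × P q × (∀ i → q < i → ¬ P i)
greatest P? zero    bd zero    Pn = zero , z≤n , Pn , bd
greatest P? zero    bd (suc n) Pn = ⊥-elim (bd (suc n) (s≤s z≤n) Pn)
greatest {P} P? (suc N) bd n Pn with P? (suc N)
... | yes PN = suc N , n≤N , PN , bd
  where
  n≤N : n ≤ suc N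
  n≤N with n ≤? suc N
  ... | yes r = r
  ... | no  r = ⊥-elim (bd n (≰⇒> r) Pn)
... | no ¬PN = greatest P? N bd′ n Pn
  where
  bd′ : ∀ i → N < i → ¬ P i
  bd′ i l with <-cmp i (suc N)
  ... | tri< r _ _    = ⊥-elim (<-irrefl refl (≤-trans l (≤-pred r)))
  ... | tri≈ _ refl _ = ¬PN
  ... | tri> _ _ r    = bd i r

-- Adjacent cells differ by at most one row, so the step of the walk that leaves the rows up to i is
-- vertical.
reach-crosses : ∀ {S c d} i → c ∈S S → Reach S c d → proj₁ c ≤ i → i < proj₁ d → ∃ λ j → (i , j) ∈S S ×
    (suc i , j) ∈S S
reach-crosses i c∈ here p q = ⊥-elim (<-irrefl refl (≤-trans q p))
reach-crosses i c∈ (step {c} {c′} adj c′∈ r) p q with proj₁ c′ ≤? i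
... | yes p′ = reach-crosses i c′∈ r p′ q
... | no  p′ = cross c c′ c∈ c′∈ adj p (≰⇒> p′)
  where
  cross : ∀ {S} c c′ → c ∈S S → c′ ∈S S → Adjacent c c′ → proj₁ c ≤ i → i < proj₁ c′ → ∃ λ j → (i , j) ∈S S ×
      (suc i , j) ∈S S
  cross (k , j) (k′ , j′) c∈ c′∈ (inj₁ (refl , _)) p q = ⊥-elim (<-irrefl refl (≤-trans q p))
  cross (k , j) (k′ , j′) c∈ c′∈ (inj₂ (refl , inj₁ refl)) p q with refl ← ≤-antisym p (≤-pred q) = j , c∈ , c′∈
  cross (k , j) (k′ , j′) c∈ c′∈ (inj₂ (refl , inj₂ refl)) p q = ⊥-elim
      (<-irrefl refl (≤-trans q (≤-trans (n≤1+n k′) p)))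

-- Connectedness makes consecutive rows overlap in at least one column, and the absence of 2x2
-- squares in at most one; together this is `inside`. The rows p and q are the first and the last
-- nonempty row.
borderStrip⇒strip : ∀ {α β} → IsPartition α → IsPartition β → β ⊆ₚ α → IsBorderStrip (α , β) → ∃₂ λ p q
    → Strip α β p q
borderStrip⇒strip {α} {β} Pα Pβ β⊆α (((i₀ , j₀) , (lo , hi)) , conn , no2) = p , q , record
  { 1≤p = 1≤p ; p≤q = p≤q
  ; above = λ i l → ≤-antisym (β⊆α i) (≮⇒≥ (proj₂ (proj₂ (proj₂ first)) i l))
  ; inside = λ i l r → ≤-antisym (meets i l r) (thin i (≤-trans 1≤p l))
  ; last = proj₁ (proj₂ (proj₂ final))
  ; below = λ i l → ≤-antisym (β⊆α i) (≮⇒≥ (proj₂ (proj₂ (proj₂ final)) i l)) }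
  where
  P? : ∀ i → Dec (row β i < row α i)
  P? i = row β i <? row α i
  first = least P? i₀ (≤-trans lo hi)
  final = greatest P? (length α) (λ i l r → ⊥-elim (m<n⇒n≢0 r (row-beyond α i l))) i₀ (≤-trans lo hi)
  p = proj₁ first
  q = proj₁ final
  1≤p : 1 ≤ p
  1≤p = proj₁ (∈S-row {α} {β} {p} {row α p} (proj₁ (proj₂ (proj₂ first)) , ≤-refl))
  p≤q : p ≤ q
  p≤q = ≤-trans (proj₁ (proj₂ first)) (proj₁ (proj₂ final))
  meets : ∀ i → p ≤ i → i < q → row β i < row α (suc i)
  meets i l r with j , a , b ← reach-crosses i (proj₁ (proj₂ (proj₂ first)) , ≤-refl)
    (conn (p , row α p) (q , row α q) (proj₁ (proj₂ (proj₂ first)) , ≤-refl)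
        (proj₁ (proj₂ (proj₂ final)) , ≤-refl)) l r
    = ≤-trans (proj₁ a) (proj₂ b)
  thin : ∀ i → 1 ≤ i → row α (suc i) ≤ suc (row β i)
  thin i 1≤i with row α (suc i) ≤? suc (row β i)
  ... | yes r = r
  ... | no  r = ⊥-elim (no2 (i , suc (row β i) ,
      (≤-refl , ≤-trans (n≤1+n _) w) , (s≤s (n≤1+n _) , w) ,
      (s≤s (row-antitone Pβ 1≤i (n≤1+n i)) , ≤-trans (n≤1+n _) (≰⇒> r)) ,
      (s≤s (≤-trans (row-antitone Pβ 1≤i (n≤1+n i)) (n≤1+n _)) , ≰⇒> r)))
    where
    w : suc (suc (row β i)) ≤ row α i
    w = ≤-trans (≰⇒> r) (row-antitone Pα 1≤i (n≤1+n i))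

open Strip

strip-row-< : ∀ {α β p q} → IsPartition α → Strip α β p q → ∀ i → p ≤ i → i ≤ q → row β i < row α i
strip-row-< {α} {q = q} Pα s i l r with <-cmp i q
... | tri≈ _ refl _ = last s
... | tri< t _ _    = subst (_≤ row α i) (sym (inside s i l t)) (row-antitone Pα (≤-trans (1≤p s) l) (n≤1+n i))
... | tri> _ _ t    = ⊥-elim (<-irrefl refl (≤-trans t r))

strip-rows : ∀ {α β p q} → Strip α β p q → ∀ i → row β i < row α i → p ≤ i × i ≤ q
strip-rows {p = p} {q} s i l with p ≤? i | i ≤? q
... | yes a | yes b = a , b
... | no  a | _     = ⊥-elim (<⇒≢ l (above s i (≰⇒> a)))
... | _     | no  b = ⊥-elim (<⇒≢ l (below s i (≰⇒> b)))

strip-⊆ : ∀ {α β p q} → IsPartition α → Strip α β p q → β ⊆ₚ α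
strip-⊆ {p = p} {q} Pα s i with p ≤? i | i ≤? q
... | yes a | yes b = <⇒≤ (strip-row-< Pα s i a b)
... | no  a | _     = ≤-reflexive (above s i (≰⇒> a))
... | _     | no  b = ≤-reflexive (below s i (≰⇒> b))

adjacent-sym : ∀ c d → Adjacent c d → Adjacent d c
adjacent-sym _ _ (inj₁ (refl , inj₁ e)) = inj₁ (refl , inj₂ (sym e))
adjacent-sym _ _ (inj₁ (refl , inj₂ e)) = inj₁ (refl , inj₁ (sym e))
adjacent-sym _ _ (inj₂ (refl , inj₁ e)) = inj₂ (refl , inj₂ (sym e))
adjacent-sym _ _ (inj₂ (refl , inj₂ e)) = inj₂ (refl , inj₁ (sym e))

reach-trans : ∀ {S c d e} → Reach S c d → Reach S d e → Reach S c e
reach-trans here           r′ = r′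
reach-trans (step a c∈ r) r′ = step a c∈ (reach-trans r r′)

reach-sym : ∀ {S c d} → c ∈S S → Reach S c d → Reach S d c
reach-sym c∈ here = here
reach-sym c∈ (step {c} {c′} a c′∈ r) = reach-trans (reach-sym c′∈ r) (step (adjacent-sym c c′ a) c∈ here)

-- Lets enlarged strips compete with a maximal one. Every cell reaches the end of row q: walk to the
-- left end of the row, whose column is the last column of the next row, and step down.
strip⇒borderStrip : ∀ {α β p q} → IsPartition α → Strip α β p q → IsBorderStrip (α , β)
strip⇒borderStrip {α} {β} {p} {q} Pα s = ((q , row α q) , (last s , ≤-refl)) , conn , no2
  where
  walk : ∀ i j d → (i , j) ∈S (α , β) → j + d ≤ row α i → Reach (α , β) (i , j) (i , j + d)
  walk i j zero    (lo , hi) le rewrite +-identityʳ j = here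
  walk i j (suc d) (lo , hi) le rewrite +-suc j d = step (inj₁ (refl , inj₁ refl)) c∈ (walk i (suc j) d c∈ le)
    where
    c∈ : (i , suc j) ∈S (α , β)
    c∈ = ≤-trans lo (n≤1+n j) , ≤-trans (s≤s (m≤m+n j d)) le
  walk-to : ∀ {i j j′} → (i , j) ∈S (α , β) → j ≤ j′ → j′ ≤ row α i → Reach (α , β) (i , j) (i , j′)
  walk-to {i} {j} {j′} c∈ l r = subst (λ k → Reach (α , β) (i , j) (i , k)) (m+[n∸m]≡n l)
    (walk i j (j′ ∸ j) c∈ (subst (_≤ row α i) (sym (m+[n∸m]≡n l)) r))
  anchor : ∀ k i j → i + k ≡ q → (i , j) ∈S (α , β) → Reach (α , β) (i , j) (q , row α q)
  anchor zero i j e c∈ with refl ← trans (sym (+-identityʳ i)) e = walk-to c∈ (proj₂ c∈) ≤-refl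
  anchor (suc k) i j e c∈ = reach-trans (reach-sym left∈ (walk-to left∈ (proj₁ c∈) (proj₂ c∈)))
      (step (inj₂ (refl , inj₁ refl)) down∈ (anchor k (suc i) _ (trans (sym (+-suc i k)) e) down∈))
    where
    p≤i : p ≤ i
    p≤i = proj₁ (strip-rows s i (≤-trans (proj₁ c∈) (proj₂ c∈)))
    i<q : i < q
    i<q = subst (i <_) e (subst (i <_) (sym (+-suc i k)) (s≤s (m≤m+n i k)))
    left∈ : (i , suc (row β i)) ∈S (α , β)
    left∈ = ≤-refl , ≤-trans (proj₁ c∈) (proj₂ c∈)
    down∈ : (suc i , suc (row β i)) ∈S (α , β)
    down∈ = subst (λ j → (suc i , j) ∈S (α , β)) (sym (inside s i p≤i i<q))
        (strip-row-< Pα s (suc i) (m≤n⇒m≤1+n p≤i) i<q , ≤-refl)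
  to-anchor : ∀ i j → (i , j) ∈S (α , β) → Reach (α , β) (i , j) (q , row α q)
  to-anchor i j c∈ = anchor (q ∸ i) i j (m+[n∸m]≡n (proj₂ (strip-rows s i (≤-trans (proj₁ c∈) (proj₂ c∈))))) c∈
  conn : Connected (α , β)
  conn (i , j) (i′ , j′) c∈ d∈ = reach-trans (to-anchor i j c∈) (reach-sym d∈ (to-anchor i′ j′ d∈))
  no2 : No2x2 (α , β)
  no2 (i , j , a , _ , _ , b) = <-irrefl refl (≤-trans (proj₁ a) (≤-pred (subst (suc j ≤_) (sym
    (inside s i (proj₁ (strip-rows s i (≤-trans (proj₁ a) (proj₂ a))))
        (proj₂ (strip-rows s (suc i) (≤-trans (proj₁ b) (proj₂ b))))))
    (proj₂ b))))

-- The positions of the vertical steps of the boundary path, for N rows; positions start at 0 in the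
-- bottom left corner.
bead : ℕ → List ℕ → ℕ → ℕ
bead N α i = row α i + (N ∸ i)

beadList : ℕ → List ℕ → List ℕ
beadList N α = map (bead N α) (range 1 N)

range-++ : ∀ i m n → range i (m + n) ≡ range i m ++ range (i + m) n
range-++ i zero    n = cong (λ k → range k n) (sym (+-identityʳ i))
range-++ i (suc m) n = cong (i ∷_) (trans (range-++ (suc i) m n)
    (cong (λ k → range (suc i) m ++ range k n) (sym (+-suc i m))))

map-range-suc : (g : ℕ → X) → ∀ i n → map g (range (suc i) n) ≡ map (g ∘ suc) (range i n)
map-range-suc g i zero    = refl
map-range-suc g i (suc n) = cong (g (suc i) ∷_) (map-range-suc g (suc i) n)

beadList≡beads : ∀ ls → beadList (length ls) ls ≡ beads ls
beadList≡beads []       = refl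
beadList≡beads (l ∷ ls) = cong (l + length ls ∷_) (trans
    (map-range-suc (bead (suc (length ls)) (l ∷ ls)) 1 (length ls))
  (trans (map-cong-∈ (range 1 (length ls)) (λ p → same (proj₁ (∈-range⁻ 1 (length ls) p)))) (beadList≡beads ls)))
  where
  same : ∀ {i} → 1 ≤ i → bead (suc (length ls)) (l ∷ ls) (suc i) ≡ bead (length ls) ls i
  same {suc i} _ = refl

bead-strict : ∀ {N α i i′} → IsPartition α → 1 ≤ i → i < i′ → i′ ≤ N → bead N α i′ < bead N α i
bead-strict P a b c = +-mono-≤-< (row-antitone P a (<⇒≤ b)) (∸-monoʳ-< b c)

bead-antitone : ∀ {N α i i′} → IsPartition α → 1 ≤ i → i ≤ i′ → bead N α i′ ≤ bead N α i
bead-antitone {N} P a b = +-mono-≤ (row-antitone P a b) (∸-monoʳ-≤ N b)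

-- The tail count. Moving a bead from a to b < a lowers it by 1 exactly on (b, a].
cnt : List ℕ → ℕ → ℕ
cnt []       x = 0
cnt (a ∷ as) x = indicator (x ≤ᵇ a) + cnt as x

cnt-++ : ∀ as bs x → cnt (as ++ bs) x ≡ cnt as x + cnt bs x
cnt-++ []       bs x = refl
cnt-++ (a ∷ as) bs x = trans (cong (indicator (x ≤ᵇ a) +_) (cnt-++ as bs x)) (sym (+-assoc (indicator (x ≤ᵇ a)) _ _))

covers : ℕ × ℕ → ℕ → Bool
covers (b , a) x = (b <ᵇ x) ∧ (x ≤ᵇ a)

cover : List (ℕ × ℕ) → ℕ → ℕ
cover []      x = 0
cover (e ∷ I) x = indicator (covers e x) + cover I x

cover-++ : ∀ I J x → cover (I ++ J) x ≡ cover I x + cover J x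
cover-++ []      J x = refl
cover-++ (e ∷ I) J x = trans (cong (indicator (covers e x) +_) (cover-++ I J x))
    (sym (+-assoc (indicator (covers e x)) _ _))

indicator-T : ∀ {b} → T b → indicator b ≡ 1
indicator-T {true} _ = refl

indicator-¬T : ∀ {b} → ¬ T b → indicator b ≡ 0
indicator-¬T {true}  p = ⊥-elim (p tt)
indicator-¬T {false} p = refl

T-covers⁺ : ∀ {b a x} → b < x → x ≤ a → T (covers (b , a) x)
T-covers⁺ {b} {a} {x} p q = from (T-∧ {b <ᵇ x}) (<⇒<ᵇ p , ≤⇒≤ᵇ q)

T-covers⁻ : ∀ {b a x} → T (covers (b , a) x) → b < x × x ≤ a
T-covers⁻ {b} {a} {x} t with p , q ← to (T-∧ {b <ᵇ x}) t = <ᵇ⇒< b x p , ≤ᵇ⇒≤ x a q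

indicator-split : ∀ {b a} → b ≤ a → ∀ x → indicator (x ≤ᵇ a) ≡ indicator (covers (b , a) x) + indicator (x ≤ᵇ b)
indicator-split {b} {a} b≤a x with x ≤? b | x ≤? a
... | yes p | _     = trans (indicator-T (≤⇒≤ᵇ (≤-trans p b≤a)))
  (sym (cong₂ _+_ (indicator-¬T (λ t → <-irrefl refl (≤-trans (proj₁ (T-covers⁻ {b} {a} {x} t)) p)))
      (indicator-T (≤⇒≤ᵇ p))))
... | no  p | yes q = trans (indicator-T (≤⇒≤ᵇ q))
  (sym (cong₂ _+_ (indicator-T (T-covers⁺ (≰⇒> p) q)) (indicator-¬T (p ∘ ≤ᵇ⇒≤ x b))))
... | no  p | no  q = trans (indicator-¬T (q ∘ ≤ᵇ⇒≤ x a))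
  (sym (cong₂ _+_ (indicator-¬T (λ t → q (proj₂ (T-covers⁻ {b} {a} {x} t)))) (indicator-¬T (p ∘ ≤ᵇ⇒≤ x b))))

-- Beads are listed by rows. `mid` holds the beads jumped over: those of rows p + 1 to q of α, which
-- reappear in rows p to q - 1 of β.
record BeadMove (N : ℕ) (α β : List ℕ) (p q : ℕ) : Set where
  field
    pre mid post : List ℕ
    source : beadList N α ≡ pre ++ bead N α p ∷ mid ++ post
    target : beadList N β ≡ pre ++ mid ++ bead N β q ∷ post
    height≡ : length mid ≡ q ∸ p

-- Removing a border strip moves one bead to a free smaller position.
strip-beads : ∀ {N α β p q} → Strip α β p q → q ≤ N → BeadMove N α β p q
strip-beads {N} {α} {β} {suc p} {q} s q≤N = record
  { pre = map (bead N α) (range 1 p) ; mid = map (bead N β) (range (suc p) k) ; post = map (bead N α)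
      (range (suc q) m)
  ; source = trans (cong (map (bead N α)) split₁) (trans (map-++ (bead N α) (range 1 p) _)
      (cong (λ l → map (bead N α) (range 1 p) ++ bead N α (suc p) ∷ l)
          (trans (map-++ (bead N α) (range (suc (suc p)) k) _)
        (cong (_++ map (bead N α) (range (suc q) m)) (trans (map-range-suc (bead N α) (suc p) k)
          (map-cong-∈ (range (suc p) k) λ {i} i∈ → let a , b = ∈-range⁻ (suc p) k i∈ in shift-bead i a (subst (i <_) p+k b)))))))
  ; target = trans (cong (map (bead N β)) split₂) (trans (map-++ (bead N β) (range 1 p) _)
      (cong₂ _++_ (map-cong-∈ (range 1 p) λ {i} i∈ → cong (_+ (N ∸ i)) (above s i (proj₂ (∈-range⁻ 1 p i∈))))
        (trans (map-++ (bead N β) (range (suc p) k) _)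
            (cong (λ l → map (bead N β) (range (suc p) k) ++ bead N β q ∷ l)
          (map-cong-∈ (range (suc q) m) λ {i} i∈ → cong (_+ (N ∸ i)) (below s i (proj₁ (∈-range⁻ (suc q) m i∈))))))))
  ; height≡ = trans (length-map (bead N β) (range (suc p) k)) (length-range (suc p) k) }
  where
  k = q ∸ suc p
  m = N ∸ q
  p+k : suc p + k ≡ q
  p+k = m+[n∸m]≡n (p≤q s)
  total : p + (suc k + m) ≡ N
  total = trans (cong (p +_) (cong suc refl)) (trans (+-suc p (k + m))
      (trans (sym (+-assoc (suc p) k m)) (trans (cong (_+ m) p+k) (m+[n∸m]≡n q≤N))))
  split₁ : range 1 N ≡ range 1 p ++ suc p ∷ range (suc (suc p)) k ++ range (suc q) m
  split₁ = trans (cong (range 1) (sym total)) (trans (range-++ 1 p (suc k + m)) (cong (λ l → range 1 p ++ suc p ∷ l)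
    (trans (range-++ (suc (suc p)) k m) (cong (λ r → range (suc (suc p)) k ++ range (suc r) m) p+k))))
  split₂ : range 1 N ≡ range 1 p ++ range (suc p) k ++ q ∷ range (suc q) m
  split₂ = trans (cong (range 1) (sym (trans (cong (p +_) (+-suc k m)) total)))
      (trans (range-++ 1 p (k + suc m)) (cong (range 1 p ++_)
    (trans (range-++ (suc p) k (suc m)) (cong (λ r → range (suc p) k ++ r ∷ range (suc r) m) p+k))))
  -- One cell shorter and one row higher, the bead keeps its position.
  shift-bead : ∀ i → suc p ≤ i → i < q → bead N α (suc i) ≡ bead N β i
  shift-bead i a b = trans (cong (_+ (N ∸ suc i)) (sym (inside s i a b)))
    (trans (sym (+-suc (row β i) (N ∸ suc i))) (cong (row β i +_) (sym (+-∸-assoc 1 (≤-trans b q≤N)))))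
strip-beads {p = zero} s _ = ⊥-elim (<-irrefl refl (1≤p s))

strip-bead-< : ∀ {N α β p q} → IsPartition α → Strip α β p q → bead N β q < bead N α p
strip-bead-< {N} {q = q} Pα s = ≤-trans (+-monoˡ-< (N ∸ q) (last s)) (bead-antitone {N} Pα (1≤p s) (p≤q s))

strip-cnt : ∀ {N α β p q} → IsPartition α → Strip α β p q → q ≤ N → ∀ x →
  cnt (beadList N α) x ≡ indicator (covers (bead N β q , bead N α p) x) + cnt (beadList N β) x
strip-cnt {N} {α} {β} {p} {q} Pα s q≤N x = begin
  cnt (beadList N α) x                                       ≡⟨ cong (λ l → cnt l x) source ⟩
  cnt (pre ++ a ∷ mid ++ post) x                             ≡⟨ cnt-++ pre (a ∷ mid ++ post) x ⟩
  cnt pre x + (indicator (x ≤ᵇ a) + cnt (mid ++ post) x)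
    ≡⟨ cong (cnt pre x +_) (cong₂ _+_ (indicator-split (<⇒≤ (strip-bead-< {N} Pα s)) x) (cnt-++ mid post x)) ⟩
  cnt pre x + (indicator (covers (b , a) x) + indicator (x ≤ᵇ b) + (cnt mid x + cnt post x))
    ≡⟨ ℕS.solve 5 (λ P I J M Q → P ℕS.:+ (I ℕS.:+ J ℕS.:+ (M ℕS.:+ Q)) ℕS.:= I ℕS.:+
        (P ℕS.:+ (M ℕS.:+ (J ℕS.:+ Q)))) refl
         (cnt pre x) (indicator (covers (b , a) x)) (indicator (x ≤ᵇ b)) (cnt mid x) (cnt post x) ⟩
  indicator (covers (b , a) x) + (cnt pre x + (cnt mid x + (indicator (x ≤ᵇ b) + cnt post x)))
    ≡⟨ cong (λ n → indicator (covers (b , a) x) + (cnt pre x + n)) (cnt-++ mid (b ∷ post) x) ⟨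
  indicator (covers (b , a) x) + (cnt pre x + cnt (mid ++ b ∷ post) x)
    ≡⟨ cong (indicator (covers (b , a) x) +_) (cnt-++ pre (mid ++ b ∷ post) x) ⟨
  indicator (covers (b , a) x) + cnt (pre ++ mid ++ b ∷ post) x
    ≡⟨ cong (λ l → indicator (covers (b , a) x) + cnt l x) target ⟨
  indicator (covers (b , a) x) + cnt (beadList N β) x        ∎
  where
  open BeadMove (strip-beads {N} s q≤N)
  a = bead N α p
  b = bead N β q

height-strip : ∀ {α β p q} → IsPartition α → Strip α β p q → height (α , β) ≡ q ∸ p
height-strip {α} {β} {p} {q} Pα s = cong (_∸ 1) (trans (unique-same-length
    (Unique.filter⁺ (λ i → T? (row β i <ᵇ row α i)) (unique-between 0 (length α))) (unique-range p (suc (q ∸ p)))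
    (λ {i} i∈ → let a , b = ∈-filter⁻ (λ i → T? (row β i <ᵇ row α i)) {xs = between 0 (length α)} i∈
                    c , d = strip-rows s i (<ᵇ⇒< (row β i) (row α i) b)
                in ∈-range⁺ p (suc (q ∸ p)) c (subst (i <_) (sym end) (s≤s d)))
    (λ {i} i∈ → let c , d = ∈-range⁻ p (suc (q ∸ p)) i∈
                    l = strip-row-< Pα s i c (≤-pred (subst (i <_) end d))
                in ∈-filter⁺ (λ i → T? (row β i <ᵇ row α i))
                     (∈-between⁺ 0 (length α) (≤-trans (1≤p s) c)
                         (proj₂ (∈S-row {α} {β} {i} {row α i} (l , ≤-refl)))) (<⇒<ᵇ l)))
  (length-range p (suc (q ∸ p))))
  where
  end : p + suc (q ∸ p) ≡ suc q
  end = trans (+-suc p _) (cong suc (m+[n∸m]≡n (p≤q s)))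

open Strip

-- Maximal border strips fill a component

linked-from-rows : ∀ xs → (∀ i → row xs (suc (suc i)) ≤ row xs (suc i)) → IsPartition xs
linked-from-rows []           p = []
linked-from-rows (x ∷ [])     p = [-]
linked-from-rows (x ∷ y ∷ xs) p = p 0 ∷ linked-from-rows (y ∷ xs) (p ∘ suc)

module _ (f : ℕ → ℕ) (n : ℕ) (f0 : f 0 ≡ 0) (anti : ∀ i → f (suc (suc i)) ≤ f (suc i))
    (fin : ∀ i → n < i → f i ≡ 0) where

  fromRows : List ℕ
  fromRows = map f (range 1 n)

  row-fromRows : ∀ i → row fromRows i ≡ f i
  row-fromRows zero    = sym f0
  row-fromRows (suc i) with suc i ≤? n
  ... | yes p = row-map-range f 1 n i p
  ... | no  p = trans (row-beyond fromRows (suc i) (subst (_< suc i)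
      (sym (trans (length-map f (range 1 n)) (length-range 1 n))) (≰⇒> p)))
    (sym (fin (suc i) (≰⇒> p)))

  partition-fromRows : IsPartition fromRows
  partition-fromRows = linked-from-rows fromRows λ i →
    subst (_≤ row fromRows (suc i)) (sym (row-fromRows (suc (suc i))))
        (subst (f (suc (suc i)) ≤_) (sym (row-fromRows (suc i))) (anti i))

module Maximal {cur mu ν : List ℕ} {p q : ℕ} (Pc : IsPartition cur) (Pμ : IsPartition mu)
  (mx : IsMaximalBSOf cur mu ν) (s : Strip cur ν p q) where

  private
    Pν : IsPartition ν
    Pν = proj₁ (proj₁ mx)
    μ⊆ν : mu ⊆ₚ ν
    μ⊆ν = proj₁ (proj₂ (proj₁ mx))
    ν⊆c : ν ⊆ₚ cur
    ν⊆c = proj₁ (proj₂ (proj₂ (proj₁ mx)))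

  -- Maximality in the form used below: `ν′` inside ν gives a strip containing the given one, and (i
  -- , j) is a cell that it adds.
  not-larger : ∀ ν′ {p′ q′} → IsPartition ν′ → Strip cur ν′ p′ q′ → mu ⊆ₚ ν′ → ν′ ⊆ₚ ν → ∀ i j →
    row ν′ i < j → j ≤ row ν i → j ≤ row cur i → ⊥
  not-larger ν′ Pν′ s′ m⊆ν′ ν′⊆ν i j lo hi hi′ = <-irrefl refl (≤-trans (proj₁ (proj₂ mx ν′
    (Pν′ , m⊆ν′ , strip-⊆ Pc s′ , strip⇒borderStrip Pc s′)
    (λ { (i , j) (a , b) → ≤-trans (s≤s (ν′⊆ν i)) a , b }) (i , j) (lo , hi′))) hi)

  -- Otherwise the strip extends downwards to the next corner of cur.
  bottom : row mu q ≡ row ν q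
  bottom with row ν q ≤? row mu q
  ... | yes r = ≤-antisym (μ⊆ν q) r
  ... | no  r = ⊥-elim (extend (length cur) q ≤-refl (m≤n+m (length cur) q)
      (λ i a b → ⊥-elim (<-irrefl refl (≤-trans a b))))
    where
    c = row ν q
    μ<c : row mu q < c
    μ<c = ≰⇒> r
    -- `k` is fuel. If row q is shortened below c, every following row of length c has to be
    -- shortened as well, so the search runs to the last row q′ of that run. It ends because c is
    -- positive.
    extend : ∀ k q′ → q ≤ q′ → length cur ≤ q′ + k → (∀ i → q < i → i ≤ q′ → row cur i ≡ c) → ⊥
    extend k q′ q≤q′ fuel same with row cur (suc q′) ≟ c | k
    ... | yes e | zero  = m<n⇒n≢0 μ<c (trans (sym e) (row-beyond cur (suc q′)
        (s≤s (subst (length cur ≤_) (+-identityʳ q′) fuel))))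
    ... | yes e | suc k = extend k (suc q′) (m≤n⇒m≤1+n q≤q′) (subst (length cur ≤_) (+-suc q′ k) fuel) same′
      where
      same′ : ∀ i → q < i → i ≤ suc q′ → row cur i ≡ c
      same′ i a b with i ≟ suc q′
      ... | yes refl = e
      ... | no  ne   = same i a (≤-pred (≤∧≢⇒< b ne))
    ... | no ne | _ = not-larger ν′ (partition-fromRows f n f0 anti fin)
        record { 1≤p = 1≤p s ; p≤q = ≤-trans (p≤q s) q≤q′
               ; above = λ i l → trans (rowν′ i) (trans (f-< i (≤-trans l (p≤q s))) (above s i l))
               ; inside = λ i a b → trans (cong suc (rowν′ i)) (ins i a b)
               ; last = subst (_< row cur q′) (sym (rowν′ q′))
                   (subst (_< row cur q′) (sym (f-mid q′ q≤q′ ≤-refl))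
                   (≤-trans (≤-reflexive c-1) (c≤ q′ q≤q′ ≤-refl)))
               ; below = λ i l → trans (rowν′ i) (f-> i l) }
        (λ i → subst (row mu i ≤_) (sym (rowν′ i)) (μ≤f i))
        (λ i → subst (_≤ row ν i) (sym (rowν′ i)) (f≤ν i))
        q c (subst (_< c) (sym (rowν′ q)) (subst (_< c) (sym (f-mid q ≤-refl q≤q′)) (≤-reflexive c-1))) ≤-refl
            (<⇒≤ (last s))
      where
      n = length cur
      f : ℕ → ℕ
      f i with i <? q | i ≤? q′
      ... | yes _ | _     = row ν i
      ... | no  _ | yes _ = c ∸ 1
      ... | no  _ | no  _ = row cur i
      f-< : ∀ i → i < q → f i ≡ row ν i
      f-< i l with i <? q
      ... | yes _ = refl
      ... | no  a = ⊥-elim (a l)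
      f-mid : ∀ i → q ≤ i → i ≤ q′ → f i ≡ c ∸ 1
      f-mid i l r with i <? q | i ≤? q′
      ... | yes a | _     = ⊥-elim (<-irrefl refl (≤-trans a l))
      ... | no  _ | yes _ = refl
      ... | no  _ | no  a = ⊥-elim (a r)
      f-> : ∀ i → q′ < i → f i ≡ row cur i
      f-> i l with i <? q | i ≤? q′
      ... | yes a | _     = ⊥-elim (<-irrefl refl (≤-trans (≤-trans a q≤q′) (<⇒≤ l)))
      ... | no  _ | yes a = ⊥-elim (<-irrefl refl (≤-trans l a))
      ... | no  _ | no  _ = refl
      f0 : f 0 ≡ 0
      f0 = f-< 0 (≤-trans (1≤p s) (p≤q s))
      c-1 : suc (c ∸ 1) ≡ c
      c-1 = m+[n∸m]≡n (≤-trans (s≤s z≤n) μ<c)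
      c≤ : ∀ i → q ≤ i → i ≤ q′ → c ≤ row cur i
      c≤ i l r with i ≟ q
      ... | yes refl = <⇒≤ (last s)
      ... | no  ne′  = ≤-reflexive (sym (same i (≤∧≢⇒< l (ne′ ∘ sym)) r))
      c≤ν : ∀ i → q ≤ i → i ≤ q′ → c ≤ row ν i
      c≤ν i l r with i ≟ q
      ... | yes refl = ≤-refl
      ... | no  ne′  = ≤-reflexive (sym (trans (below s i (≤∧≢⇒< l (ne′ ∘ sym))) (same i (≤∧≢⇒< l (ne′ ∘ sym)) r)))
      next≤ : row cur (suc q′) ≤ c ∸ 1
      next≤ = ≤-pred (subst (row cur (suc q′) <_) (sym c-1) (≤∧≢⇒< (subst (_≤ c) (below s (suc q′) (s≤s q≤q′))
        (row-antitone Pν (≤-trans (1≤p s) (p≤q s)) (m≤n⇒m≤1+n q≤q′))) ne))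
      data Where (i : ℕ) : Set where
        isA : i < q → Where i
        isB : q ≤ i → i ≤ q′ → Where i
        isC : q′ < i → Where i
      place : ∀ i → Where i
      place i with i <? q | i ≤? q′
      ... | yes a | _     = isA a
      ... | no  a | yes b = isB (≮⇒≥ a) b
      ... | no  _ | no  b = isC (≰⇒> b)
      f≤ν : ∀ i → f i ≤ row ν i
      f≤ν i with place i
      ... | isA a   = ≤-reflexive (f-< i a)
      ... | isB a b = subst (_≤ row ν i) (sym (f-mid i a b))
          (≤-trans (≤-trans (n≤1+n _) (≤-reflexive c-1)) (c≤ν i a b))
      ... | isC a   = ≤-reflexive (trans (f-> i a) (sym (below s i (≤-trans (s≤s q≤q′) a))))
      μ≤f : ∀ i → row mu i ≤ f i
      μ≤f i with place i
      ... | isA a   = subst (row mu i ≤_) (sym (f-< i a)) (μ⊆ν i)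
      ... | isB a b = subst (row mu i ≤_) (sym (f-mid i a b))
          (≤-trans (row-antitone Pμ (≤-trans (1≤p s) (p≤q s)) a) (≤-pred (subst (row mu q <_) (sym c-1) μ<c)))
      ... | isC a   = subst (row mu i ≤_) (sym (trans (f-> i a) (sym (below s i (≤-trans (s≤s q≤q′) a))))) (μ⊆ν i)
      anti : ∀ i → f (suc (suc i)) ≤ f (suc i)
      anti i with place (suc i)
      ... | isA a = subst (f (suc (suc i)) ≤_) (sym (f-< (suc i) a))
          (≤-trans (f≤ν (suc (suc i))) (row-antitone Pν (s≤s z≤n) (n≤1+n _)))
      ... | isC a = subst (f (suc (suc i)) ≤_) (sym (f-> (suc i) a))
          (subst (_≤ row cur (suc i)) (sym (f-> (suc (suc i)) (m≤n⇒m≤1+n a))) (row-antitone Pc (s≤s z≤n) (n≤1+n _)))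
      ... | isB a b with suc i ≟ q′
      ...   | no  ne′  = ≤-reflexive (trans (f-mid (suc (suc i)) (m≤n⇒m≤1+n a) (≤∧≢⇒< b ne′))
          (sym (f-mid (suc i) a b)))
      ...   | yes refl = subst (f (suc (suc i)) ≤_) (sym (f-mid (suc i) a b))
          (subst (_≤ c ∸ 1) (sym (f-> (suc (suc i)) ≤-refl)) next≤)
      fin : ∀ i → n < i → f i ≡ 0
      fin i l = n≤0⇒n≡0 (≤-trans (f≤ν i) (≤-trans (ν⊆c i) (≤-reflexive (row-beyond cur i l))))
      ν′ : List ℕ
      ν′ = fromRows f n f0 anti fin
      rowν′ : ∀ i → row ν′ i ≡ f i
      rowν′ = row-fromRows f n f0 anti fin
      ins : ∀ i → p ≤ i → i < q′ → suc (f i) ≡ row cur (suc i)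
      ins i a b with place i
      ... | isA l   = trans (cong suc (f-< i l)) (inside s i a l)
      ... | isB l _ = trans (cong suc (f-mid i l (<⇒≤ b))) (trans c-1 (sym (same (suc i) (s≤s l) b)))
      ... | isC l   = ⊥-elim (<-asym l b)

  -- Otherwise the strip extends to the row above.
  top : ∀ o → p ≡ suc (suc o) → row cur p ≤ row mu (suc o)
  top o refl with row cur p ≤? row mu (suc o)
  ... | yes r = r
  ... | no  r = ⊥-elim (not-larger ν′ (partition-fromRows f n refl anti fin)
      record { 1≤p = s≤s z≤n ; p≤q = ≤-trans (n≤1+n _) (p≤q s)
             ; above = λ i l → trans (rowν′ i) (trans (f-≢ i (<⇒≢ l)) (above s i (m≤n⇒m≤1+n l)))
             ; inside = λ i a b → trans (cong suc (rowν′ i)) (ins i a b)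
             ; last = subst (_< row cur q) (sym (trans (rowν′ q)
                 (f-≢ q (λ e → <-irrefl refl (subst (suc (suc o) ≤_) e (p≤q s)))))) (last s)
             ; below = λ i l → trans (rowν′ i) (trans (f-≢ i
                 (λ e → <-irrefl refl (≤-trans (subst (_≤ q) (cong suc (sym e)) (p≤q s)) (<⇒≤ l)))) (below s i l)) }
      (λ i → subst (row mu i ≤_) (sym (rowν′ i)) (μ≤f i))
      (λ i → subst (_≤ row ν i) (sym (rowν′ i)) (f≤ν i))
      (suc o) (row cur p) (subst (_< row cur p) (sym (trans (rowν′ (suc o)) f-≡)) (≤-reflexive c-1))
      (subst (row cur p ≤_) (sym (above s (suc o) ≤-refl)) cp≤) cp≤)
    where
    n = length cur
    cp≤ : row cur p ≤ row cur (suc o)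
    cp≤ = row-antitone Pc (s≤s z≤n) (n≤1+n _)
    c-1 : suc (row cur p ∸ 1) ≡ row cur p
    c-1 = m+[n∸m]≡n (≤-trans (s≤s z≤n) (≰⇒> r))
    f : ℕ → ℕ
    f i with i ≟ suc o
    ... | yes _ = row cur p ∸ 1
    ... | no  _ = row ν i
    f-≢ : ∀ i → i ≢ suc o → f i ≡ row ν i
    f-≢ i ne with i ≟ suc o
    ... | yes e = ⊥-elim (ne e)
    ... | no  _ = refl
    f-≡ : f (suc o) ≡ row cur p ∸ 1
    f-≡ with suc o ≟ suc o
    ... | yes _ = refl
    ... | no ne = ⊥-elim (ne refl)
    f≤ν : ∀ i → f i ≤ row ν i
    f≤ν i with i ≟ suc o
    ... | yes refl = subst (row cur p ∸ 1 ≤_) (sym (above s (suc o) ≤-refl))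
        (≤-trans (≤-trans (n≤1+n _) (≤-reflexive c-1)) cp≤)
    ... | no  _    = ≤-refl
    μ≤f : ∀ i → row mu i ≤ f i
    μ≤f i with i ≟ suc o
    ... | yes refl = ≤-pred (subst (row mu (suc o) <_) (sym c-1) (≰⇒> r))
    ... | no  _    = μ⊆ν i
    anti : ∀ i → f (suc (suc i)) ≤ f (suc i)
    anti i with suc i ≟ suc o
    ... | yes refl = subst (_≤ row cur p ∸ 1) (sym (f-≢ (suc (suc o)) (λ ())))
        (≤-pred (subst (row ν p <_) (sym c-1) (strip-row-< Pc s p ≤-refl (p≤q s))))
    ... | no  _    = ≤-trans (f≤ν (suc (suc i))) (row-antitone Pν (s≤s z≤n) (n≤1+n _))
    fin : ∀ i → n < i → f i ≡ 0
    fin i l = n≤0⇒n≡0 (≤-trans (f≤ν i) (≤-trans (ν⊆c i) (≤-reflexive (row-beyond cur i l))))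
    ν′ : List ℕ
    ν′ = fromRows f n refl anti fin
    rowν′ : ∀ i → row ν′ i ≡ f i
    rowν′ = row-fromRows f n refl anti fin
    ins : ∀ i → suc o ≤ i → i < q → suc (f i) ≡ row cur (suc i)
    ins i a b with i ≟ suc o
    ... | yes refl = c-1
    ... | no  ne   = inside s i (≤∧≢⇒< a (ne ∘ sym)) b

  -- Row i contributes differently to the two counts only if its mu-bead is below x and its cur-bead
  -- is not.
  cnt-≡ : ∀ N x → (∀ i → 1 ≤ i → i ≤ N → (x ≤ bead N mu i) ⊎ (bead N cur i < x)) → cnt (beadList N cur) x ≡ cnt
      (beadList N mu) x
  cnt-≡ N x e = go (range 1 N) λ i∈ → let a , b = ∈-range⁻ 1 N i∈ in e _ a (≤-pred b)
    where
    μ≤c : ∀ i → bead N mu i ≤ bead N cur i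
    μ≤c i = +-monoˡ-≤ (N ∸ i) (≤-trans (μ⊆ν i) (ν⊆c i))
    go : ∀ is → (∀ {i} → i ∈ is → (x ≤ bead N mu i) ⊎ (bead N cur i < x)) → cnt (map (bead N cur) is) x ≡ cnt
        (map (bead N mu) is) x
    go []       e = refl
    go (i ∷ is) e = cong₂ _+_ (here≡ (e (aHere refl))) (go is (e ∘ aThere))
      where
      here≡ : (x ≤ bead N mu i) ⊎ (bead N cur i < x) → indicator (x ≤ᵇ bead N cur i) ≡ indicator (x ≤ᵇ bead N mu i)
      here≡ (inj₁ a) = trans (indicator-T (≤⇒≤ᵇ (≤-trans a (μ≤c i)))) (sym (indicator-T (≤⇒≤ᵇ a)))
      here≡ (inj₂ a) = trans (indicator-¬T (λ t → <-irrefl refl (≤-trans a (≤ᵇ⇒≤ x _ t))))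
        (sym (indicator-¬T (λ t → <-irrefl refl (≤-trans a (≤-trans (≤ᵇ⇒≤ x _ t) (μ≤c i))))))

  -- Rows up to q have mu-beads at least b by `bottom`, later rows have cur-beads below b. So no
  -- interval passes over b.
  cnt-bottom : ∀ N → cnt (beadList N cur) (bead N ν q) ≡ cnt (beadList N mu) (bead N ν q)
  cnt-bottom N = cnt-≡ N (bead N ν q) side
    where
    side : ∀ i → 1 ≤ i → i ≤ N → (bead N ν q ≤ bead N mu i) ⊎ (bead N cur i < bead N ν q)
    side i a b with i ≤? q
    ... | yes l = inj₁ (subst (λ r → r + (N ∸ q) ≤ bead N mu i) bottom (bead-antitone {N} Pμ a l))
    ... | no  l = inj₂ (subst (λ r → r + (N ∸ i) < bead N ν q) (below s i (≰⇒> l))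
                    (bead-strict {N} Pν (≤-trans (1≤p s) (p≤q s)) (≰⇒> l) b))

  -- Rows from p on have cur-beads at most a, earlier rows have mu-beads above a by `top`. So no
  -- interval passes over a + 1, and (b, a] is maximal at both ends.
  cnt-top : ∀ N → q ≤ N → cnt (beadList N cur) (suc (bead N cur p)) ≡ cnt (beadList N mu) (suc (bead N cur p))
  cnt-top N q≤N = cnt-≡ N (suc (bead N cur p)) side
    where
    side : ∀ i → 1 ≤ i → i ≤ N → (bead N cur p < bead N mu i) ⊎ (bead N cur i < suc (bead N cur p))
    side i a b with p ≤? i
    ... | yes l = inj₂ (s≤s (bead-antitone {N} Pc (1≤p s) l))
    ... | no  l = inj₁ (higher p refl (≰⇒> l))
      where
      higher : ∀ p′ → p ≡ p′ → i < p′ → bead N cur p < bead N mu i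
      higher (suc zero)    e (s≤s l) = ⊥-elim (<-irrefl refl (≤-trans a l))
      higher (suc (suc o)) refl (s≤s l) = ≤-trans (+-mono-≤-< (top o refl) (∸-monoʳ-< ≤-refl (≤-trans (p≤q s) q≤N)))
          (bead-antitone {N} Pμ a l)

open Strip

-- Diagonal counts of an arbitrary decomposition

indicator-⇔ : ∀ {a b} → (T a → T b) → (T b → T a) → indicator a ≡ indicator b
indicator-⇔ {true}  {true}  f g = refl
indicator-⇔ {true}  {false} f g = ⊥-elim (f tt)
indicator-⇔ {false} {true}  f g = ⊥-elim (g tt)
indicator-⇔ {false} {false} f g = refl

-- The number of cells of S in rows 1, …, N on the diagonal j - i = x - N; where x - (N - i) is
-- truncated to the column 0, there is no cell.
depth : ℕ → List ℕ × List ℕ → ℕ → ℕ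
depth N S x = sum (map (λ i → indicator (memb S (i , x ∸ (N ∸ i)))) (range 1 N))

memb⇔covers : ∀ N α β x i → indicator (memb (α , β) (i , x ∸ (N ∸ i))) ≡ indicator
    (covers (bead N β i , bead N α i) x)
memb⇔covers N α β x i = indicator-⇔ {memb (α , β) (i , x ∸ m)} {covers (bead N β i , bead N α i) x}
  (λ t → let p , q = to (T-∧ {row β i <ᵇ x ∸ m}) t in
    T-covers⁺ (<∸⇒+< (<ᵇ⇒< (row β i) (x ∸ m) p)) (∸≤⇒≤+ (≤ᵇ⇒≤ (x ∸ m) (row α i) q)))
  (λ t → let p , q = T-covers⁻ {bead N β i} {bead N α i} {x} t in
    from (T-∧ {row β i <ᵇ x ∸ m}) (<⇒<ᵇ (m+n≤o⇒m≤o∸n (suc (row β i)) p) , ≤⇒≤ᵇ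
        (m≤n+o⇒m∸n≤o x m (subst (x ≤_) (+-comm (row α i) m) q))))
  where
  m = N ∸ i
  <∸⇒+< : ∀ {b} → b < x ∸ m → b + m < x
  <∸⇒+< l = m≤o∸n⇒m+n≤o _ (<⇒≤ (m∸n≢0⇒n<m (m<n⇒n≢0 l))) l
  ∸≤⇒≤+ : ∀ {a} → x ∸ m ≤ a → x ≤ a + m
  ∸≤⇒≤+ {a} l = ≤-trans (m≤n+m∸n x m) (subst (m + (x ∸ m) ≤_) (+-comm m a) (+-monoʳ-≤ m l))

-- Row i has a cell on the diagonal of x exactly when x lies between its two beads, so the cells on
-- a diagonal count the rows whose bead passes x.
depth-cnt : ∀ N {α β} → β ⊆ₚ α → ∀ x → cnt (beadList N α) x ≡ depth N (α , β) x + cnt (beadList N β) x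
depth-cnt N {α} {β} β⊆α x = go (range 1 N)
  where
  go : ∀ is → cnt (map (bead N α) is) x ≡ sum (map (λ i → indicator (memb (α , β) (i , x ∸ (N ∸ i)))) is) + cnt
      (map (bead N β) is) x
  go []       = refl
  go (i ∷ is) = trans (cong₂ _+_ (trans (indicator-split (+-monoˡ-≤ (N ∸ i) (β⊆α i)) x)
      (cong (_+ indicator (x ≤ᵇ bead N β i)) (sym (memb⇔covers N α β x i)))) (go is))
    (ℕS.solve 4 (λ a b c d → (a ℕS.:+ b) ℕS.:+ (c ℕS.:+ d) ℕS.:= (a ℕS.:+ c) ℕS.:+ (b ℕS.:+ d)) refl
      (indicator (memb (α , β) (i , x ∸ (N ∸ i)))) _ (sum
          (map (λ i → indicator (memb (α , β) (i , x ∸ (N ∸ i)))) is)) _)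

multiplicity-sum : ∀ c D → multiplicity c D ≡ sum (map (λ S → indicator (memb S c)) D)
multiplicity-sum c []      = refl
multiplicity-sum c (S ∷ D) with memb S c
... | true  = cong suc (multiplicity-sum c D)
... | false = multiplicity-sum c D

sum-swap : (f : X → Y → ℕ) → ∀ xs ys → sum (map (λ x → sum (map (f x) ys)) xs) ≡ sum
    (map (λ y → sum (map (λ x → f x y) xs)) ys)
sum-swap f []       ys = sym (zeros ys)
  where
  zeros : ∀ ys → sum (map (λ _ → 0) ys) ≡ 0
  zeros []       = refl
  zeros (y ∷ ys) = zeros ys
sum-swap f (x ∷ xs) ys = trans (cong (sum (map (f x) ys) +_) (sum-swap f xs ys)) (merge ys)
  where
  merge : ∀ ys → sum (map (f x) ys) + sum (map (λ y → sum (map (λ x → f x y) xs)) ys) ≡ sum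
      (map (λ y → f x y + sum (map (λ x → f x y) xs)) ys)
  merge []       = refl
  merge (y ∷ ys) = trans (ℕS.solve 4 (λ a b c d → (a ℕS.:+ b) ℕS.:+ (c ℕS.:+ d) ℕS.:= (a ℕS.:+ c) ℕS.:+
      (b ℕS.:+ d)) refl
    (f x y) (sum (map (f x) ys)) (sum (map (λ x → f x y) xs)) _)
        (cong (f x y + sum (map (λ x → f x y) xs) +_) (merge ys))

sum-∈ : ∀ (f : X → ℕ) {x xs} → x ∈ xs → f x ≤ sum (map f xs)
sum-∈ f {xs = y ∷ xs} (aHere refl) = m≤m+n (f y) _
sum-∈ f {xs = y ∷ xs} (aThere p)   = ≤-trans (sum-∈ f p) (m≤n+m _ (f y))

depth-decomposition : ∀ {lam mu D} N → IsBSDecomposition lam mu D → ∀ x → sum (map (λ S → depth N S x) D) ≡ depth N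
    (lam , mu) x
depth-decomposition {lam} {mu} {D} N (_ , mult) x = trans
  (sum-swap (λ S i → indicator (memb S (i , x ∸ (N ∸ i)))) D (range 1 N))
  (cong sum (map-cong (λ i → trans (sym (multiplicity-sum (i , x ∸ (N ∸ i)) D)) (mult (i , x ∸ (N ∸ i))))
      (range 1 N)))

memb⇒∈S : ∀ {α β i j} → T (memb (α , β) (i , j)) → (i , j) ∈S (α , β)
memb⇒∈S {α} {β} {i} {j} t with p , q ← to (T-∧ {row β i <ᵇ j}) t = <ᵇ⇒< (row β i) j p , ≤ᵇ⇒≤ j (row α i) q

∈S⇒memb : ∀ {α β i j} → (i , j) ∈S (α , β) → T (memb (α , β) (i , j))
∈S⇒memb {α} {β} {i} {j} (p , q) = from (T-∧ {row β i <ᵇ j}) (<⇒<ᵇ p , ≤⇒≤ᵇ q)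

1≤indicator : ∀ {b} → 1 ≤ indicator b → T b
1≤indicator {true} _ = tt

decomposition-⊆ : ∀ {lam mu D} → IsBSDecomposition lam mu D → ∀ {S} → S ∈ D → ∀ c → T (memb S c) → T
    (memb (lam , mu) c)
decomposition-⊆ {D = D} (_ , mult) S∈ c t = 1≤indicator (subst (1 ≤_) (trans (sym (multiplicity-sum c D)) (mult c))
  (≤-trans (≤-reflexive (sym (indicator-T t))) (sum-∈ (λ S → indicator (memb S c)) S∈)))

-- A border strip meets a diagonal at most once, and the diagonals it meets form the interval of its
-- bead move. `bound` ensures that all its rows are among the N rows counted.
strip-depth : ∀ {α β} N → SkewBorderStrip (α , β) → (∀ i j → (i , j) ∈S (α , β) → i ≤ N) →
  ∃ λ e → proj₁ e < proj₂ e × (∀ x → depth N (α , β) x ≡ indicator (covers e x))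
strip-depth {α} {β} N (Pα , Pβ , β⊆α , bs) bound with p , q , s ← borderStrip⇒strip Pα Pβ β⊆α bs =
  (bead N β q , bead N α p) , strip-bead-< {N} Pα s , λ x → +-cancelʳ-≡ (cnt (beadList N β) x) _ _
    (trans (sym (depth-cnt N β⊆α x)) (strip-cnt Pα s (bound q (row α q) (last s , ≤-refl)) x))

rows-bounded : ∀ {lam mu D} → IsBSDecomposition lam mu D → ∀ {α β} → (α , β) ∈ D → ∀ i j → (i , j) ∈S (α , β)
    → i ≤ length lam
rows-bounded {lam} {mu} dec {α} {β} S∈ i j c∈ = proj₂ (∈S-row {lam} {mu} {i} {j}
  (memb⇒∈S {lam} {mu} {i} {j} (decomposition-⊆ {lam} {mu} dec S∈ (i , j) (∈S⇒memb {α} {β} {i} {j} c∈))))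

Edges : ℕ → List (List ℕ × List ℕ) → Set
Edges N D = ∃ λ E → length E ≡ length D × All (λ e → proj₁ e < proj₂ e) E ×
    (∀ x → sum (map (λ S → depth N S x) D) ≡ cover E x)

decomposition-edges : ∀ {N} D → All SkewBorderStrip D → (∀ {α β} → (α , β) ∈ D → ∀ i j → (i , j) ∈S (α , β) → i ≤ N)
    → Edges N D
decomposition-edges []            []       bd = [] , refl , [] , λ _ → refl
decomposition-edges {N} ((α , β) ∷ D) (b ∷ bs) bd = cons (strip-depth N b (bd (aHere refl)))
    (decomposition-edges D bs (bd ∘ aThere))
  where
  cons : (∃ λ e → proj₁ e < proj₂ e × (∀ x → depth N (α , β) x ≡ indicator (covers e x))) → Edges N D → Edges N
      ((α , β) ∷ D)
  cons (e , e< , d) (E , len , lt , cov) = e ∷ E , cong suc len , e< ∷ lt , λ x → cong₂ _+_ (d x) (cov x)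

-- The strips of an arbitrary decomposition need not be removable one after another, so bead moves
-- cannot be composed. The counts of cells on diagonals add up regardless of the order.
decomposition-cover : ∀ {lam mu D} → mu ⊆ₚ lam → IsBSDecomposition lam mu D →
  ∃ λ E → length E ≡ length D × All (λ e → proj₁ e < proj₂ e) E ×
    (∀ x → cnt (beadList (length lam) lam) x ≡ cover E x + cnt (beadList (length lam) mu) x)
decomposition-cover {lam} {mu} {D} m⊆l dec with E , len , lt , cov ← decomposition-edges D (proj₁ dec)
    (rows-bounded {lam} {mu} dec) =
  E , len , lt , λ x → trans (depth-cnt N m⊆l x) (cong (_+ cnt (beadList N mu) x)
      (trans (sym (depth-decomposition N dec x)) (cov x)))
  where
  N = length lam

occ : List ℕ → ℕ → ℕ
occ []       x = 0
occ (a ∷ as) x = indicator (x ≡ᵇ a) + occ as x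

occ-∈ : ∀ {as x} → x ∈ as → 1 ≤ occ as x
occ-∈ {a ∷ as} (aHere refl) = ≤-trans (≤-reflexive (sym (indicator-T (≡⇒≡ᵇ a a refl)))) (m≤m+n _ _)
occ-∈ {a ∷ as} {x} (aThere p) = ≤-trans (occ-∈ p) (m≤n+m _ (indicator (x ≡ᵇ a)))

occ-∉ : ∀ {as x} → x ∉ as → occ as x ≡ 0
occ-∉ {[]}         p = refl
occ-∉ {a ∷ as} {x} p = cong₂ _+_ (indicator-¬T (λ t → p (aHere (≡ᵇ⇒≡ x a t)))) (occ-∉ (p ∘ aThere))

1≤occ : ∀ {as x} → 1 ≤ occ as x → x ∈ as
1≤occ {a ∷ as} {x} p with x ≟ a
... | yes refl = aHere refl
... | no  ne   = aThere (1≤occ (subst (λ n → 1 ≤ n + occ as x) (indicator-¬T (ne ∘ ≡ᵇ⇒≡ x a)) p))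

cnt-suc : ∀ as x → cnt as x ≡ occ as x + cnt as (suc x)
cnt-suc []       x = refl
cnt-suc (a ∷ as) x = trans (cong₂ _+_ (one x a) (cnt-suc as x))
  (ℕS.solve 4 (λ a b c d → (a ℕS.:+ b) ℕS.:+ (c ℕS.:+ d) ℕS.:= (a ℕS.:+ c) ℕS.:+ (b ℕS.:+ d)) refl
    (indicator (x ≡ᵇ a)) (indicator (suc x ≤ᵇ a)) (occ as x) (cnt as (suc x)))
  where
  one : ∀ x a → indicator (x ≤ᵇ a) ≡ indicator (x ≡ᵇ a) + indicator (suc x ≤ᵇ a)
  one zero    zero    = refl
  one zero    (suc a) = refl
  one (suc x) zero    = refl
  one (suc zero)    (suc a) = one zero a
  one (suc (suc x)) (suc a) = one (suc x) a

cover-cnt : ∀ {E} → All (λ e → proj₁ e < proj₂ e) E → ∀ x → cnt (map proj₂ E) x ≡ cover E x + cnt (map proj₁ E) x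
cover-cnt []           x = refl
cover-cnt {(b , a) ∷ E} (lt ∷ lts) x = trans (cong₂ _+_ (indicator-split (<⇒≤ lt) x) (cover-cnt lts x))
  (ℕS.solve 4 (λ a b c d → (a ℕS.:+ b) ℕS.:+ (c ℕS.:+ d) ℕS.:= (a ℕS.:+ c) ℕS.:+ (b ℕS.:+ d)) refl
    (indicator (covers (b , a) x)) (indicator (x ≤ᵇ b)) (cover E x) (cnt (map proj₁ E) x))

module Ends {A B : List ℕ} {E : List (ℕ × ℕ)} (lt : All (λ e → proj₁ e < proj₂ e) E)
  (cov : ∀ x → cnt A x ≡ cover E x + cnt B x) where

  cnt-balance : ∀ x → cnt A x + cnt (map proj₁ E) x ≡ cnt B x + cnt (map proj₂ E) x
  cnt-balance x = trans (cong (_+ cnt (map proj₁ E) x) (cov x)) (trans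
    (ℕS.solve 3 (λ c b s → (c ℕS.:+ b) ℕS.:+ s ℕS.:= b ℕS.:+ (c ℕS.:+ s)) refl (cover E x) (cnt B x)
        (cnt (map proj₁ E) x))
    (cong (cnt B x +_) (sym (cover-cnt lt x))))

  -- The difference of `cnt-balance` at x and x + 1. As multisets, A together with the starts equals
  -- B together with the ends.
  balance : ∀ x → occ A x + occ (map proj₁ E) x ≡ occ B x + occ (map proj₂ E) x
  balance x = +-cancelʳ-≡ (cnt A (suc x) + cnt (map proj₁ E) (suc x)) _ _ (trans (split A (map proj₁ E))
    (trans (cnt-balance x) (trans (sym (split B (map proj₂ E)))
      (cong (occ B x + occ (map proj₂ E) x +_) (sym (cnt-balance (suc x)))))))
    where
    split : ∀ as bs → (occ as x + occ bs x) + (cnt as (suc x) + cnt bs (suc x)) ≡ cnt as x + cnt bs x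
    split as bs = trans (ℕS.solve 4 (λ a b c d → (a ℕS.:+ b) ℕS.:+ (c ℕS.:+ d) ℕS.:= (a ℕS.:+ c) ℕS.:+
        (b ℕS.:+ d)) refl
      (occ as x) (occ bs x) (cnt as (suc x)) (cnt bs (suc x))) (sym (cong₂ _+_ (cnt-suc as x) (cnt-suc bs x)))

  start-∈ : ∀ {x} → x ∈ B → x ∉ A → x ∈ map proj₁ E
  start-∈ {x} p q = 1≤occ (subst (1 ≤_) (trans (sym (balance x)) (cong (_+ occ (map proj₁ E) x) (occ-∉ q)))
    (≤-trans (occ-∈ p) (m≤m+n _ _)))

  end-∈ : ∀ {x} → x ∈ A → x ∉ B → x ∈ map proj₂ E
  end-∈ {x} p q = 1≤occ (subst (1 ≤_) (trans (balance x) (cong (_+ occ (map proj₂ E) x) (occ-∉ q)))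
    (≤-trans (occ-∈ p) (m≤m+n _ _)))

-- Noncrossing matchings and greedy removal

cnt-↭ : ∀ {as bs} → as ↭ bs → ∀ x → cnt as x ≡ cnt bs x
cnt-↭ Perm.refl          x = refl
cnt-↭ (Perm.prep a p)    x = cong (indicator (x ≤ᵇ a) +_) (cnt-↭ p x)
cnt-↭ (Perm.swap a b p)  x = trans (cong (λ n → indicator (x ≤ᵇ a) + (indicator (x ≤ᵇ b) + n)) (cnt-↭ p x))
  (ℕS.solve 3 (λ a b c → a ℕS.:+ (b ℕS.:+ c) ℕS.:= b ℕS.:+ (a ℕS.:+ c)) refl (indicator (x ≤ᵇ a))
      (indicator (x ≤ᵇ b)) _)
cnt-↭ (Perm.trans p q)   x = trans (cnt-↭ p x) (cnt-↭ q x)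

-- By `cover-cnt` the cover is the tail count of the ends minus that of the starts, whatever the
-- pairing.
cover-unique : ∀ {E I} → All (λ e → proj₁ e < proj₂ e) E → All (λ e → proj₁ e < proj₂ e) I →
  map proj₁ I ↭ map proj₁ E → map proj₂ I ↭ map proj₂ E → ∀ x → cover I x ≡ cover E x
cover-unique {E} {I} lt lt′ p q x = +-cancelʳ-≡ (cnt (map proj₁ I) x) _ _ (trans (sym (cover-cnt lt′ x))
  (trans (cnt-↭ q x) (trans (cover-cnt lt x) (cong (cover E x +_) (sym (cnt-↭ p x))))))

cover-0 : ∀ {J x} → cover J x ≡ 0 → ∀ {w y} → (w , y) ∈ J → w < x → x ≤ y → ⊥
cover-0 {e ∷ J} {x} z (aHere refl) p q = m<n⇒n≢0 (≤-trans (≤-reflexive (sym (indicator-T (T-covers⁺ p q))))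
    (m≤m+n _ _)) z
cover-0 {e ∷ J} {x} z (aThere w∈) p q = cover-0 (n≤0⇒n≡0
    (≤-trans (m≤n+m _ (indicator (covers e x))) (≤-reflexive z))) w∈ p q

1≤cover : ∀ {J x} → 1 ≤ cover J x → ∃₂ λ w y → (w , y) ∈ J × w < x × x ≤ y
1≤cover {(w , y) ∷ J} {x} p with w <? x | x ≤? y
... | yes a | yes b = w , y , aHere refl , a , b
... | no  a | _ with w′ , y′ , q ← 1≤cover {J} {x} (subst (λ n → 1 ≤ n + cover J x)
    (indicator-¬T (λ t → a (proj₁ (T-covers⁻ {w} {y} {x} t)))) p)
  = w′ , y′ , aThere (proj₁ q) , proj₂ q
1≤cover {(w , y) ∷ J} {x} p | yes _ | no b
  with w′ , y′ , q ← 1≤cover {J} {x} (subst (λ n → 1 ≤ n + cover J x)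
      (indicator-¬T (λ t → b (proj₂ (T-covers⁻ {w} {y} {x} t)))) p)
  = w′ , y′ , aThere (proj₁ q) , proj₂ q

-- Fixing all numbers that are not ends makes starts and unmatched beads their own labels.
partner : List (ℕ × ℕ) → ℕ → ℕ
partner []            a = a
partner ((w , y) ∷ I) a with a ≟ y
... | yes _ = w
... | no  _ = partner I a

partner-∉ : ∀ {I a} → a ∉ map proj₂ I → partner I a ≡ a
partner-∉ {[]}          p = refl
partner-∉ {(w , y) ∷ I} {a} p with a ≟ y
... | yes e = ⊥-elim (p (aHere e))
... | no  _ = partner-∉ (p ∘ aThere)

partner-∈ : ∀ {I w a} → Unique (map proj₂ I) → (w , a) ∈ I → partner I a ≡ w
partner-∈ {(w , y) ∷ I} {a = a} u p with a ≟ y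
partner-∈ u (aHere refl) | yes _ = refl
partner-∈ (n ∷ u) (aThere p) | yes refl = ⊥-elim (All¬⇒¬Any n (∈-map⁺ proj₂ p))
partner-∈ u (aHere refl) | no ne = ⊥-elim (ne refl)
partner-∈ (_ ∷ u) (aThere p) | no _ = partner-∈ u p

unique-proj₁ : ∀ {I : List (ℕ × ℕ)} {w y y′} → Unique (map proj₁ I) → (w , y) ∈ I → (w , y′) ∈ I → y ≡ y′
unique-proj₁ u (aHere refl) (aHere refl) = refl
unique-proj₁ (n ∷ u) (aHere refl) (aThere q) = ⊥-elim (All¬⇒¬Any n (∈-map⁺ proj₁ q))
unique-proj₁ (n ∷ u) (aThere p) (aHere refl) = ⊥-elim (All¬⇒¬Any n (∈-map⁺ proj₁ p))
unique-proj₁ (_ ∷ u) (aThere p) (aThere q) = unique-proj₁ u p q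

module Greedy (N : ℕ) {mu : List ℕ} (Pμ : IsPartition mu) (I : List (ℕ × ℕ))
  (uw : Unique (map proj₁ I)) (uy : Unique (map proj₂ I))
  (w≢y : ∀ {p p′} → p ∈ I → p′ ∈ I → proj₁ p ≢ proj₂ p′)
  (nc : ∀ {p p′} → p ∈ I → p′ ∈ I → ¬ ((proj₁ p < proj₁ p′) × (proj₁ p′ < proj₂ p) × (proj₂ p < proj₂ p′))) where

  -- The pair over b + 1 starts at b, as nothing covers b, and it cannot pass a. If it ended at y <
  -- a, consider the pair over y + 1: a start before b would cover b, the start b is already taken,
  -- y is an end and hence no start, and a start between b and y would give a crossing.
  maximal-interval : ∀ {J b a} → (∀ {p} → p ∈ J → p ∈ I) → b < a → cover J b ≡ 0 → cover J (suc a) ≡ 0 →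
    (∀ x → b < x → x ≤ a → 1 ≤ cover J x) → (b , a) ∈ J
  maximal-interval {J} {b} {a} sub b<a zb za cov with w , y , w∈ , w<sb , sb≤y ← 1≤cover {J} (cov (suc b) ≤-refl b<a)
    with ≤-antisym (≤-pred w<sb) (≮⇒≥ (λ w<b → cover-0 {J} zb w∈ w<b (<⇒≤ sb≤y)))
  ... | refl with <-cmp y a
  ...   | tri≈ _ refl _ = w∈
  ...   | tri> _ _ a<y  = ⊥-elim (cover-0 {J} za w∈ (m≤n⇒m≤1+n b<a) a<y)
  ...   | tri< y<a _ _ with w′ , y′ , w′∈ , w′<sy , sy≤y′ ← 1≤cover {J} (cov (suc y) (m≤n⇒m≤1+n sb≤y) y<a)
    with <-cmp w′ b
  ...     | tri< w′<b _ _  = ⊥-elim (cover-0 {J} zb w′∈ w′<b (≤-trans (<⇒≤ sb≤y) (<⇒≤ sy≤y′)))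
  ...     | tri≈ _ refl _  = ⊥-elim (<⇒≢ sy≤y′ (unique-proj₁ uw (sub w∈) (sub w′∈)))
  ...     | tri> _ _ b<w′  = ⊥-elim (nc (sub w∈) (sub w′∈)
      (b<w′ , ≤∧≢⇒< (≤-pred w′<sy) (w≢y (sub w′∈) (sub w∈)) , sy≤y′))

  φ : ℕ → ℕ
  φ = partner I

  cnt-≤ : ∀ {α β} → β ⊆ₚ α → ∀ x → cnt (beadList N β) x ≤ cnt (beadList N α) x
  cnt-≤ {α} {β} p x = subst (cnt (beadList N β) x ≤_) (sym (depth-cnt N p x)) (m≤n+m _ (depth N (α , β) x))

  -- `J` holds the pairs not yet removed, and the equation for `cnt` is the invariant. `φ` belongs
  -- to the full list `I` throughout: it sends the bead a of cur and the bead b of ν both to b, so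
  -- the relabelled lists differ only in the place of b.
  greedy-sign : ∀ {cur G} → IsPartition cur → (∀ i → N < i → row cur i ≡ 0) → GreedyDec mu cur G →
    ∀ J → (∀ {p} → p ∈ J → p ∈ I) → (∀ x → cnt (beadList N cur) x ≡ cover J x + cnt (beadList N mu) x) →
    (Φ : List ℕ → ℚ) → Alternating Φ → Φ (map φ (beadList N cur)) ≡ sgn (zOf G) * Φ (map φ (beadList N mu))
  greedy-sign Pc fin (done e) J sub cov Φ alt = trans (cong (Φ ∘ map φ)
      (map-cong (λ i → cong (_+ (N ∸ i)) (e i)) (range 1 N))) (sym (ℚ.*-identityˡ _))
  greedy-sign {cur} Pc fin (step {ν = ν} {G = G} mx g) J sub cov Φ alt
    with p , q , s ← borderStrip⇒strip Pc (proj₁ (proj₁ mx)) (proj₁ (proj₂ (proj₂ (proj₁ mx))))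
        (proj₂ (proj₂ (proj₂ (proj₁ mx))))
    = remove p q s
    where
    Pν = proj₁ (proj₁ mx)
    μ⊆ν = proj₁ (proj₂ (proj₁ mx))
    ν⊆c = proj₁ (proj₂ (proj₂ (proj₁ mx)))
    remove : ∀ p q → Strip cur ν p q → Φ (map φ (beadList N cur)) ≡ sgn (height (cur , ν) + zOf G) * Φ
        (map φ (beadList N mu))
    remove p q s = go (∈-∃++ pair∈)
      where
      open Maximal Pc Pμ mx s
      q≤N : q ≤ N
      q≤N with q ≤? N
      ... | yes r = r
      ... | no  r = ⊥-elim (m<n⇒n≢0 (last s) (fin q (≰⇒> r)))
      a = bead N cur p
      b = bead N ν q
      move : ∀ x → cnt (beadList N cur) x ≡ indicator (covers (b , a) x) + cnt (beadList N ν) x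
      move = strip-cnt Pc s q≤N
      -- `cnt-bottom` and `cnt-top` give the zeros at both ends. On (b, a] the count for cur exceeds
      -- that for ν by 1, hence that for mu by at least 1.
      pair∈ : (b , a) ∈ J
      pair∈ = maximal-interval sub (strip-bead-< {N} Pc s)
        (+-cancelʳ-≡ (cnt (beadList N mu) b) _ _ (trans (sym (cov b)) (cnt-bottom N)))
        (+-cancelʳ-≡ (cnt (beadList N mu) (suc a)) _ _ (trans (sym (cov (suc a))) (cnt-top N q≤N)))
        (λ x l r → +-cancelʳ-≤ (cnt (beadList N mu) x) 1 (cover J x) (subst (1 + cnt (beadList N mu) x ≤_)
          (trans (cong (_+ cnt (beadList N ν) x) (sym (indicator-T (T-covers⁺ l r)))) (trans (sym (move x)) (cov x)))
          (s≤s (cnt-≤ μ⊆ν x))))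
      go : (∃₂ λ us vs → J ≡ us ++ (b , a) ∷ vs) → Φ (map φ (beadList N cur)) ≡ sgn (height (cur , ν) + zOf G) * Φ
          (map φ (beadList N mu))
      go (us , vs , refl) = begin
        Φ (map φ (beadList N cur))
          ≡⟨ cong Φ (trans (cong (map φ) source) (trans (map-++ φ pre (a ∷ mid ++ post))
              (cong₂ (λ c l → map φ pre ++ c ∷ l) φa (map-++ φ mid post)))) ⟩
        Φ (map φ pre ++ b ∷ map φ mid ++ map φ post)
          ≡⟨ alternating-move {Φ = Φ} alt (map φ pre) b (map φ mid) (map φ post) ⟩
        sgn (length (map φ mid)) * Φ (map φ pre ++ map φ mid ++ b ∷ map φ post)
          ≡⟨ cong₂ (λ n l → sgn n * Φ l) (trans (length-map φ mid) (trans height≡ (sym (height-strip Pc s))))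
               (sym (trans (cong (map φ) target) (trans (map-++ φ pre (mid ++ b ∷ post))
                 (cong (map φ pre ++_) (trans (map-++ φ mid (b ∷ post))
                     (cong (λ c → map φ mid ++ c ∷ map φ post) φb)))))) ⟩
        sgn (height (cur , ν)) * Φ (map φ (beadList N ν))
          ≡⟨ cong (sgn (height (cur , ν)) *_) (greedy-sign Pν
              (λ i l → n≤0⇒n≡0 (subst (row ν i ≤_) (fin i l) (ν⊆c i))) g (us ++ vs) sub′ cov′ Φ alt) ⟩
        sgn (height (cur , ν)) * (sgn (zOf G) * Φ (map φ (beadList N mu)))
          ≡⟨ ℚ.*-assoc (sgn (height (cur , ν))) (sgn (zOf G)) _ ⟨
        sgn (height (cur , ν)) * sgn (zOf G) * Φ (map φ (beadList N mu))
          ≡⟨ cong (_* Φ (map φ (beadList N mu))) (sgn-+ (height (cur , ν)) (zOf G)) ⟨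
        sgn (height (cur , ν) + zOf G) * Φ (map φ (beadList N mu)) ∎
        where
        open BeadMove (strip-beads {N} s q≤N)
        φa : φ a ≡ b
        φa = partner-∈ uy (sub pair∈)
        φb : φ b ≡ b
        φb = partner-∉ λ b∈ → let p′ , p′∈ , e = ∈-map⁻ proj₂ b∈ in w≢y (sub pair∈) p′∈ e
        sub′ : ∀ {p} → p ∈ us ++ vs → p ∈ I
        sub′ r with ∈-++⁻ us r
        ... | inj₁ t = sub (∈-++⁺ˡ t)
        ... | inj₂ t = sub (∈-++⁺ʳ us (aThere t))
        cov′ : ∀ x → cnt (beadList N ν) x ≡ cover (us ++ vs) x + cnt (beadList N mu) x
        cov′ x = +-cancelˡ-≡ (indicator (covers (b , a) x)) _ _ (trans (sym (move x)) (trans (cov x)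
          (trans (cong (_+ cnt (beadList N mu) x) (cover-++ us ((b , a) ∷ vs) x))
            (trans (ℕS.solve 4 (λ u i v m → (u ℕS.:+ (i ℕS.:+ v)) ℕS.:+ m ℕS.:= i ℕS.:+ ((u ℕS.:+ v) ℕS.:+ m)) refl
                (cover us x) (indicator (covers (b , a) x)) (cover vs x) (cnt (beadList N mu) x))
              (cong (λ n → indicator (covers (b , a) x) + (n + cnt (beadList N mu) x)) (sym (cover-++ us vs x)))))))

-- Snakes

odd? : ℕ → Bool
odd? zero    = false
odd? (suc n) = not (odd? n)

odd?-double : ∀ m → odd? (m *ℕ 2) ≡ false
odd?-double zero    = refl
odd?-double (suc m) = trans (not-involutive (odd? (m *ℕ 2))) (odd?-double m)

odd?-suc : ∀ s → s % 2 ≡ 0 → odd? (suc s) ≡ true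
odd?-suc s e = cong not (trans (cong odd? (trans (m≡m%n+[m/n]*n s 2) (cong (_+ (s / 2) *ℕ 2) e)))
    (odd?-double (s / 2)))

count : (ℕ → Bool) → ℕ → ℕ
count P zero    = 0
count P (suc n) = indicator (P 0) + count (P ∘ suc) n

filter-count : (f : Cell → Bool) (g : ℕ → Cell) (k : ℕ → ℕ) → ∀ n →
  length (filter (λ c → T? (f c)) (map g (applyUpTo k n))) ≡ count (λ m → f (g (k m))) n
filter-count f g k zero    = refl
filter-count f g k (suc n) with f (g (k 0))
... | true  = cong suc (filter-count f g (k ∘ suc) n)
... | false = filter-count f g (k ∘ suc) n

-- If P holds an odd number of times below n, then some pair 2m, 2m + 1 is split.
data OddAt (P : ℕ → Bool) (n : ℕ) : Set where
  falls : ∀ m → T (P (m *ℕ 2)) → ¬ T (P (suc (m *ℕ 2))) → OddAt P n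
  rises : ∀ m → ¬ T (P (m *ℕ 2)) → T (P (suc (m *ℕ 2))) → OddAt P n
  ends  : ∀ m → T (P (m *ℕ 2)) → n ≡ suc (m *ℕ 2) → OddAt P n

odd-count : ∀ P n → odd? (count P n) ≡ true → OddAt P n
odd-count P (suc zero) o with P 0 in e
... | true = ends 0 (subst T (sym e) tt) refl
odd-count P (suc (suc n)) o with P 0 in e | P 1 in e′
... | true  | false = falls 0 (subst T (sym e) tt) (subst T e′)
... | false | true  = rises 0 (subst T e) (subst T (sym e′) tt)
... | false | false = later (odd-count (λ m → P (suc (suc m))) n o)
  where
  later : OddAt (λ m → P (suc (suc m))) n → OddAt P (suc (suc n))
  later (falls m p q) = falls (suc m) p q
  later (rises m p q) = rises (suc m) p q
  later (ends m p q)  = ends (suc m) p (cong (suc ∘ suc) q)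
... | true  | true  = later (odd-count (λ m → P (suc (suc m))) n (trans (sym (not-involutive _)) o))
  where
  later : OddAt (λ m → P (suc (suc m))) n → OddAt P (suc (suc n))
  later (falls m p q) = falls (suc m) p q
  later (rises m p q) = rises (suc m) p q
  later (ends m p q)  = ends (suc m) p (cong (suc ∘ suc) q)

double/2 : ∀ m → (m *ℕ 2) / 2 ≡ m
double/2 m = m*n/n≡m m 2

suc-double/2 : ∀ m → suc (m *ℕ 2) / 2 ≡ m
suc-double/2 zero    = refl
suc-double/2 (suc m) = trans (m/n≡1+[m∸n]/n {suc (suc m *ℕ 2)} {2} (s≤s (s≤s z≤n))) (cong suc (suc-double/2 m))

suc-double%2 : ∀ m → suc (m *ℕ 2) % 2 ≡ 1
suc-double%2 zero    = refl
suc-double%2 (suc m) = suc-double%2 m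

-- The local functions of snakeSize, to which these unfold.
rightSnake leftSnake : ℕ → ℕ → ℕ → Cell
rightSnake i j n = if n % 2 ≡ᵇ 0 then (i ∸ (n / 2) , j ∸ (n / 2)) else (i ∸ suc (n / 2) , j ∸ (n / 2))
leftSnake  i j n = if n % 2 ≡ᵇ 0 then (i ∸ (n / 2) , j ∸ (n / 2)) else (i ∸ (n / 2) , j ∸ suc (n / 2))

right-even : ∀ i j m → rightSnake i j (m *ℕ 2) ≡ (i ∸ m , j ∸ m)
right-even i j m rewrite m*n%n≡0 m 2 ⦃ _ ⦄ | double/2 m = refl

right-odd : ∀ i j m → rightSnake i j (suc (m *ℕ 2)) ≡ (i ∸ suc m , j ∸ m)
right-odd i j m rewrite suc-double%2 m | suc-double/2 m = refl

left-even : ∀ i j m → leftSnake i j (m *ℕ 2) ≡ (i ∸ m , j ∸ m)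
left-even i j m rewrite m*n%n≡0 m 2 ⦃ _ ⦄ | double/2 m = refl

left-odd : ∀ i j m → leftSnake i j (suc (m *ℕ 2)) ≡ (i ∸ m , j ∸ suc m)
left-odd i j m rewrite suc-double%2 m | suc-double/2 m = refl

letterOf-L : ∀ e s → IsL (letterOf e s) → (∃₂ λ i j → e ≡ Bot i j) × odd? s ≡ true
letterOf-L e zero (_ , ())
letterOf-L e (suc s) p with s % 2 in eq
letterOf-L (Bot i j) (suc s) p | zero = (i , j , refl) , odd?-suc s eq
letterOf-L (Rgt i j) (suc s) (_ , ()) | zero
letterOf-L e (suc s) (_ , ()) | suc _

letterOf-R : ∀ e s → IsR (letterOf e s) → (∃₂ λ i j → e ≡ Rgt i j) × odd? s ≡ true
letterOf-R e zero (_ , ())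
letterOf-R e (suc s) p with s % 2 in eq
letterOf-R (Rgt i j) (suc s) p | zero = (i , j , refl) , odd?-suc s eq
letterOf-R (Bot i j) (suc s) (_ , ()) | zero
letterOf-R e (suc s) (_ , ()) | suc _

applyUpTo≡range : ∀ (f : ℕ → ℕ) c n → (∀ k → f k ≡ c + k) → applyUpTo f n ≡ range c n
applyUpTo≡range f c zero    e = refl
applyUpTo≡range f c (suc n) e = cong₂ _∷_ (trans (e 0) (+-identityʳ c))
    (applyUpTo≡range (f ∘ suc) (suc c) n (λ k → trans (e (suc k)) (+-suc c k)))

between≡range : ∀ a b → between a b ≡ range (suc a) (b ∸ a)
between≡range a b = trans (map-upTo (λ k → a + suc k) (b ∸ a)) (applyUpTo≡range _ (suc a) (b ∸ a) (λ k → +-suc a k))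

range-sorted : ∀ i n → AllPairs _<_ (range i n)
range-sorted i zero    = []
range-sorted i (suc n) = All.tabulate (λ p → proj₁ (∈-range⁻ (suc i) n p)) ∷ range-sorted (suc i) n

down : ℕ → ℕ → List ℕ
down a zero    = []
down a (suc d) = a + suc d ∷ down a d

reverse-between : ∀ a d → reverse (between a (a + d)) ≡ down a d
reverse-between a d = trans (cong (λ n → reverse (map (λ k → a + suc k) (upTo n))) (m+n∸m≡n a d)) (go d)
  where
  go : ∀ d → reverse (map (λ k → a + suc k) (upTo d)) ≡ down a d
  go zero    = refl
  go (suc d) = trans (cong (λ l → reverse (map (λ k → a + suc k) l)) (sym (upTo-∷ʳ d)))
    (trans (cong reverse (map-++ (λ k → a + suc k) (upTo d) (d ∷ [])))
      (trans (reverse-++ (map (λ k → a + suc k) (upTo d)) (a + suc d ∷ [])) (cong (a + suc d ∷_) (go d))))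

lastOr-∈ : ∀ x xs → lastOr x xs ∈ x ∷ xs
lastOr-∈ x []       = aHere refl
lastOr-∈ x (y ∷ xs) = aThere (lastOr-∈ y xs)

lastOr-max : ∀ x xs → AllPairs _<_ (x ∷ xs) → ∀ {y} → y ∈ x ∷ xs → y ≤ lastOr x xs
lastOr-max x []       s              (aHere refl) = ≤-refl
lastOr-max x (z ∷ xs) ((l ∷ _) ∷ s)  (aHere refl) = ≤-trans (<⇒≤ l) (lastOr-max z xs s (aHere refl))
lastOr-max x (z ∷ xs) (_ ∷ s)        (aThere p)   = lastOr-max z xs s p

¬T⇒≡false : ∀ {b} → ¬ T b → b ≡ false
¬T⇒≡false {true}  p = ⊥-elim (p tt)
¬T⇒≡false {false} p = refl

module Snakes {lam mu : List ℕ} (Pl : IsPartition lam) (Pμ : IsPartition mu) (m⊆l : mu ⊆ₚ lam) where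

  N : ℕ
  N = length lam

  In : Cell → Set
  In c = c ∈S (lam , mu)

  if-odd : ∀ b {n} → odd? (if b then n else 0) ≡ true → odd? n ≡ true
  if-odd true e = e

  right-size-odd : ∀ i j → odd? (snakeSize lam mu (Rgt i j)) ≡ true → OddAt
      (λ n → memb (lam , mu) (rightSnake i j n)) (suc (i + j))
  right-size-odd i j e = odd-count _ (suc (i + j)) (trans
      (cong odd? (sym (filter-count (memb (lam , mu)) (rightSnake i j) (λ n → n) (suc (i + j)))))
    (if-odd (memb (lam , mu) (i , j)) e))

  left-size-odd : ∀ i j → odd? (snakeSize lam mu (Bot i j)) ≡ true → OddAt (λ n → memb (lam , mu) (leftSnake i j n))
      (suc (i + j))
  left-size-odd i j e = odd-count _ (suc (i + j)) (trans
      (cong odd? (sym (filter-count (memb (lam , mu)) (leftSnake i j) (λ n → n) (suc (i + j)))))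
    (if-odd (memb (lam , mu) (i , j)) e))

  in⁻ : ∀ {c d} → c ≡ d → T (memb (lam , mu) c) → In d
  in⁻ {i , j} refl t = memb⇒∈S {lam} {mu} {i} {j} t

  in⁺ : ∀ {c d} → c ≡ d → In d → T (memb (lam , mu) c)
  in⁺ {i , j} refl t = ∈S⇒memb {lam} {mu} {i} {j} t

  -- Cells have positive coordinates, so at a cell of the shape the subtractions are not truncated.
  diagonal-< : ∀ i j m → In (i ∸ m , j ∸ m) → m < i × m < j
  diagonal-< i j m c∈ = m∸n≢0⇒n<m (m<n⇒n≢0 (proj₁ (∈S-row {lam} {mu} {i ∸ m} {j ∸ m} c∈))) ,
    m∸n≢0⇒n<m (m<n⇒n≢0 (proj₁ c∈))

  -- The snake is listed for the indices 0 to i + j. A cell at the last index i + j = 2m would have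
  -- m < i and m < j.
  not-last : ∀ i j m → In (i ∸ m , j ∸ m) → suc (i + j) ≢ suc (m *ℕ 2)
  not-last i j m c∈ e = <⇒≢ (≤-<-trans (≤-reflexive (trans (*-comm m 2) (cong (m +_) (+-identityʳ m))))
      (+-mono-<-≤ (proj₁ m<) (<⇒≤ (proj₂ m<)))) (sym (suc-injective e))
    where
    m< = diagonal-< i j m c∈

  row-up : ∀ {i m j} → j ≤ row lam i → m < i → j ∸ m ≤ row lam (i ∸ m)
  row-up {i} {m} {j} p q = ≤-trans (m∸n≤m j m) (≤-trans p (row-antitone Pl (m<n⇒0<n∸m q) (m∸n≤m i m)))

  -- From index 2m to 2m + 1 membership cannot rise: if the cell above (i - m, j - m) lies in λ/μ,
  -- so does that cell, with `le` keeping the diagonal inside λ. Odd size thus means leaving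
  -- upwards, through a horizontal step of the boundary of μ.
  right-turn : ∀ i j → j ≤ row lam i → odd? (snakeSize lam mu (Rgt i j)) ≡ true →
    ∃ λ m → In (i ∸ m , j ∸ m) × ¬ In (i ∸ suc m , j ∸ m)
  right-turn i j le o with right-size-odd i j o
  ... | falls m p q = m , in⁻ (right-even i j m) p , q ∘ in⁺ (right-odd i j m)
  ... | ends m p e  = ⊥-elim (not-last i j m (in⁻ (right-even i j m) p) e)
  ... | rises m p q = ⊥-elim (p (in⁺ (right-even i j m) (back (in⁻ (right-odd i j m) q))))
    where
    back : In (i ∸ suc m , j ∸ m) → In (i ∸ m , j ∸ m)
    back c∈ = ≤-trans (s≤s (row-antitone Pμ 1≤ (subst (i ∸ suc m ≤_) up (n≤1+n _)))) (proj₁ c∈) , row-up le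
        (<-trans (n<1+n m) m<)
      where
      1≤ : 1 ≤ i ∸ suc m
      1≤ = proj₁ (∈S-row {lam} {mu} {i ∸ suc m} {j ∸ m} c∈)
      m< : suc m < i
      m< = m∸n≢0⇒n<m (m<n⇒n≢0 1≤)
      up : suc (i ∸ suc m) ≡ i ∸ m
      up = sym (+-∸-assoc 1 (<⇒≤ m<))

  -- The same parity argument with the left neighbour: the snake leaves through a vertical step of
  -- the boundary of μ.
  left-turn : ∀ i j → j ≤ row lam i → odd? (snakeSize lam mu (Bot i j)) ≡ true →
    ∃ λ m → In (i ∸ m , j ∸ m) × ¬ In (i ∸ m , j ∸ suc m)
  left-turn i j le o with left-size-odd i j o
  ... | falls m p q = m , in⁻ (left-even i j m) p , q ∘ in⁺ (left-odd i j m)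
  ... | ends m p e  = ⊥-elim (not-last i j m (in⁻ (left-even i j m) p) e)
  ... | rises m p q = ⊥-elim (p (in⁺ (left-even i j m) (back (in⁻ (left-odd i j m) q))))
    where
    back : In (i ∸ m , j ∸ suc m) → In (i ∸ m , j ∸ m)
    back c∈ = ≤-trans (proj₁ c∈) (∸-monoʳ-≤ j (n≤1+n m)) , row-up {i} {m} {j} le
        (m∸n≢0⇒n<m (m<n⇒n≢0 (proj₁ (∈S-row {lam} {mu} {i ∸ m} {j ∸ suc m} c∈))))

  -- Positions depend only on the diagonal, so the point where a snake leaves the shape is a step of
  -- μ at the position of the original edge.
  same-diagonal : ∀ i j m → m < i → m < j → i ≤ N → j + (N ∸ i) ≡ (j ∸ m) + (N ∸ (i ∸ m))
  same-diagonal i j m m<i m<j i≤N = begin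
    j + (N ∸ i)                         ≡⟨ cong (_+ (N ∸ i)) (m+[n∸m]≡n (<⇒≤ m<j)) ⟨
    m + (j ∸ m) + (N ∸ i)               ≡⟨ cong (_+ (N ∸ i)) (+-comm m (j ∸ m)) ⟩
    (j ∸ m) + m + (N ∸ i)               ≡⟨ +-assoc (j ∸ m) m (N ∸ i) ⟩
    (j ∸ m) + (m + (N ∸ i))             ≡⟨ cong ((j ∸ m) +_) (+-∸-assoc m i≤N) ⟨
    (j ∸ m) + (m + N ∸ i)               ≡⟨ cong (λ k → (j ∸ m) + (m + N ∸ k)) (m+[n∸m]≡n (<⇒≤ m<i)) ⟨
    (j ∸ m) + (m + N ∸ (m + (i ∸ m)))   ≡⟨ cong ((j ∸ m) +_) ([m+n]∸[m+o]≡n∸o m N (i ∸ m)) ⟩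
    (j ∸ m) + (N ∸ (i ∸ m))             ∎

  ∈-beadList⁻ : ∀ α {x} → x ∈ beadList N α → ∃ λ k → 1 ≤ k × k ≤ N × x ≡ bead N α k
  ∈-beadList⁻ α p with k , k∈ , e ← ∈-map⁻ (bead N α) p with a , b ← ∈-range⁻ 1 N k∈ = k , a , ≤-pred b , e

  ∈-beadList⁺ : ∀ α {k} → 1 ≤ k → k ≤ N → bead N α k ∈ beadList N α
  ∈-beadList⁺ α a b = ∈-map⁺ (bead N α) (∈-range⁺ 1 N a (s≤s b))

  -- With I = i - m and J = j - m at the turn, a bead of μ at this position would belong to a row
  -- above I. Then row I - 1 of μ would be shorter than J and the cell above (I, J) would lie in
  -- λ/μ, against `right-turn`.
  right-∉ : ∀ i → i ≤ N → odd? (snakeSize lam mu (Rgt i (row lam i))) ≡ true → bead N lam i ∉ beadList N mu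
  right-∉ i i≤N o x∈ with m , c∈ , c∉ ← right-turn i (row lam i) ≤-refl o | k , 1≤k , k≤N , e ← ∈-beadList⁻ mu x∈
    = absurd (i ∸ m) refl
    where
    j = row lam i
    J = j ∸ m
    m<i = proj₁ (diagonal-< i j m c∈)
    pos : bead N lam i ≡ J + (N ∸ (i ∸ m))
    pos = same-diagonal i j m m<i (proj₂ (diagonal-< i j m c∈)) i≤N
    k< : k < i ∸ m
    k< with k <? i ∸ m
    ... | yes p = p
    ... | no  p = ⊥-elim (<-irrefl refl (≤-trans (subst (_≤ J + (N ∸ (i ∸ m))) refl
        (+-monoˡ-≤ (N ∸ (i ∸ m)) (proj₁ c∈)))
            (≤-trans (≤-reflexive (trans (sym pos) e))
                (bead-antitone {N} Pμ (proj₁ (∈S-row {lam} {mu} {i ∸ m} {J} c∈)) (≮⇒≥ p)))))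
    absurd : ∀ I → I ≡ i ∸ m → ⊥
    absurd zero     eq = m<n⇒n≢0 k< (sym eq)
    absurd (suc I₁) eq = c∉ (subst (λ I → In (I , J)) I₁≡ (μ<J , J≤))
      where
      I₁≡ : I₁ ≡ i ∸ suc m
      I₁≡ = suc-injective (trans eq (+-∸-assoc 1 m<i))
      k≤I₁ : k ≤ I₁
      k≤I₁ = ≤-pred (subst (k <_) (sym eq) k<)
      I≤N : suc I₁ ≤ N
      I≤N = subst (_≤ N) (sym eq) (≤-trans (m∸n≤m i m) i≤N)
      μ<J : row mu I₁ < J
      μ<J = +-cancelʳ-≤ (N ∸ suc I₁) (suc (row mu I₁)) J
          (≤-trans (≤-reflexive (trans (sym (+-suc (row mu I₁) (N ∸ suc I₁)))
              (cong (row mu I₁ +_) (sym (+-∸-assoc 1 I≤N)))))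
            (≤-trans (bead-antitone {N} Pμ 1≤k k≤I₁) (≤-reflexive
                (trans (sym e) (trans pos (cong (λ I → J + (N ∸ I)) (sym eq)))))))
      J≤ : J ≤ row lam I₁
      J≤ = ≤-trans (m∸n≤m j m) (row-antitone Pl (≤-trans 1≤k k≤I₁) (≤-trans (≤-reflexive I₁≡) (m∸n≤m i (suc m))))

  -- At the turn, row i - m of μ ends just before column j - m, which puts its bead at the position
  -- of the edge.
  left-∈ : ∀ i j {x} → i ≤ N → j ≤ row lam i → suc x ≡ j + (N ∸ i) → odd? (snakeSize lam mu (Bot i j)) ≡ true
      → x ∈ beadList N mu
  left-∈ i j {x} i≤N le e o with m , c∈ , c∉ ← left-turn i j le o = subst (_∈ beadList N mu) x≡
      (∈-beadList⁺ mu (proj₁ (∈S-row {lam} {mu} {i ∸ m} {j ∸ m} c∈)) (≤-trans (m∸n≤m i m) i≤N))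
    where
    m<i = proj₁ (diagonal-< i j m c∈)
    m<j = proj₂ (diagonal-< i j m c∈)
    J≡ : j ∸ m ≡ suc (j ∸ suc m)
    J≡ = +-∸-assoc 1 m<j
    μ≡ : row mu (i ∸ m) ≡ j ∸ suc m
    μ≡ = ≤-antisym (≤-pred (subst (row mu (i ∸ m) <_) J≡ (proj₁ c∈)))
      (≮⇒≥ λ l → c∉ (l , ≤-trans (∸-monoʳ-≤ j (n≤1+n m)) (row-up {i} {m} {j} le m<i)))
    x≡ : bead N mu (i ∸ m) ≡ x
    x≡ = suc-injective (trans (cong (λ r → suc (r + (N ∸ (i ∸ m)))) μ≡) (trans (cong (_+ (N ∸ (i ∸ m))) (sym J≡))
      (trans (sym (same-diagonal i j m m<i m<j i≤N)) (sym e))))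

  -- The position of a bottom edge in row i lies strictly between the beads of rows i and i + 1 of
  -- λ.
  left-∉ : ∀ i j {x} → 1 ≤ i → row lam (suc i) < j → j ≤ row lam i → suc x ≡ j + (N ∸ i) → x ∉ beadList N lam
  left-∉ i j {x} 1≤i lo hi e x∈ with k , 1≤k , k≤N , refl ← ∈-beadList⁻ lam x∈ | k ≤? i
  ... | yes k≤i = <-irrefl refl (≤-trans (≤-reflexive e)
      (≤-trans (+-monoˡ-≤ (N ∸ i) hi) (bead-antitone {N} Pl 1≤k k≤i)))
  ... | no  k≰i = <-irrefl refl (≤-trans (s≤s (≤-trans (s≤s (bead-antitone {N} Pl (s≤s z≤n) (≰⇒> k≰i)))
      (≤-reflexive (trans (sym (+-suc (row lam (suc i)) (N ∸ suc i)))
          (cong (row lam (suc i) +_) (sym (+-∸-assoc 1 (≤-trans (≰⇒> k≰i) k≤N))))))))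
    (≤-trans (+-monoˡ-≤ (N ∸ i) lo) (≤-reflexive (sym e))))

  -- The position where the edge ends, for the path of λ with all N rows. The edge is the step at
  -- the position one less, which for `Rgt` is the bead.
  endpoint : Edge → ℕ
  endpoint (Bot i j) = j + (N ∸ i)
  endpoint (Rgt i j) = suc (j + (N ∸ i))

  data Valid : Edge → Set where
    bot : ∀ {i j} → 1 ≤ i → i ≤ N → row lam (suc i) < j → j ≤ row lam i → Valid (Bot i j)
    rgt : ∀ {i} → 1 ≤ i → i ≤ N → Valid (Rgt i (row lam i))

  data Path : ℕ → List Edge → ℕ → Set where
    []  : ∀ {s} → Path s [] s
    _∷_ : ∀ {s e es t} → Valid e × endpoint e ≡ suc s → Path (suc s) es t → Path s (e ∷ es) t

  path-++ : ∀ {s es t fs u} → Path s es t → Path t fs u → Path s (es ++ fs) u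
  path-++ []      q = q
  path-++ (v ∷ p) q = v ∷ path-++ p q

  -- Mirrors the local function of `boundaryPath`, including its `foldr`, so that both unfold to the
  -- same term.
  rowEdges : ℕ → ℕ → List Edge
  rowEdges m i = foldr _∷_ (Rgt i (row lam i) ∷ []) (map (Bot i)
      (between (if i ≡ᵇ m then row mu m else row lam (suc i)) (row lam i)))

  fullPath : List ℕ → List Edge
  fullPath []         = []
  fullPath rs@(_ ∷ _) = concatMap (rowEdges (lastOr 0 rs)) (reverse (between (headOr 0 rs ∸ 1) (lastOr 0 rs)))

  boundaryPath≡fullPath : boundaryPath lam mu ≡ fullPath (nonemptyRows lam mu)
  boundaryPath≡fullPath with nonemptyRows lam mu
  ... | []    = refl
  ... | _ ∷ _ = refl

  bottom-path : ∀ i a d → 1 ≤ i → i ≤ N → row lam (suc i) ≤ a → a + d ≡ row lam i →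
    Path (a + (N ∸ i)) (foldr _∷_ (Rgt i (row lam i) ∷ []) (map (Bot i) (range (suc a) d)))
        (suc (row lam i + (N ∸ i)))
  bottom-path i a zero    p q le e = (rgt p q , cong (λ r → suc (r + (N ∸ i))) (trans (sym e) (+-identityʳ a))) ∷
    subst (λ r → Path (suc (a + (N ∸ i))) [] (suc (r + (N ∸ i)))) (trans (sym (+-identityʳ a)) e) []
  bottom-path i a (suc d) p q le e = (bot p q (s≤s le) (≤-trans (s≤s (m≤m+n a d)) (≤-reflexive e′)) , refl) ∷
    bottom-path i (suc a) d p q (m≤n⇒m≤1+n le) e′
    where
    e′ : suc a + d ≡ row lam i
    e′ = trans (sym (+-suc a d)) e

  row-path : ∀ i lo → 1 ≤ i → i ≤ N → row lam (suc i) ≤ lo → lo ≤ row lam i →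
    Path (lo + (N ∸ i)) (foldr _∷_ (Rgt i (row lam i) ∷ []) (map (Bot i) (between lo (row lam i))))
        (suc (row lam i + (N ∸ i)))
  row-path i lo p q le ge = subst (λ l → Path (lo + (N ∸ i)) (foldr _∷_ (Rgt i (row lam i) ∷ []) (map (Bot i) l))
      (suc (row lam i + (N ∸ i))))
    (sym (between≡range lo (row lam i))) (bottom-path i lo (row lam i ∸ lo) p q le (m+[n∸m]≡n ge))

  rowEdges-last : ∀ m → rowEdges m m ≡ foldr _∷_ (Rgt m (row lam m) ∷ [])
      (map (Bot m) (between (row mu m) (row lam m)))
  rowEdges-last m rewrite to T-≡ (≡⇒≡ᵇ m m refl) = refl

  rowEdges-other : ∀ m i → i < m → rowEdges m i ≡ foldr _∷_ (Rgt i (row lam i) ∷ [])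
      (map (Bot i) (between (row lam (suc i)) (row lam i)))
  rowEdges-other m i l rewrite ¬T⇒≡false {i ≡ᵇ m} (λ t → <⇒≢ l (≡ᵇ⇒≡ i m t)) = refl

  upper-rows : ∀ m a d → a + d < m → m ≤ N →
    ∃ λ t → Path (row lam (suc (a + d)) + (N ∸ (a + d))) (concatMap (rowEdges m) (down a d)) t
  upper-rows m a zero    l m≤N = _ , []
  upper-rows m a (suc d) l m≤N = _ , path-++ (subst (λ es → Path _ es (suc (row lam i + (N ∸ i))))
      (sym (rowEdges-other m i l))
      (row-path i (row lam (suc i)) 1≤i i≤N ≤-refl (row-antitone Pl 1≤i (n≤1+n i))))
    (subst (λ s → Path s (concatMap (rowEdges m) (down a d)) (proj₁ rest)) joint (proj₂ rest))
    where
    i = a + suc d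
    i≡ : i ≡ suc (a + d)
    i≡ = +-suc a d
    1≤i : 1 ≤ i
    1≤i = subst (1 ≤_) (sym i≡) (s≤s z≤n)
    i≤N : i ≤ N
    i≤N = ≤-trans (<⇒≤ l) m≤N
    rest = upper-rows m a d (≤-trans (s≤s (≤-trans (n≤1+n _) (≤-reflexive (sym i≡)))) l) m≤N
    joint : row lam (suc (a + d)) + (N ∸ (a + d)) ≡ suc (row lam i + (N ∸ i))
    joint = trans (cong₂ _+_ (cong (row lam) (sym i≡))
        (trans (+-∸-assoc 1 (subst (_≤ N) i≡ i≤N)) (cong (λ k → suc (N ∸ k)) (sym i≡))))
      (+-suc (row lam i) (N ∸ i))

  -- The bottom row starts after column μ_m rather than λ_{m+1}; `le` ensures that its bottom edges
  -- are not shared with cells of row m + 1.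
  all-rows : ∀ m a → 1 ≤ m → m ≤ N → row lam (suc m) ≤ row mu m →
    ∃ λ t → Path (row mu m + (N ∸ m)) (concatMap (rowEdges m) (reverse (between a m))) t
  all-rows m a 1≤m m≤N le with a <? m
  ... | no  p = _ , subst (λ l → Path (row mu m + (N ∸ m))
      (concatMap (rowEdges m) (reverse (map (λ k → a + suc k) (upTo l)))) (row mu m + (N ∸ m)))
    (sym (m≤n⇒m∸n≡0 (≮⇒≥ p))) []
  ... | yes p = _ , subst (λ es → Path (row mu m + (N ∸ m)) (concatMap (rowEdges m) es) (proj₁ rest)) (sym down≡)
      (path-++ (subst (λ es → Path (row mu m + (N ∸ m)) es (suc (row lam m + (N ∸ m)))) (sym (rowEdges-last m))
          (row-path m (row mu m) 1≤m m≤N le (m⊆l m)))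
        (subst (λ s → Path s (concatMap (rowEdges m) (down a d)) (proj₁ rest)) joint (proj₂ rest)))
    where
    d = m ∸ suc a
    m≡ : suc (a + d) ≡ m
    m≡ = m+[n∸m]≡n p
    rest = upper-rows m a d (≤-reflexive m≡) m≤N
    joint : row lam (suc (a + d)) + (N ∸ (a + d)) ≡ suc (row lam m + (N ∸ m))
    joint = trans (cong₂ _+_ (cong (row lam) m≡) (trans (+-∸-assoc 1 (subst (_≤ N) (sym m≡) m≤N))
        (cong (λ k → suc (N ∸ k)) m≡)))
      (+-suc (row lam m) (N ∸ m))
    down≡ : reverse (between a m) ≡ m ∷ down a d
    down≡ = trans (cong (λ k → reverse (between a k)) (trans (sym m≡) (sym (+-suc a d))))
        (trans (reverse-between a (suc d)) (cong (_∷ down a d) (trans (+-suc a d) m≡)))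

  boundary-path : ∃₂ λ s t → Path s (boundaryPath lam mu) t
  boundary-path rewrite boundaryPath≡fullPath = go (nonemptyRows lam mu) refl
    where
    nonempty : ∀ {i} → i ∈ nonemptyRows lam mu → row mu i < row lam i
    nonempty {i} p = <ᵇ⇒< (row mu i) (row lam i) (proj₂
        (∈-filter⁻ (λ i → T? (row mu i <ᵇ row lam i)) {xs = between 0 (length lam)} p))
    nonempty⁺ : ∀ {i} → row mu i < row lam i → i ∈ nonemptyRows lam mu
    nonempty⁺ {i} p = ∈-filter⁺ (λ i → T? (row mu i <ᵇ row lam i)) (∈-between⁺ 0 (length lam) (proj₁ r) (proj₂ r))
        (<⇒<ᵇ p)
      where r = ∈S-row {lam} {mu} {i} {row lam i} (p , ≤-refl)
    sorted : AllPairs _<_ (nonemptyRows lam mu)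
    sorted = pairs-filter⁺ (λ i → T? (row mu i <ᵇ row lam i))
        (subst (AllPairs _<_) (sym (between≡range 0 (length lam))) (range-sorted 1 (length lam)))
    go : ∀ rs → rs ≡ nonemptyRows lam mu → ∃₂ λ s t → Path s (fullPath rs) t
    go []       e = 0 , 0 , []
    go (x ∷ xs) e = _ , all-rows m (x ∸ 1) (proj₁ r) (proj₂ r) top-row
      where
      m = lastOr x xs
      m< : row mu m < row lam m
      m< = nonempty (subst (m ∈_) e (lastOr-∈ x xs))
      r = ∈S-row {lam} {mu} {m} {row lam m} (m< , ≤-refl)
      -- Row m + 1 of λ/μ is empty, m being the last nonempty row, so λ_{m+1} is at most μ_{m+1}.
      top-row : row lam (suc m) ≤ row mu m
      top-row with row lam (suc m) ≤? row mu (suc m)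
      ... | yes p = ≤-trans p (row-antitone Pμ (proj₁ r) (n≤1+n m))
      ... | no  p = ⊥-elim (<-irrefl refl (lastOr-max x xs (subst (AllPairs _<_) (sym e) sorted)
          (subst (suc m ∈_) (sym e) (nonempty⁺ (≰⇒> p)))))

  -- `letterAt` counts from 1 and yields `O` out of range, so any other letter comes from an edge.
  letter-edge : ∀ {s es t} (f : Edge → Letter) → Path s es t → ∀ u → letterAt (map f es) u ≢ O →
    ∃ λ e → Valid e × f e ≡ letterAt (map f es) u × ∃ λ x → suc x ≡ s + u × endpoint e ≡ suc x
  letter-edge f p zero ne = ⊥-elim (ne refl)
  letter-edge f [] (suc u) ne = ⊥-elim (ne refl)
  letter-edge {s} f (_∷_ {e = e} (v , q) p) (suc zero) ne = e , v , refl , s , +-comm 1 s , q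
  letter-edge {s} f ((_ , _) ∷ p) (suc (suc u)) ne with e , v , r , x , a , b ← letter-edge f p
      (suc u) ne = e , v , r , x , trans a (sym (+-suc s (suc u))) , b

  -- The u-th edge of the boundary path is the step at position s + u - 1.
  letter-beads : ∃ λ s →
    (∀ u → IsL (letterAt (snakeSeq lam mu) u) → ∃ λ x → suc x ≡ s + u × x ∈ beadList N mu × x ∉ beadList N lam) ×
    (∀ u → IsR (letterAt (snakeSeq lam mu) u) → ∃ λ x → suc x ≡ s + u × x ∈ beadList N lam × x ∉ beadList N mu)
  letter-beads with s , t , p ← boundary-path = s , left p , right p
    where
    f : Edge → Letter
    f e = letterOf e (snakeSize lam mu e)
    left : ∀ {s t} → Path s (boundaryPath lam mu) t → ∀ u → IsL (letterAt (snakeSeq lam mu) u) → ∃ λ x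
        → suc x ≡ s + u × x ∈ beadList N mu × x ∉ beadList N lam
    left p u l with e , v , r , x , a , b ← letter-edge f p u (λ o → case trans (sym o) (proj₂ l) of λ ())
      with (i , j , refl) , odd ← letterOf-L e (snakeSize lam mu e) (proj₁ l , trans r (proj₂ l))
      with bot 1≤i i≤N lo hi ← v = x , a , left-∈ i j i≤N hi (sym b) odd , left-∉ i j 1≤i lo hi (sym b)
    right : ∀ {s t} → Path s (boundaryPath lam mu) t → ∀ u → IsR (letterAt (snakeSeq lam mu) u) → ∃ λ x
        → suc x ≡ s + u × x ∈ beadList N lam × x ∉ beadList N mu
    right p u l with e , v , r , x , a , b ← letter-edge f p u (λ o → case trans (sym o) (proj₂ l) of λ ())
      with (i , j , refl) , odd ← letterOf-R e (snakeSize lam mu e) (proj₁ l , trans r (proj₂ l))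
      with rgt 1≤i i≤N ← v with refl ← suc-injective b = x , a , ∈-beadList⁺ lam 1≤i i≤N , right-∉ i i≤N odd

-- Polynomial functions

-- Agreement is asked at natural arguments, where the tableau count is defined; the witness is the
-- list of coefficients.
Polynomial : (ℕ → ℚ) → Set
Polynomial f = ∃ λ p → ∀ t → evalP p (ℕtoℚ t) ≡ f t

polynomial-cong : ∀ {f g} → (∀ t → f t ≡ g t) → Polynomial f → Polynomial g
polynomial-cong e (p , q) = p , λ t → trans (q t) (e t)

polynomial-const : ∀ c → Polynomial (λ _ → c)
polynomial-const c = c ∷ [] , λ t → solve 2 (λ c x → c :+ x :* con 0ℚ := c) refl c (ℕtoℚ t)

polynomial-id : Polynomial ℕtoℚ
polynomial-id = 0ℚ ∷ 1ℚ ∷ [] , λ t → solve 1 (λ x → con 0ℚ :+ x :* (con 1ℚ :+ x :* con 0ℚ) := x) refl (ℕtoℚ t)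

addP : List ℚ → List ℚ → List ℚ
addP []      q       = q
addP (a ∷ p) []      = a ∷ p
addP (a ∷ p) (b ∷ q) = a +ℚ b ∷ addP p q

evalP-add : ∀ p q x → evalP (addP p q) x ≡ evalP p x +ℚ evalP q x
evalP-add []      q       x = sym (ℚ.+-identityˡ _)
evalP-add (a ∷ p) []      x = sym (ℚ.+-identityʳ _)
evalP-add (a ∷ p) (b ∷ q) x = trans (cong (λ e → (a +ℚ b) +ℚ x * e) (evalP-add p q x))
  (solve 5 (λ a b x p q → (a :+ b) :+ x :* (p :+ q) := (a :+ x :* p) :+ (b :+ x :* q)) refl a b x (evalP p x)
      (evalP q x))

scaleP : ℚ → List ℚ → List ℚ
scaleP c = map (c *_)

evalP-scale : ∀ c p x → evalP (scaleP c p) x ≡ c * evalP p x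
evalP-scale c []      x = sym (ℚ.*-zeroʳ c)
evalP-scale c (a ∷ p) x = trans (cong (λ e → c * a +ℚ x * e) (evalP-scale c p x))
  (solve 4 (λ c a x p → c :* a :+ x :* (c :* p) := c :* (a :+ x :* p)) refl c a x (evalP p x))

mulP : List ℚ → List ℚ → List ℚ
mulP []      q = []
mulP (a ∷ p) q = addP (scaleP a q) (0ℚ ∷ mulP p q)

evalP-mul : ∀ p q x → evalP (mulP p q) x ≡ evalP p x * evalP q x
evalP-mul []      q x = sym (ℚ.*-zeroˡ (evalP q x))
evalP-mul (a ∷ p) q x = trans (evalP-add (scaleP a q) (0ℚ ∷ mulP p q) x)
  (trans (cong₂ (λ e f → e +ℚ (0ℚ +ℚ x * f)) (evalP-scale a q x) (evalP-mul p q x))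
    (solve 4 (λ a x p q → a :* q :+ (con 0ℚ :+ x :* (p :* q)) := (a :+ x :* p) :* q) refl a x (evalP p x)
        (evalP q x)))

polynomial-+ : ∀ {f g} → Polynomial f → Polynomial g → Polynomial (λ t → f t +ℚ g t)
polynomial-+ (p , e) (q , e′) = addP p q , λ t → trans (evalP-add p q (ℕtoℚ t)) (cong₂ _+ℚ_ (e t) (e′ t))

polynomial-* : ∀ {f g} → Polynomial f → Polynomial g → Polynomial (λ t → f t * g t)
polynomial-* (p , e) (q , e′) = mulP p q , λ t → trans (evalP-mul p q (ℕtoℚ t)) (cong₂ _*_ (e t) (e′ t))

polynomial-neg : ∀ {f} → Polynomial f → Polynomial (λ t → -ℚ f t)
polynomial-neg {f} pf = polynomial-cong (λ t → solve 1 (λ a → (:- con 1ℚ) :* a := :- a) refl (f t))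
    (polynomial-* (polynomial-const (-ℚ 1ℚ)) pf)

polynomial-ι : {f : ℕ → X → ℚ} {Φ : ℕ → List X → ℚ} → (∀ x → Polynomial (λ t → f t x)) →
  (∀ ys → Polynomial (λ t → Φ t ys)) → ∀ xs → Polynomial (λ t → ι (f t) (Φ t) xs)
polynomial-ι pf pΦ []       = polynomial-const 0ℚ
polynomial-ι pf pΦ (x ∷ xs) = polynomial-+ (polynomial-* (pf x) (pΦ xs))
    (polynomial-neg (polynomial-ι pf (λ ys → pΦ (x ∷ ys)) xs))

polynomial-detL : (fs : List (ℕ → X → ℚ)) → (∀ {f} → f ∈ fs → ∀ x → Polynomial (λ t → f t x)) →
  ∀ xs → Polynomial (λ t → detL (map (λ f → f t) fs) xs)
polynomial-detL []       pf []       = polynomial-const 1ℚ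
polynomial-detL []       pf (_ ∷ _)  = polynomial-const 0ℚ
polynomial-detL (f ∷ fs) pf xs       = polynomial-ι (pf (aHere refl)) (λ ys → polynomial-detL fs (pf ∘ aThere) ys) xs

power : ℚ → ℕ → ℚ
power x zero    = 1ℚ
power x (suc r) = x * power x r

shiftP : ℕ → List ℚ → List ℚ
shiftP zero    p = p
shiftP (suc r) p = 0ℚ ∷ shiftP r p

evalP-shift : ∀ r p x → evalP (shiftP r p) x ≡ power x r * evalP p x
evalP-shift zero    p x = sym (ℚ.*-identityˡ _)
evalP-shift (suc r) p x = trans (cong (λ e → 0ℚ +ℚ x * e) (evalP-shift r p x))
  (solve 3 (λ x a b → con 0ℚ :+ x :* (a :* b) := (x :* a) :* b) refl x (power x r) (evalP p x))

coeff-shift-< : ∀ r p {i} → i < r → coeff (shiftP r p) i ≡ 0ℚ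
coeff-shift-< (suc r) p {zero}  l       = refl
coeff-shift-< (suc r) p {suc i} (s≤s l) = coeff-shift-< r p l

coeff-shift : ∀ r p → coeff (shiftP r p) r ≡ coeff p 0
coeff-shift zero    p = refl
coeff-shift (suc r) p = coeff-shift r p

coeff-0 : ∀ p → coeff p 0 ≡ evalP p (ℕtoℚ 0)
coeff-0 []      = refl
coeff-0 (a ∷ p) = solve 2 (λ a e → a := a :+ con 0ℚ :* e) refl a (evalP p 0ℚ)

-- The kernel divided by t, and its value at t = 0

h-1 : ∀ t → h t 1 ≡ t
h-1 zero    = refl
h-1 (suc t) = trans (cong (h t 1 +_) refl) (trans (+-comm (h t 1) 1) (cong suc (h-1 t)))

mutual
  -- For h t n = C(t + n - 1, n) this and `h-suc-row` are the absorption identities in n and in t.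
  -- Pascal's rule reduces each to both of them at smaller arguments, hence the mutual induction.
  h-suc-column : ∀ t n → suc n *ℕ h t (suc n) ≡ (t + n) *ℕ h t n
  h-suc-column zero    zero    = refl
  h-suc-column zero    (suc n) = trans (*-zeroʳ (suc (suc n))) (sym (*-zeroʳ (suc n)))
  h-suc-column (suc t) n = begin
    suc n *ℕ (h t (suc n) + h (suc t) n)
      ≡⟨ ℕS.solve 3 (λ m a b → m ℕS.:* (a ℕS.:+ b) ℕS.:= m ℕS.:* a ℕS.:+ m ℕS.:* b) refl (suc n) (h t (suc n))
          (h (suc t) n) ⟩
    suc n *ℕ h t (suc n) + suc n *ℕ h (suc t) n
      ≡⟨ cong (_+ suc n *ℕ h (suc t) n) (trans (h-suc-column t n) (sym (h-suc-row t n))) ⟩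
    t *ℕ h (suc t) n + suc n *ℕ h (suc t) n
      ≡⟨ ℕS.solve 3 (λ t n b → t ℕS.:* b ℕS.:+ (ℕS.con 1 ℕS.:+ n) ℕS.:* b ℕS.:=
          (ℕS.con 1 ℕS.:+ (t ℕS.:+ n)) ℕS.:* b) refl t n (h (suc t) n) ⟩
    (suc t + n) *ℕ h (suc t) n ∎

  h-suc-row : ∀ t n → t *ℕ h (suc t) n ≡ (t + n) *ℕ h t n
  h-suc-row t zero    = cong₂ _*ℕ_ (sym (+-identityʳ t)) (sym (h-0 t))
  h-suc-row t (suc n) = begin
    t *ℕ (h t (suc n) + h (suc t) n)
      ≡⟨ ℕS.solve 3 (λ m a b → m ℕS.:* (a ℕS.:+ b) ℕS.:= m ℕS.:* a ℕS.:+ m ℕS.:* b) refl t (h t (suc n))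
          (h (suc t) n) ⟩
    t *ℕ h t (suc n) + t *ℕ h (suc t) n
      ≡⟨ cong (t *ℕ h t (suc n) +_) (trans (h-suc-row t n) (sym (h-suc-column t n))) ⟩
    t *ℕ h t (suc n) + suc n *ℕ h t (suc n)
      ≡⟨ ℕS.solve 3 (λ t n b → t ℕS.:* b ℕS.:+ n ℕS.:* b ℕS.:= (t ℕS.:+ n) ℕS.:* b) refl t (suc n) (h t (suc n)) ⟩
    (t + suc n) *ℕ h t (suc n) ∎

-- hDiv n t is the polynomial h_n(1^t) / t, with value 1 / n at t = 0; hDiv 0 t is a junk value.
hDiv : ℕ → ℕ → ℚ
hDiv zero          t = 0ℚ
hDiv (suc zero)    t = 1ℚ
hDiv (suc (suc n)) t = hDiv (suc n) t * (ℕtoℚ (t + suc n) * recipℕ (suc (suc n)))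

h≡t*hDiv : ∀ t n → ℕtoℚ (h t (suc n)) ≡ ℕtoℚ t * hDiv (suc n) t
h≡t*hDiv t zero    = trans (cong ℕtoℚ (h-1 t)) (sym (ℚ.*-identityʳ _))
h≡t*hDiv t (suc n) = begin
  ℕtoℚ (h t (suc (suc n)))
    ≡⟨ solve 1 (λ a → a := con 1ℚ :* a) refl _ ⟩
  1ℚ * ℕtoℚ (h t (suc (suc n)))
    ≡⟨ cong (_* ℕtoℚ (h t (suc (suc n)))) (sym (ℕtoℚ-suc-recip (suc n))) ⟩
  ℕtoℚ (suc (suc n)) * ρ * ℕtoℚ (h t (suc (suc n)))
    ≡⟨ solve 3 (λ a r b → (a :* r) :* b := r :* (a :* b)) refl (ℕtoℚ (suc (suc n))) ρ (ℕtoℚ (h t (suc (suc n)))) ⟩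
  ρ * (ℕtoℚ (suc (suc n)) * ℕtoℚ (h t (suc (suc n))))
    ≡⟨ cong (ρ *_) (trans (sym (ℕtoℚ-* (suc (suc n)) (h t (suc (suc n)))))
        (trans (cong ℕtoℚ (h-suc-column t (suc n))) (ℕtoℚ-* (t + suc n) (h t (suc n))))) ⟩
  ρ * (ℕtoℚ (t + suc n) * ℕtoℚ (h t (suc n)))
    ≡⟨ cong (λ e → ρ * (ℕtoℚ (t + suc n) * e)) (h≡t*hDiv t n) ⟩
  ρ * (ℕtoℚ (t + suc n) * (ℕtoℚ t * hDiv (suc n) t))
    ≡⟨ solve 4 (λ r a t g → r :* (a :* (t :* g)) := t :* (g :* (a :* r))) refl ρ (ℕtoℚ (t + suc n)) (ℕtoℚ t)
        (hDiv (suc n) t) ⟩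
  ℕtoℚ t * hDiv (suc (suc n)) t ∎
  where
  ρ = recipℕ (suc (suc n))

-- At t = 0 the factor t + n + 1 cancels the 1 / (n + 1) reached before.
hDiv-0 : ∀ n → hDiv (suc n) 0 ≡ recipℕ (suc n)
hDiv-0 zero    = refl
hDiv-0 (suc n) = trans (cong (_* (ℕtoℚ (suc n) * ρ)) (hDiv-0 n))
  (trans (solve 3 (λ a b r → a :* (b :* r) := (b :* a) :* r) refl (recipℕ (suc n)) (ℕtoℚ (suc n)) ρ)
    (trans (cong (_* ρ) (ℕtoℚ-suc-recip n)) (ℚ.*-identityˡ ρ)))
  where
  ρ = recipℕ (suc (suc n))

polynomial-hDiv : ∀ n → Polynomial (hDiv n)
polynomial-hDiv zero          = polynomial-const 0ℚ
polynomial-hDiv (suc zero)    = polynomial-const 1ℚ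
polynomial-hDiv (suc (suc n)) = polynomial-* (polynomial-hDiv (suc n)) (polynomial-*
  (polynomial-cong (λ t → sym (ℕtoℚ-+ t (suc n))) (polynomial-+ polynomial-id (polynomial-const (ℕtoℚ (suc n)))))
  (polynomial-const (recipℕ (suc (suc n)))))

-- On the diagonal, where the kernel is 1 and not divisible by t, the value is the default 0.
kernDiv : ℕ → ℕ → ℕ → ℚ
kernDiv t zero    a       = hDiv a t
kernDiv t (suc b) zero    = 0ℚ
kernDiv t (suc b) (suc a) = kernDiv t b a

polynomial-kernDiv : ∀ b a → Polynomial (λ t → kernDiv t b a)
polynomial-kernDiv zero    a       = polynomial-hDiv a
polynomial-kernDiv (suc b) zero    = polynomial-const 0ℚ
polynomial-kernDiv (suc b) (suc a) = polynomial-kernDiv b a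

polynomial-kern : ∀ b a → Polynomial (λ t → kernℚ t b a)
polynomial-kern zero    zero    = polynomial-cong (λ t → cong ℕtoℚ (sym (h-0 t))) (polynomial-const 1ℚ)
polynomial-kern zero    (suc a) = polynomial-cong (λ t → sym (h≡t*hDiv t a))
    (polynomial-* polynomial-id (polynomial-hDiv (suc a)))
polynomial-kern (suc b) zero    = polynomial-const 0ℚ
polynomial-kern (suc b) (suc a) = polynomial-kern b a

kern≡t*kernDiv : ∀ t b a → b ≢ a → kernℚ t b a ≡ ℕtoℚ t * kernDiv t b a
kern≡t*kernDiv t zero    zero    p = ⊥-elim (p refl)
kern≡t*kernDiv t zero    (suc a) p = h≡t*hDiv t a
kern≡t*kernDiv t (suc b) zero    p = sym (ℚ.*-zeroʳ (ℕtoℚ t))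
kern≡t*kernDiv t (suc b) (suc a) p = kern≡t*kernDiv t b a (p ∘ cong suc)

inverseDifference : ℕ → ℕ → ℚ
inverseDifference w y = if w <ᵇ y then recipℕ (y ∸ w) else 0ℚ

kernDiv-0 : ∀ b a → kernDiv 0 b a ≡ inverseDifference b a
kernDiv-0 zero    zero    = refl
kernDiv-0 zero    (suc a) = hDiv-0 a
kernDiv-0 (suc b) zero    = refl
kernDiv-0 (suc b) (suc a) = kernDiv-0 b a

inverseDifference-+ : ∀ s w y → inverseDifference (s + w) (s + y) ≡ inverseDifference w y
inverseDifference-+ zero    w y = refl
inverseDifference-+ (suc s) w y = inverseDifference-+ s w y

-- The factor is taken out of the rows `ws`, while `fs` stay as they are. `P` restricts the columns,
-- because t divides the kernel off the diagonal only.
detL-scale : (c : ℚ) (k l : Y → X → ℚ) (fs : List (X → ℚ)) → ∀ ws {zs} → (P : X → Set) → All P zs →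
  (∀ {w x} → w ∈ ws → P x → k w x ≡ c * l w x) →
  detL (fs ++ map k ws) zs ≡ power c (length ws) * detL (fs ++ map l ws) zs
detL-scale c k l []       []       P ps e = sym (ℚ.*-identityˡ _)
detL-scale c k l []       (w ∷ ws) {zs} P ps e = begin
  ι (k w) (detL (map k ws)) zs
    ≡⟨ ι-cong-on P (e (aHere refl)) (λ qs → detL-scale c k l [] ws P qs (e ∘ aThere)) ps ⟩
  ι (λ x → c * l w x) (λ ys → power c (length ws) * detL (map l ws) ys) zs
    ≡⟨ trans (ι-*ˡ c (l w) _ zs) (cong (c *_) (ι-*ʳ (power c (length ws)) (l w) (detL (map l ws)) zs)) ⟩
  c * (power c (length ws) * ι (l w) (detL (map l ws)) zs)
    ≡⟨ ℚ.*-assoc c (power c (length ws)) _ ⟨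
  c * power c (length ws) * ι (l w) (detL (map l ws)) zs ∎
detL-scale c k l (f ∷ fs) ws {zs} P ps e = trans
  (ι-cong-on P (λ _ → refl) (λ qs → detL-scale c k l fs ws P qs e) ps)
  (ι-*ʳ (power c (length ws)) f (detL (fs ++ map l ws)) zs)

ι-map : (s : Y → X) (f : X → ℚ) (Φ : List X → ℚ) → ∀ ys → ι f Φ (map s ys) ≡ ι (f ∘ s) (Φ ∘ map s) ys
ι-map s f Φ []       = refl
ι-map s f Φ (y ∷ ys) = cong (f (s y) * Φ (map s ys) -_) (ι-map s f (Φ ∘ (s y ∷_)) ys)

detL-map : {Z : Set} (s : Y → X) (k : Z → X → ℚ) (l : Z → Y → ℚ) → ∀ ws {ys} → (P : Y → Set) → All P ys →
  (∀ {w y} → w ∈ ws → P y → k w (s y) ≡ l w y) → detL (map k ws) (map s ys) ≡ detL (map l ws) ys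
detL-map s k l []       {[]}     P ps e = refl
detL-map s k l []       {y ∷ ys} P ps e = refl
detL-map s k l (w ∷ ws) {ys}     P ps e = trans (ι-map s (k w) (detL (map k ws)) ys)
  (ι-cong-on P (e (aHere refl)) (λ qs → detL-map s k l ws P qs (e ∘ aThere)) ps)

-- Unit rows listed in the same order as their columns are split off one by one without signs.
detL-diagonal : (k : X → X → ℚ) (fs : List (X → ℚ)) → ∀ cs {xs} → Unique (cs ++ xs) →
  (∀ c → k c c ≡ 1ℚ) → (∀ {c x} → c ≢ x → k c x ≡ 0ℚ) → detL (map k cs ++ fs) (cs ++ xs) ≡ detL fs xs
detL-diagonal k fs []       u       on off = refl
detL-diagonal k fs (c ∷ cs) (n ∷ u) on off = trans (detL-unit-row (k c) (map k cs ++ fs) (on c) (All.map off n))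
  (detL-diagonal k fs cs u on off)

tabulate-lookup : (f : X → Y) → ∀ {n} (v : Vec X n) → tabulate (λ i → f (lookup v i)) ≡ map f (toList v)
tabulate-lookup f []      = refl
tabulate-lookup f (x ∷ v) = cong (f x ∷_) (tabulate-lookup f v)

unique-↭ : {xs zs : List X} → Unique xs → (∀ {x} → x ∈ xs → x ∈ zs) → length zs ≡ length xs → xs ↭ zs
unique-↭ {xs = xs} u s e with unique-⊆-↭ u s
... | []     , p = subst (_↭ _) (++-identityʳ xs) (↭-sym p)
... | w ∷ ws , p = ⊥-elim (<⇒≢ (subst (length xs <_) (trans (sym (length-++ xs)) (sym (↭-length p)))
    (subst (length xs <_) (+-comm (suc (length ws)) (length xs)) (s≤s (m≤n+m (length xs) (length ws))))) (sym e))

-- The power of t and the constant term of the quotient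

module Beads {lam mu : List ℕ} (Pl : IsPartition lam) (Pμ : IsPartition mu) (m⊆l : mu ⊆ₚ lam) where

  N : ℕ
  N = length lam

  as bs : List ℕ
  as = beadList N lam
  bs = beadList N mu

  beadList-unique : ∀ {α} → IsPartition α → Unique (beadList N α)
  beadList-unique {α} P = unique-map-on (bead N α) (unique-range 1 N) λ {i} {i′} p p′ e → same i i′ (∈-range⁻ 1 N p)
      (∈-range⁻ 1 N p′) e
    where
    same : ∀ i i′ → 1 ≤ i × i < suc N → 1 ≤ i′ × i′ < suc N → bead N α i ≡ bead N α i′ → i ≡ i′
    same i i′ (a , b) (a′ , b′) e with <-cmp i i′
    ... | tri< l _ _ = ⊥-elim (<⇒≢ (bead-strict {N} P a l (≤-pred b′)) (sym e))
    ... | tri≈ _ l _ = l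
    ... | tri> _ _ l = ⊥-elim (<⇒≢ (bead-strict {N} P a′ l (≤-pred b)) e)

  -- μ brought to the N rows of λ by adding or dropping trailing zeros, since `jacobi-trudi`
  -- compares lists of equal length.
  ms : List ℕ
  ms = map (row mu) (range 1 N)

  length-ms : length ms ≡ N
  length-ms = trans (length-map (row mu) (range 1 N)) (length-range 1 N)

  row-ms : ∀ i → row ms i ≡ row mu i
  row-ms zero    = refl
  row-ms (suc i) with suc i ≤? N
  ... | yes p = row-map-range (row mu) 1 N i p
  ... | no  p = trans (row-beyond ms (suc i) (subst (_< suc i) (sym length-ms) (≰⇒> p)))
    (sym (n≤0⇒n≡0 (subst (row mu (suc i) ≤_) (row-beyond lam (suc i) (≰⇒> p)) (m⊆l (suc i)))))

  cells-ms : cells (lam , mu) ≡ cells (lam , ms)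
  cells-ms = cong concat (map-cong (λ i → cong (λ b → map (i ,_) (between b (row lam i))) (sym (row-ms i)))
      (between 0 N))

  beads-ms : beads ms ≡ bs
  beads-ms = trans (sym (beadList≡beads ms)) (trans (cong (λ n → beadList n ms) length-ms)
    (map-cong (λ i → cong (_+ (N ∸ i)) (row-ms i)) (range 1 N)))

  count-cells : List Cell → ℕ → ℕ
  count-cells cs t = length (filter (λ f → T? (isSSYT cs f)) (fillings t (length cs)))

  ssytCount≡det : ∀ t → ℕtoℚ (ssytCount lam mu t) ≡ detL (map (kernℚ t) bs) as
  ssytCount≡det t = begin
    ℕtoℚ (count-cells (cells (lam , mu)) t)   ≡⟨ cong (λ cs → ℕtoℚ (count-cells cs t)) cells-ms ⟩
    ℕtoℚ (ssytCount lam ms t)                 ≡⟨ jacobi-trudi t (row lam 1) lam ms (top Pl) bound length-ms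
                                                   (pointwise-row length-ms
                                                       (λ i → subst (_≤ row lam i) (sym (row-ms i)) (m⊆l i))) ⟩
    detL (map (kernℚ t) (beads ms)) (beads lam) ≡⟨ cong₂ (λ u v → detL (map (kernℚ t) u) v) beads-ms
        (sym (beadList≡beads lam)) ⟩
    detL (map (kernℚ t) bs) as                ∎
    where
    top : ∀ {ls} → IsPartition ls → Linked _≥_ (row ls 1 ∷ ls)
    top []      = [-]
    top [-]     = ≤-refl ∷ [-]
    top (p ∷ l) = ≤-refl ∷ (p ∷ l)
    bound : Linked _≥_ (row lam 1 ∷ ms)
    bound = linked-from-rows (row lam 1 ∷ ms) λ where
      zero    → subst (_≤ row lam 1) (sym (row-ms 1)) (m⊆l 1)
      (suc i) → subst₂ _≤_ (sym (row-ms (suc (suc i)))) (sym (row-ms (suc i))) (row-antitone Pμ (s≤s z≤n) (n≤1+n _))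

  module Matching (I : List (ℕ × ℕ)) (lt : All (λ p → proj₁ p < proj₂ p) I)
    (uw : Unique (map proj₁ I)) (uy : Unique (map proj₂ I))
    (nc : ∀ {p p′} → p ∈ I → p′ ∈ I → ¬ ((proj₁ p < proj₁ p′) × (proj₁ p′ < proj₂ p) × (proj₂ p < proj₂ p′)))
    (starts : ∀ {w} → w ∈ map proj₁ I → w ∈ bs × w ∉ as)
    (finishes : ∀ {y} → y ∈ map proj₂ I → y ∈ as × y ∉ bs)
    {D} (dec : IsBSDecomposition lam mu D) (lenD : length D ≡ length I) where

    ws ys : List ℕ
    ws = map proj₁ I
    ys = map proj₂ I

    w≢y : ∀ {p p′} → p ∈ I → p′ ∈ I → proj₁ p ≢ proj₂ p′
    w≢y p∈ p′∈ e = proj₂ (starts (∈-map⁺ proj₁ p∈)) (subst (_∈ as) (sym e) (proj₁ (finishes (∈-map⁺ proj₂ p′∈))))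

    open Greedy N Pμ I uw uy w≢y nc

    -- `Ends` finds every start of `I` among the starts of the decomposition, which has as many
    -- strips as `I` has pairs. So the starts agree up to order, likewise the ends, and
    -- `cover-unique` applies. This is the initial invariant of `greedy-sign`.
    covered : ∀ x → cnt as x ≡ cover I x + cnt bs x
    covered x = go (decomposition-cover {lam} {mu} m⊆l dec)
      where
      go : (∃ λ E → length E ≡ length D × All (λ e → proj₁ e < proj₂ e) E × (∀ x → cnt as x ≡ cover E x + cnt bs x)) →
           cnt as x ≡ cover I x + cnt bs x
      go (E , len , ltE , cov) = trans (cov x) (cong (_+ cnt bs x) (sym (cover-unique ltE lt
          (unique-↭ uw (λ p → let a , b = starts p in start-∈ a b) (lengths proj₁ proj₁))
          (unique-↭ uy (λ p → let a , b = finishes p in end-∈ a b) (lengths proj₂ proj₂)) x)))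
        where
        open Ends {as} {bs} ltE cov
        lengths : (f g : ℕ × ℕ → ℕ) → length (map f E) ≡ length (map g I)
        lengths f g = trans (length-map f E) (trans len (trans lenD (sym (length-map g I))))

    rest : ∃ λ C → as ↭ ys ++ C
    rest = unique-⊆-↭ uy (λ p → proj₁ (finishes p))

    -- The unmatched beads of λ; they index the unit rows at t = 0.
    C : List ℕ
    C = proj₁ rest

    as↭ : as ↭ C ++ ys
    as↭ = ↭-trans (proj₂ rest) (++-comm ys C)

    unique-C++ys : Unique (C ++ ys)
    unique-C++ys = Permₛ.Unique-resp-↭ (setoid ℕ) (↭⇒↭ₛ as↭) (beadList-unique Pl)

    C∌ys : ∀ {xs zs : List ℕ} → Unique (xs ++ zs) → ∀ {c} → c ∈ xs → c ∉ zs
    C∌ys {x ∷ xs} (n ∷ u) (aHere refl) q = All¬⇒¬Any n (∈-++⁺ʳ xs q)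
    C∌ys {x ∷ xs} (n ∷ u) (aThere p)   q = C∌ys u p q

    φ-bs : map φ bs ≡ bs
    φ-bs = trans (map-cong-∈ bs (λ p → partner-∉ (λ q → proj₂ (finishes q) p))) (map-id bs)

    φ-C : map φ C ≡ C
    φ-C = trans (map-cong-∈ C (λ p → partner-∉ (C∌ys unique-C++ys p))) (map-id C)

    φ-ys : map φ ys ≡ ws
    φ-ys = trans (sym (map-∘ I)) (map-cong-∈ I (partner-∈ uy))

    sign-flip : ∀ z {a b} → a ≡ sgn z * b → b ≡ sgn z * a
    sign-flip z {a} {b} e = begin
      b                    ≡⟨ ℚ.*-identityˡ b ⟨
      1ℚ * b               ≡⟨ cong (_* b) (sgn*sgn z) ⟨
      sgn z * sgn z * b    ≡⟨ ℚ.*-assoc (sgn z) (sgn z) b ⟩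
      sgn z * (sgn z * b)  ≡⟨ cong (sgn z *_) e ⟨
      sgn z * a            ∎

    rows-alternating : (k : ℕ → ℕ → ℚ) → Alternating (λ us → detL (map k us) as)
    rows-alternating k us x y vs rewrite map-++ k us (x ∷ y ∷ vs) | map-++ k us (y ∷ x ∷ vs) =
      detL-alternating-rows as (map k us) (k x) (k y) (map k vs)

    -- After relabelling, each row stands at the place of its own column, so one permutation of both
    -- brings the pairs to the end without a sign.
    matched : (k : ℕ → ℕ → ℚ) → detL (map k (map φ as)) as ≡ detL (map k C ++ map k ws) (C ++ ys)
    matched k = begin
      detL (map k (map φ as)) as
        ≡⟨ cong₂ detL (trans (sym (map-∘ as)) (map-∘ as)) (trans (sym (map-id as)) (map-∘ as)) ⟩
      detL (map (k ∘ proj₁) (map pair as)) (map proj₂ (map pair as))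
        ≡⟨ detL-↭ k (↭-map⁺ pair as↭) ⟩
      detL (map (k ∘ proj₁) (map pair (C ++ ys))) (map proj₂ (map pair (C ++ ys)))
        ≡⟨ cong₂ detL (trans (sym (map-∘ (C ++ ys))) (trans (map-∘ (C ++ ys))
            (cong (map k) (trans (map-++ φ C ys) (cong₂ _++_ φ-C φ-ys)))))
             (trans (sym (map-∘ (C ++ ys))) (map-id (C ++ ys))) ⟩
      detL (map k (C ++ ws)) (C ++ ys)
        ≡⟨ cong (λ fs → detL fs (C ++ ys)) (map-++ k C ws) ⟩
      detL (map k C ++ map k ws) (C ++ ys) ∎
      where
      pair : ℕ → ℕ × ℕ
      pair a = φ a , a

    lowest : ℕ → ℚ
    lowest t = detL (map (kernℚ t) C ++ map (kernDiv t) ws) (C ++ ys)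

    -- `greedy-sign` ends at the beads of μ, which `φ` fixes, and its sign is its own inverse. Each
    -- row at a start w is divisible by t on all columns, since w is no bead of λ.
    factor : ∀ {G} → GreedyDec mu lam G → ∀ t →
      ℕtoℚ (ssytCount lam mu t) ≡ power (ℕtoℚ t) (length I) * (sgn (zOf G) * lowest t)
    factor {G} g t = begin
      ℕtoℚ (ssytCount lam mu t)                         ≡⟨ ssytCount≡det t ⟩
      detL (map (kernℚ t) bs) as
        ≡⟨ sign-flip (zOf G) (trans (greedy-sign Pl (row-beyond lam) g I (λ p → p) covered
            (λ us → detL (map (kernℚ t) us) as) (rows-alternating (kernℚ t)))
             (cong (λ us → sgn (zOf G) * detL (map (kernℚ t) us) as) φ-bs)) ⟩
      sgn (zOf G) * detL (map (kernℚ t) (map φ as)) as  ≡⟨ cong (sgn (zOf G) *_) (matched (kernℚ t)) ⟩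
      sgn (zOf G) * detL (map (kernℚ t) C ++ map (kernℚ t) ws) (C ++ ys)
        ≡⟨ cong (sgn (zOf G) *_) (detL-scale (ℕtoℚ t) (kernℚ t) (kernDiv t) (map (kernℚ t) C) ws (_∈ as)
             (All.tabulate (∈-resp-↭ (↭-sym as↭)))
             (λ {w} {x} w∈ x∈ → kern≡t*kernDiv t w x (λ e → proj₂ (starts w∈) (subst (_∈ as) (sym e) x∈)))) ⟩
      sgn (zOf G) * (power (ℕtoℚ t) (length ws) * lowest t)
        ≡⟨ solve 3 (λ s p l → s :* (p :* l) := p :* (s :* l)) refl (sgn (zOf G)) (power (ℕtoℚ t) (length ws))
            (lowest t) ⟩
      power (ℕtoℚ t) (length ws) * (sgn (zOf G) * lowest t)
        ≡⟨ cong (λ n → power (ℕtoℚ t) n * (sgn (zOf G) * lowest t)) (length-map proj₁ I) ⟩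
      power (ℕtoℚ t) (length I) * (sgn (zOf G) * lowest t) ∎

    polynomial-lowest : Polynomial lowest
    polynomial-lowest = polynomial-cong (λ t → cong (λ fs → detL fs (C ++ ys))
        (trans (map-++ (λ f → f t) (map (λ c t → kernℚ t c) C) (map (λ w t → kernDiv t w) ws))
          (cong₂ _++_ (sym (map-∘ C)) (sym (map-∘ ws)))))
      (polynomial-detL (map (λ c t → kernℚ t c) C ++ map (λ w t → kernDiv t w) ws) poly (C ++ ys))
      where
      poly : ∀ {f} → f ∈ map (λ c t → kernℚ t c) C ++ map (λ w t → kernDiv t w) ws → ∀ x → Polynomial (λ t → f t x)
      poly p x with ∈-++⁻ (map (λ c t → kernℚ t c) C) p
      ... | inj₁ q with c , _ , refl ← ∈-map⁻ (λ c t → kernℚ t c) q = polynomial-kern c x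
      ... | inj₂ q with w , _ , refl ← ∈-map⁻ (λ w t → kernDiv t w) q = polynomial-kernDiv w x

    lowest-0 : lowest 0 ≡ detL (map inverseDifference ws) ys
    lowest-0 = begin
      lowest 0                          ≡⟨ detL-diagonal (kernℚ 0) (map (kernDiv 0) ws) C unique-C++ys
                                             (λ c → cong ℕtoℚ (kern-diag 0 c))
                                                 (λ ne → cong ℕtoℚ (kern-0 (ne ∘ sym))) ⟩
      detL (map (kernDiv 0) ws) ys      ≡⟨ cong (detL (map (kernDiv 0) ws)) (map-id ys) ⟨
      detL (map (kernDiv 0) ws) (map (λ y → y) ys)
        ≡⟨ detL-map (λ y → y) (kernDiv 0) inverseDifference ws (λ _ → ⊤) (All.universal (λ _ → tt) ys)
            (λ {w} {y} _ _ → kernDiv-0 w y) ⟩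
      detL (map inverseDifference ws) ys ∎

-- From indices of the snake sequence to positions

shift-back : ∀ {s x u} → suc x ≡ s + u → x ≡ pred (s + u)
shift-back e = cong pred e

module Translate (s : ℕ) where

  -- Letters are numbered from 1 and the path starts at position s. For u at least 1 this is a
  -- translation, so the differences y - w are unchanged.
  sh : ℕ → ℕ
  sh u = pred (s + u)

  suc-sh : ∀ {u} → 1 ≤ u → suc (sh u) ≡ s + u
  suc-sh {u} p with s + u in e
  ... | suc n = refl
  ... | zero  = ⊥-elim (m<n⇒n≢0 (≤-trans p (m≤n+m u s)) e)

  sh-mono : ∀ {u v} → 1 ≤ u → 1 ≤ v → u < v → sh u < sh v
  sh-mono p q l = ≤-pred (subst₂ _<_ (sym (suc-sh p)) (sym (suc-sh q)) (+-monoʳ-< s l))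

  sh-cancel : ∀ {u v} → sh u < sh v → u < v
  sh-cancel {u} {v} l = +-cancelˡ-< s u v (pred-cancel-< l)

  sh-injective : ∀ {u v} → 1 ≤ u → 1 ≤ v → sh u ≡ sh v → u ≡ v
  sh-injective {u} {v} p q e = +-cancelˡ-≡ s u v (trans (sym (suc-sh p)) (trans (cong suc e) (suc-sh q)))

  inverseDifference-sh : ∀ {u v} → 1 ≤ u → 1 ≤ v → inverseDifference (sh u) (sh v) ≡ inverseDifference u v
  inverseDifference-sh {u} {v} p q = trans (cong₂ inverseDifference (suc-sh p) (suc-sh q)) (inverseDifference-+ s u v)

  shPair : ℕ × ℕ → ℕ × ℕ
  shPair (u , v) = sh u , sh v

det-dMatrix : ∀ {r} (I : Vec (ℕ × ℕ) r) → det r (dMatrix I) ≡ detL (map inverseDifference (map proj₁ (toList I)))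
    (map proj₂ (toList I))
det-dMatrix {r} I = trans (det≡detL r (λ i → inverseDifference (proj₁ (lookup I i))) (λ j → proj₂ (lookup I j)))
  (cong₂ detL (trans (tabulate-lookup (inverseDifference ∘ proj₁) I) (map-∘ (toList I))) (tabulate-lookup proj₂ I))

theorem4p3 : (lam mu : List ℕ) → IsPartition lam → IsPartition mu → mu ⊆ₚ lam →
    (r : ℕ) → IsRank lam mu r →
    (G : List (List ℕ × List ℕ)) → GreedyDec mu lam G →
    (I : Vec (ℕ × ℕ) r) → IsNoncrossingIntervalSet lam mu r I →
    Σ (List ℚ) (λ p →
    ((t : ℕ) → evalP p (ℕtoℚ t) ≡ ℕtoℚ (ssytCount lam mu t))
    × ((i : ℕ) → i < r → coeff p i ≡ 0ℚ)
    × (coeff p r ≡ sgn (zOf G) * det r (dMatrix I)))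
theorem4p3 lam mu Pl Pμ m⊆l r ((D , lenD , dec) , _) G g I ((props , uu , uv , _) , nc) =
  -- The polynomial is t^r times q, so the coefficient at r is the constant term of q.
  shiftP r q ,
  (λ t → begin
    evalP (shiftP r q) (ℕtoℚ t)                    ≡⟨ evalP-shift r q (ℕtoℚ t) ⟩
    power (ℕtoℚ t) r * evalP q (ℕtoℚ t)            ≡⟨ cong₂ (λ n e → power (ℕtoℚ t) n * e) (sym lenJ) (proj₂ poly t) ⟩
    power (ℕtoℚ t) (length J) * (sgn (zOf G) * lowest t)  ≡⟨ factor g t ⟨
    ℕtoℚ (ssytCount lam mu t)                      ∎) ,
  (λ i → coeff-shift-< r q) ,
  (begin
    coeff (shiftP r q) r                           ≡⟨ coeff-shift r q ⟩
    coeff q 0                                      ≡⟨ coeff-0 q ⟩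
    evalP q (ℕtoℚ 0)                               ≡⟨ proj₂ poly 0 ⟩
    sgn (zOf G) * lowest 0                         ≡⟨ cong (sgn (zOf G) *_) lowest-0 ⟩
    sgn (zOf G) * detL (map inverseDifference (map proj₁ J)) (map proj₂ J)  ≡⟨ cong (sgn (zOf G) *_) translated ⟩
    sgn (zOf G) * det r (dMatrix I)                ∎)
  where
  letters = Snakes.letter-beads Pl Pμ m⊆l
  open Translate (proj₁ letters)
  open Beads Pl Pμ m⊆l using (as; bs; module Matching)
  il J : List (ℕ × ℕ)
  il = toList I
  J = map shPair il
  lenJ : length J ≡ r
  lenJ = trans (length-map shPair il) (length-toList I)
  1≤u : ∀ {p} → p ∈ il → 1 ≤ proj₁ p
  1≤u p∈ = proj₁ (All.lookup props p∈)
  u<v : ∀ {p} → p ∈ il → proj₁ p < proj₂ p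
  u<v p∈ = proj₁ (proj₂ (All.lookup props p∈))
  1≤v : ∀ {p} → p ∈ il → 1 ≤ proj₂ p
  1≤v p∈ = ≤-trans (1≤u p∈) (<⇒≤ (u<v p∈))
  firsts : map proj₁ J ≡ map sh (map proj₁ il)
  firsts = trans (sym (map-∘ il)) (map-∘ il)
  seconds : map proj₂ J ≡ map sh (map proj₂ il)
  seconds = trans (sym (map-∘ il)) (map-∘ il)
  positive₁ : ∀ {u} → u ∈ map proj₁ il → 1 ≤ u
  positive₁ u∈ with p , p∈ , refl ← ∈-map⁻ proj₁ u∈ = 1≤u p∈
  positive₂ : ∀ {v} → v ∈ map proj₂ il → 1 ≤ v
  positive₂ v∈ with p , p∈ , refl ← ∈-map⁻ proj₂ v∈ = 1≤v p∈
  lt : All (λ p → proj₁ p < proj₂ p) J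
  lt = All.tabulate less
    where
    less : ∀ {p} → p ∈ J → proj₁ p < proj₂ p
    less p∈ with q , q∈ , refl ← ∈-map⁻ shPair p∈ = sh-mono (1≤u q∈) (1≤v q∈) (u<v q∈)
  uw : Unique (map proj₁ J)
  uw = subst Unique (sym firsts) (unique-map-on sh uu (λ a b → sh-injective (positive₁ a) (positive₁ b)))
  uy : Unique (map proj₂ J)
  uy = subst Unique (sym seconds) (unique-map-on sh uv (λ a b → sh-injective (positive₂ a) (positive₂ b)))
  nc′ : ∀ {p p′} → p ∈ J → p′ ∈ J → ¬ ((proj₁ p < proj₁ p′) × (proj₁ p′ < proj₂ p) × (proj₂ p < proj₂ p′))
  nc′ p∈ p′∈ (a , b , c) with q , q∈ , refl ← ∈-map⁻ shPair p∈ | q′ , q′∈ , refl ← ∈-map⁻ shPair p′∈ =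
    nc q q′ q∈ q′∈ (sh-cancel a , sh-cancel b , sh-cancel c)
  starts : ∀ {w} → w ∈ map proj₁ J → w ∈ bs × w ∉ as
  starts {w} w∈ with p , p∈ , refl ← ∈-map⁻ proj₁ w∈ with q , q∈ , refl ← ∈-map⁻ shPair p∈
    with x , e , a , b ← proj₁ (proj₂ letters) (proj₁ q) (proj₁ (proj₂ (proj₂ (proj₂ (All.lookup props q∈)))))
    with refl ← shift-back {proj₁ letters} e = a , b
  finishes : ∀ {y} → y ∈ map proj₂ J → y ∈ as × y ∉ bs
  finishes {y} y∈ with p , p∈ , refl ← ∈-map⁻ proj₂ y∈ with q , q∈ , refl ← ∈-map⁻ shPair p∈
    with x , e , a , b ← proj₂ (proj₂ letters) (proj₂ q) (proj₂ (proj₂ (proj₂ (proj₂ (All.lookup props q∈)))))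
    with refl ← shift-back {proj₁ letters} e = a , b
  open Matching J lt uw uy nc′ starts finishes {D} dec (trans lenD (sym lenJ))
  poly : Polynomial (λ t → sgn (zOf G) * lowest t)
  poly = polynomial-* (polynomial-const (sgn (zOf G))) polynomial-lowest
  q : List ℚ
  q = proj₁ poly
  translated : detL (map inverseDifference (map proj₁ J)) (map proj₂ J) ≡ det r (dMatrix I)
  translated = begin
    detL (map inverseDifference (map proj₁ J)) (map proj₂ J)
      ≡⟨ cong₂ (λ us vs → detL (map inverseDifference us) vs) firsts seconds ⟩
    detL (map inverseDifference (map sh (map proj₁ il))) (map sh (map proj₂ il))
      ≡⟨ cong (λ fs → detL fs (map sh (map proj₂ il))) (map-∘ (map proj₁ il)) ⟨
    detL (map (inverseDifference ∘ sh) (map proj₁ il)) (map sh (map proj₂ il))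
      ≡⟨ detL-map sh (inverseDifference ∘ sh) inverseDifference (map proj₁ il) (1 ≤_) (All.tabulate positive₂)
           (λ u∈ 1≤v′ → inverseDifference-sh (positive₁ u∈) 1≤v′) ⟩
    detL (map inverseDifference (map proj₁ il)) (map proj₂ il)   ≡⟨ det-dMatrix I ⟨
    det r (dMatrix I) ∎
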